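{- Let $K=K(x,\theta;y,\phi)$ be the bi-symmetric formal superfunction $$K:=\prod_{i,j\ge1}\frac1{1-x_iy_j-\theta_i\phi_j}.$$ Then $$K=\sum_{\Lambda}z_\Lambda^{ -1}\,\overleftarrow{p_\Lambda(x,\theta)}\;p_\Lambda(y,\phi),$$ the sum running over all superpartitions $\Lambda$.
   Context: $x_i,y_j$ ($i,j\ge1$) are commuting variables; $\theta_i,\phi_j$ are mutually anticommuting variables (each squares to zero, any two of them anticommute), commuting with the $x_i,y_j$. A superpartition of $(n|m)$ is $\Lambda=(\Lambda^a;\Lambda^s)=(\Lambda_1,\dots,\Lambda_m;\Lambda_{m+1},\Lambda_{m+2},\dots)$ with nonnegative integer entries, $\Lambda_1>\dots>\Lambda_m\ge 0$, $\Lambda_{m+1}\ge\Lambda_{m+2}\ge\dots\ge0$ (finitely many nonzero; trailing zeros of $\Lambda^s$ ignored) and $\sum_i\Lambda_i=n$; $\ell(\Lambda)=m+\#\{\text{nonzero parts of }\Lambda^s\}$. $p_n(x)=\sum_i x_i^n$ ($n\ge1$), $\tilde p_n(x,\theta)=\sum_i\theta_ix_i^n$ ($n\ge0$), $p_\Lambda=\tilde p_{\Lambda_1}\cdots\tilde p_{\Lambda_m}\,p_{\Lambda_{m+1}}\cdots p_{\Lambda_{\ell(\Lambda)}}$. For $f(x,\theta)$ homogeneous of degree $m$ in $\theta$, $\overleftarrow{f}=(-1)^{m(m-1)/2}f$ (reversal of the order of the $\theta$'s). $z_\Lambda=\prod_{k\ge1}k^{n_k}n_k!$ where $n_k$ is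 the number of parts of $\Lambda^s$ equal to $k$. -}

module Defs where

open import Algebra.Definitions using (Invertible)
open import Data.Bool using (Bool; true; false; _∧_; if_then_else_)
import Data.Bool.Properties as Bool
open import Data.Integer using (+_)
open import Data.List using (List; []; _∷_; _++_; [_]; _∷ʳ_; map; foldr; length; filter; replicate; upTo; cartesianProduct; cartesianProductWith)
open import Data.List.Properties using (map-++; map-∘; map-cong; length-++)
open import Data.List.Relation.Binary.Subset.Propositional using (_⊆_)
open import Data.List.Relation.Unary.All as All using (All)
import Data.List.Relation.Unary.All.Properties as All
open import Data.List.Relation.Unary.Linked using (Linked)
open import Data.List.Relation.Unary.Unique.Propositional using (Unique)
open import Data.Nat as ℕ using (ℕ; zero; suc; NonZero; _∸_; _^_; _!; _>_; _≥_)
open import Data.Nat.DivMod using (_/_)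
open import Data.Nat.ListAction using (sum; product)
open import Data.Nat.ListAction.Properties using (product≢0)
import Data.Nat.Properties as ℕ
open import Data.Product using (Σ-syntax; _×_; _,_; proj₁)
open import Data.Rational as ℚ using (ℚ; 0ℚ; 1ℚ)
import Data.Rational.Properties as ℚ
open import Function using (_∘_)
open import Relation.Binary.Definitions using (DecidableEquality)
open import Relation.Binary.PropositionalEquality using (_≡_; _≢_; refl; sym; trans; cong; cong₂; module ≡-Reasoning)
open import Relation.Nullary using (does)
open import Relation.Nullary.Decidable using (map′; _×-dec_; dec-false)

-- Exponents of xᵢ, yᵢ, θᵢ, φᵢ for one value of i.
record Exponents : Set where
  constructor exps
  field
    xᵉ yᵉ : ℕ
    θᵉ φᵉ : Bool

open Exponents public

𝟘 : Exponents
𝟘 = exps 0 0 false false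

_≟ᵉ_ : DecidableEquality Exponents
exps a b s t ≟ᵉ exps a′ b′ s′ t′ =
  map′ (λ { (refl , refl , refl , refl) → refl })
       (λ { refl → refl , refl , refl , refl })
       (a ℕ.≟ a′ ×-dec b ℕ.≟ b′ ×-dec s Bool.≟ s′ ×-dec t Bool.≟ t′)

-- The list  e₀ ∷ e₁ ∷ … ∷ eₙ₋₁ ∷ []  stands for the normally ordered monomial
--   ∏ᵢ xᵢ^(xᵉ eᵢ) yᵢ^(yᵉ eᵢ)  ·  θ₀^(θᵉ e₀) φ₀^(φᵉ e₀) θ₁^(θᵉ e₁) φ₁^(φᵉ e₁) ⋯
-- in infinitely many variables of each kind, indexed from 0.  Variables of
-- index ≥ n have exponent 0, so lists differing only by trailing 𝟘's stand for
-- the same monomial.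
Monomial : Set
Monomial = List Exponents

sameMonomial : Monomial → Monomial → Bool
sameMonomial []      []      = true
sameMonomial []      (d ∷ l) = does (𝟘 ≟ᵉ d) ∧ sameMonomial [] l
sameMonomial (c ∷ m) []      = does (c ≟ᵉ 𝟘) ∧ sameMonomial m []
sameMonomial (c ∷ m) (d ∷ l) = does (c ≟ᵉ d) ∧ sameMonomial m l

bit : Bool → ℕ
bit b = if b then 1 else 0

oddDegree : Monomial → ℕ
oddDegree []      = 0
oddDegree (c ∷ m) = bit (θᵉ c) ℕ.+ bit (φᵉ c) ℕ.+ oddDegree m

θ-degree : Monomial → ℕ
θ-degree []      = 0
θ-degree (c ∷ m) = bit (θᵉ c) ℕ.+ θ-degree m

-- Number of pairs (odd variable u of a, odd variable v of b) with v before u in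
-- the order θ₀ φ₀ θ₁ φ₁ ⋯ , i.e. of transpositions that put the juxtaposition
-- a b in normal order.
crossings : Monomial → Monomial → ℕ
crossings []      _       = 0
crossings (_ ∷ _) []      = 0
crossings (c ∷ a) (d ∷ b) =
  bit (φᵉ c) ℕ.* bit (θᵉ d) ℕ.+ oddDegree a ℕ.* (bit (θᵉ d) ℕ.+ bit (φᵉ d)) ℕ.+ crossings a b

-- All factorisations of a monomial, up to sign, into two monomials.

splitℕ : ℕ → List (ℕ × ℕ)
splitℕ n = map (λ k → k , n ∸ k) (upTo (suc n))

splitBool : Bool → List (Bool × Bool)
splitBool false = [ false , false ]
splitBool true  = (true , false) ∷ (false , true) ∷ []

splitExps : Exponents → List (Exponents × Exponents)
splitExps (exps a b s t) =
  cartesianProductWith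
    (λ { ((a₁ , a₂) , (b₁ , b₂)) ((s₁ , s₂) , (t₁ , t₂)) → exps a₁ b₁ s₁ t₁ , exps a₂ b₂ s₂ t₂ })
    (cartesianProduct (splitℕ a) (splitℕ b))
    (cartesianProduct (splitBool s) (splitBool t))

consPair : Exponents × Exponents → Monomial × Monomial → Monomial × Monomial
consPair (c , d) (a , b) = c ∷ a , d ∷ b

splits : Monomial → List (Monomial × Monomial)
splits []      = [ [] , [] ]
splits (c ∷ m) = cartesianProductWith consPair (splitExps c) (splits m)

-- Formal power series over ℚ: functions on lists that do not depend on trailing
-- 𝟘's, i.e. arbitrary functions on monomials.
record Series : Set where
  constructor series
  field
    coeff    : Monomial → ℚ
    coherent : ∀ m → coeff (m ∷ʳ 𝟘) ≡ coeff m

open Series public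

infix 4 _≈_
_≈_ : Series → Series → Set
f ≈ g = ∀ m → coeff f m ≡ coeff g m

sign : ℕ → ℚ
sign zero    = 1ℚ
sign (suc n) = ℚ.- sign n

Σℚ : List ℚ → ℚ
Σℚ = foldr ℚ._+_ 0ℚ

sameMonomial-∷ʳ : ∀ m l → sameMonomial m (l ∷ʳ 𝟘) ≡ sameMonomial m l
sameMonomial-∷ʳ []      []      = refl
sameMonomial-∷ʳ []      (d ∷ l) = cong (does (𝟘 ≟ᵉ d) ∧_) (sameMonomial-∷ʳ [] l)
sameMonomial-∷ʳ (c ∷ m) []      = refl
sameMonomial-∷ʳ (c ∷ m) (d ∷ l) = cong (does (c ≟ᵉ d) ∧_) (sameMonomial-∷ʳ m l)

oddDegree-∷ʳ : ∀ m → oddDegree (m ∷ʳ 𝟘) ≡ oddDegree m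
oddDegree-∷ʳ []      = refl
oddDegree-∷ʳ (c ∷ m) = cong (bit (θᵉ c) ℕ.+ bit (φᵉ c) ℕ.+_) (oddDegree-∷ʳ m)

θ-degree-∷ʳ : ∀ m → θ-degree (m ∷ʳ 𝟘) ≡ θ-degree m
θ-degree-∷ʳ []      = refl
θ-degree-∷ʳ (c ∷ m) = cong (bit (θᵉ c) ℕ.+_) (θ-degree-∷ʳ m)

crossings-[]ʳ : ∀ a → crossings a [] ≡ 0
crossings-[]ʳ []      = refl
crossings-[]ʳ (_ ∷ _) = refl

crossings-∷ʳ : ∀ a b → crossings (a ∷ʳ 𝟘) (b ∷ʳ 𝟘) ≡ crossings a b
crossings-∷ʳ []      []      = refl
crossings-∷ʳ []      (d ∷ b) = refl
crossings-∷ʳ (c ∷ a) []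
  rewrite crossings-[]ʳ (a ∷ʳ 𝟘) | ℕ.*-zeroʳ (bit (φᵉ c)) | ℕ.*-zeroʳ (oddDegree (a ∷ʳ 𝟘)) = refl
crossings-∷ʳ (c ∷ a) (d ∷ b) rewrite oddDegree-∷ʳ a | crossings-∷ʳ a b = refl

snocPair : Monomial × Monomial → Monomial × Monomial
snocPair (a , b) = a ∷ʳ 𝟘 , b ∷ʳ 𝟘

cartesianProductWith-snoc : ∀ es ms →
  cartesianProductWith consPair es (map snocPair ms) ≡ map snocPair (cartesianProductWith consPair es ms)
cartesianProductWith-snoc []       ms = refl
cartesianProductWith-snoc (e ∷ es) ms = begin
  map (consPair e) (map snocPair ms) ++ cartesianProductWith consPair es (map snocPair ms)
    ≡⟨ cong₂ _++_ (trans (sym (map-∘ ms)) (map-∘ ms)) (cartesianProductWith-snoc es ms) ⟩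
  map snocPair (map (consPair e) ms) ++ map snocPair (cartesianProductWith consPair es ms)
    ≡⟨ map-++ snocPair (map (consPair e) ms) _ ⟨
  map snocPair (map (consPair e) ms ++ cartesianProductWith consPair es ms) ∎
  where open ≡-Reasoning

splits-∷ʳ : ∀ m → splits (m ∷ʳ 𝟘) ≡ map snocPair (splits m)
splits-∷ʳ []      = refl
splits-∷ʳ (c ∷ m) =
  trans (cong (cartesianProductWith consPair (splitExps c)) (splits-∷ʳ m))
        (cartesianProductWith-snoc (splitExps c) (splits m))

monomial : Monomial → Series
monomial m .coeff    l = if sameMonomial m l then 1ℚ else 0ℚ
monomial m .coherent l = cong (if_then 1ℚ else 0ℚ) (sameMonomial-∷ʳ m l)

0# 1# : Series
0# = series (λ _ → 0ℚ) (λ _ → refl)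
1# = monomial []

infixl 6 _+_ _-_
infixl 7 _*_
infixr 8 _•_

_+_ : Series → Series → Series
(f + g) .coeff    m = coeff f m ℚ.+ coeff g m
(f + g) .coherent m = cong₂ ℚ._+_ (coherent f m) (coherent g m)

_-_ : Series → Series → Series
(f - g) .coeff    m = coeff f m ℚ.- coeff g m
(f - g) .coherent m = cong₂ ℚ._-_ (coherent f m) (coherent g m)

_•_ : ℚ → Series → Series
(q • f) .coeff    m = q ℚ.* coeff f m
(q • f) .coherent m = cong (q ℚ.*_) (coherent f m)

productTerm : Series → Series → Monomial × Monomial → ℚ
productTerm f g (a , b) = sign (crossings a b) ℚ.* (coeff f a ℚ.* coeff g b)

productTerm-snoc : ∀ f g ab → productTerm f g (snocPair ab) ≡ productTerm f g ab
productTerm-snoc f g (a , b) =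
  cong₂ ℚ._*_ (cong sign (crossings-∷ʳ a b)) (cong₂ ℚ._*_ (coherent f a) (coherent g b))

_*_ : Series → Series → Series
(f * g) .coeff    m = Σℚ (map (productTerm f g) (splits m))
(f * g) .coherent m = cong Σℚ (begin
  map (productTerm f g) (splits (m ∷ʳ 𝟘))          ≡⟨ cong (map (productTerm f g)) (splits-∷ʳ m) ⟩
  map (productTerm f g) (map snocPair (splits m))  ≡⟨ map-∘ (splits m) ⟨
  map (productTerm f g ∘ snocPair) (splits m)      ≡⟨ map-cong (productTerm-snoc f g) (splits m) ⟩
  map (productTerm f g) (splits m)                 ∎)
  where open ≡-Reasoning

∑ ∏ : List Series → Series
∑ = foldr _+_ 0#
∏ = foldr _*_ 1#

-- Unconditional convergence for the topology of coefficientwise (eventually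
-- constant) convergence, along finite subsets of the index set I.

HasSum : {I : Set} → (I → Series) → Series → Set
HasSum {I} f s = ∀ m → Σ[ L₀ ∈ List I ] (∀ L → Unique L → L₀ ⊆ L → coeff (∑ (map f L)) m ≡ coeff s m)

HasProduct : {I : Set} → (I → Series) → Series → Set
HasProduct {I} f s = ∀ m → Σ[ L₀ ∈ List I ] (∀ L → Unique L → L₀ ⊆ L → coeff (∏ (map f L)) m ≡ coeff s m)

-- Reversal of the order of the θ's: a component of degree d in θ is multiplied
-- by (-1)^(d(d-1)/2).
reverseθ : Series → Series
reverseθ f .coeff    m = sign (θ-degree m ℕ.* (θ-degree m ∸ 1) / 2) ℚ.* coeff f m
reverseθ f .coherent m rewrite θ-degree-∷ʳ m | coherent f m = refl

at : ℕ → Exponents → Monomial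
at i e = replicate i 𝟘 ++ [ e ]

data Alphabet : Set where
  xθ yφ : Alphabet

bosonic fermionic : Alphabet → ℕ → Exponents
bosonic xθ n = exps n 0 false false
bosonic yφ n = exps 0 n false false
fermionic xθ n = exps n 0 true false
fermionic yφ n = exps 0 n false true

x y θ φ : ℕ → Series
x i = monomial (at i (bosonic xθ 1))
y i = monomial (at i (bosonic yφ 1))
θ i = monomial (at i (fermionic xθ 0))
φ i = monomial (at i (fermionic yφ 0))

Σ< : ℕ → (ℕ → ℚ) → ℚ
Σ< zero    f = 0ℚ
Σ< (suc n) f = Σ< n f ℚ.+ f n

Σ<-cong : ∀ n {f g} → (∀ i → f i ≡ g i) → Σ< n f ≡ Σ< n g
Σ<-cong zero    eq = refl
Σ<-cong (suc n) eq = cong₂ ℚ._+_ (Σ<-cong n eq) (eq n)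

at-length : ∀ {e} → e ≢ 𝟘 → ∀ m → sameMonomial (at (length m) e) (m ∷ʳ 𝟘) ≡ false
at-length {e} e≢𝟘 [] rewrite dec-false (e ≟ᵉ 𝟘) e≢𝟘 = refl
at-length {e} e≢𝟘 (c ∷ m) rewrite at-length e≢𝟘 m with does (𝟘 ≟ᵉ c)
... | true  = refl
... | false = refl

length-∷ʳ : ∀ (m : Monomial) → length (m ∷ʳ 𝟘) ≡ suc (length m)
length-∷ʳ m = trans (length-++ m) (ℕ.+-comm (length m) 1)

-- Σ_{i ∈ ℕ} of the monomials  at i e : when e ≢ 𝟘 those with i ≥ length m do not
-- contribute to the coefficient of m.
sumOverVariables : (e : Exponents) → e ≢ 𝟘 → Series
sumOverVariables e _   .coeff    m = Σ< (length m) (λ i → coeff (monomial (at i e)) m)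
sumOverVariables e e≢𝟘 .coherent m
  rewrite length-∷ʳ m
        | at-length e≢𝟘 m
        | ℚ.+-identityʳ (Σ< (length m) (λ i → coeff (monomial (at i e)) (m ∷ʳ 𝟘)))
  = Σ<-cong (length m) (λ i → coherent (monomial (at i e)) m)

bosonic≢𝟘 : ∀ a n → .{{NonZero n}} → bosonic a n ≢ 𝟘
bosonic≢𝟘 xθ (suc n) ()
bosonic≢𝟘 yφ (suc n) ()

fermionic≢𝟘 : ∀ a n → fermionic a n ≢ 𝟘
fermionic≢𝟘 xθ n ()
fermionic≢𝟘 yφ n ()

p : Alphabet → (n : ℕ) → .{{NonZero n}} → Series
p a n = sumOverVariables (bosonic a n) (bosonic≢𝟘 a n)

p̃ : Alphabet → ℕ → Series
p̃ a n = sumOverVariables (fermionic a n) (fermionic≢𝟘 a n)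

-- Only the nonzero parts of Λˢ are recorded.
record Superpartition : Set where
  field
    Λᵃ         : List ℕ
    Λˢ         : List ℕ
    Λᵃ-strict  : Linked _>_ Λᵃ
    Λˢ-weak    : Linked _≥_ Λˢ
    Λˢ-nonZero : All NonZero Λˢ

open Superpartition public

p[_] : Superpartition → Alphabet → Series
p[ Λ ] a = ∏ (map (p̃ a) (Λᵃ Λ) ++ All.reduce (λ {n} n≢0 → p a n {{n≢0}}) (Λˢ-nonZero Λ))

multiplicity : ℕ → List ℕ → ℕ
multiplicity k ns = length (filter (k ℕ.≟_) ns)

zFactor : Superpartition → ℕ → ℕ
zFactor Λ k = k ^ multiplicity k (Λˢ Λ) ℕ.* multiplicity k (Λˢ Λ) !

-- The product over k is taken over 1 ≤ k ≤ Σ Λˢ, which includes every part of Λˢ.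
z : Superpartition → ℕ
z Λ = product (map (zFactor Λ ∘ suc) (upTo (sum (Λˢ Λ))))

z≢0 : ∀ Λ → NonZero (z Λ)
z≢0 Λ = product≢0 (All.map⁺ (All.universal factor≢0 (upTo (sum (Λˢ Λ)))))
  where
  factor≢0 : ∀ k → NonZero (zFactor Λ (suc k))
  factor≢0 k = ℕ.m*n≢0 (suc k ^ n) (n !) {{ℕ.m^n≢0 (suc k) n}} {{n ℕ.!≢0}}
    where n = multiplicity (suc k) (Λˢ Λ)

z⁻¹ : Superpartition → ℚ
z⁻¹ Λ = (+ 1 ℚ./ z Λ) {{z≢0 Λ}}

denominator : ℕ × ℕ → Series
denominator (i , j) = 1# - x i * y j - θ i * φ j

-- K = ∏_{i,j} 1 / (1 - xᵢ yⱼ - θᵢ φⱼ); the factors are even, so the order of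
-- multiplication is immaterial.
IsKernel : Series → Set
IsKernel K =
  Σ[ inv ∈ (∀ ij → Invertible _≈_ 1# _*_ (denominator ij)) ] HasProduct (λ ij → proj₁ (inv ij)) K

{-# OPTIONS --safe #-}
module Submission where

-- Let E be the Euler derivation, multiplying a monomial by its degree in (x, θ).
-- With t = xᵢyⱼ + θᵢφⱼ each factor satisfies E (1 - t)⁻¹ = (Σ_{n≥0} t^(n+1)) (1 - t)⁻¹, and
-- t^(n+1) = (xᵢyⱼ)^(n+1) + (n+1) (xᵢyⱼ)^n θᵢφⱼ; summing over i and j, the logarithmic derivative of K is
--   M = Σ_{n≥0} (uₙ₊₁ + (n+1) wₙ),  uₙ = pₙ(x) pₙ(y),  wₙ = p̃ₙ(x,θ) p̃ₙ(y,φ).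
-- The right-hand side factors as ∏_{n≥0} (1 + wₙ) ∏_{k≥1} exp (uₖ / k), where the reversal sign is that
-- of p̃(x)⋯p̃(x) p̃(y)⋯p̃(y) versus ∏ w, and it has the same logarithmic derivative since wₙ² = 0.  The
-- equation E F = M F determines F from its component of degree 0, which is 1 on both sides.  Convergence
-- is handled by working with finitely many variables and modulo high degree.

open import Defs
open import Algebra.Bundles using (Ring)
open import Algebra.Definitions using (Invertible)
import Algebra.Properties.Ring as RingProperties
open import Data.Bool using (Bool; _∧_; false; if_then_else_; true)
import Data.Bool.Properties as Bool
open import Data.Empty using (⊥; ⊥-elim)
import Data.Integer as ℤ
import Data.Integer.Properties as ℤ
open import Data.List using (List; []; _++_; _∷_; _∷ʳ_; applyUpTo; cartesianProduct; cartesianProductWith; deduplicate; foldr; length; map; replicate; upTo)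
open import Data.List.Membership.Propositional using (_∈_; _∉_)
open import Data.List.Membership.Propositional.Properties using (∈-++⁺ʳ; ∈-++⁺ˡ; ∈-++⁻; ∈-cartesianProduct⁺; ∈-cartesianProduct⁻; ∈-deduplicate⁺; ∈-map⁺; ∈-map⁻; ∈-upTo⁺; ∈-upTo⁻; ∈-∃++)
open import Data.List.Properties using (++-cancelˡ; filter-accept; filter-reject; map-++; map-upTo; map-∘; upTo-∷ʳ; ∷-injectiveʳ)
open import Data.List.Relation.Binary.Permutation.Propositional using (_↭_; ↭⇒↭ₛ)
open import Data.List.Relation.Binary.Permutation.Propositional.Properties using (shift; ∈-resp-↭)
import Data.List.Relation.Binary.Permutation.Setoid.Properties as Permutation
open import Data.List.Relation.Binary.Subset.Propositional using (_⊆_)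
open import Data.List.Relation.Unary.All as All using (All; []; _∷_)
import Data.List.Relation.Unary.All.Properties as All
open import Data.List.Relation.Unary.AllPairs using (AllPairs; []; _∷_)
open import Data.List.Relation.Unary.Any using (here; there)
import Data.List.Relation.Unary.Linked as Linked
open import Data.List.Relation.Unary.Linked.Properties using (AllPairs⇒Linked; Linked⇒AllPairs)
open import Data.List.Relation.Unary.Unique.DecPropositional.Properties using (deduplicate-!)
open import Data.List.Relation.Unary.Unique.Propositional using (Unique)
open import Data.List.Relation.Unary.Unique.Propositional.Properties using (++⁺; Unique[x∷xs]⇒x∉xs; cartesianProduct⁺; map⁺; map⁻; upTo⁺)
open import Data.Nat as ℕ using (NonZero; _!; _<_; _>_; _^_; _∸_; _≤_; _≥_; suc; s≤s; zero; z≤n; ℕ)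
open import Data.Nat.DivMod using (+-distrib-/-∣ˡ; _/_; m*n/n≡m)
open import Data.Nat.Divisibility using (n∣m*n)
open import Data.Nat.ListAction using (product; sum)
open import Data.Nat.ListAction.Properties using (product-++)
import Data.Nat.Properties as ℕ
import Data.Nat.Tactic.RingSolver as ℕ-Solver
open import Data.Product using (_,_; _×_; proj₁; proj₂; uncurry; ∃; ∃-syntax)
open import Data.Product.Properties using (≡-dec)
open import Data.Rational as ℚ using (0ℚ; 1ℚ; ℚ)
import Data.Rational.Properties as ℚ
import Data.Rational.Unnormalised as ℚᵘ
import Data.Rational.Unnormalised.Properties as ℚᵘ
open import Data.Sum using (inj₁; inj₂)
open import Function using (_∘_)
open import Level using (0ℓ)
open import Relation.Binary.PropositionalEquality as ≡ using (_≡_; _≢_; cong; cong₂; module ≡-Reasoning; refl; subst; sym; trans)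
import Relation.Binary.Reasoning.Setoid as SetoidReasoning
open import Relation.Nullary using (Dec; does; no; yes)
open import Relation.Nullary.Decidable using (dec-false; dec⇒maybe)
open import Tactic.RingSolver using (solve-∀)
open import Tactic.RingSolver.Core.AlmostCommutativeRing using (AlmostCommutativeRing; fromCommutativeRing)

-- `E` has to count θ as well as x. With x alone, 1 + w₀ would be annihilated by the derivation and
-- the equation could not see that factor; counting θ makes t homogeneous of degree 1 and gives both
-- uₙ₊₁ and wₙ degree n + 1.
--
-- The series do not commute, and both the product and the sum are infinite. The equation E F = M F
-- copes with this: it is linear in F, it needs neither logarithms nor inverses of F, and it adds up
-- over products as soon as the M's are central, which holds because they are even. It determines F
-- because M has no term of degree 0 and because the degree d can be divided out in ℚ.
--
-- Convergence reduces to one observation. The factorisations of a list of length N consist of lists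
-- of length N, and degrees add along them, so a coefficient of a product depends only on
-- coefficients in the same variables and of no larger degree. For each monomial the whole
-- comparison therefore takes place in a single truncated ring, with N its length and D its degree.

private
  variable
    A B C : Set

-- Finite sums of rational numbers

ℚ-ring : AlmostCommutativeRing 0ℓ 0ℓ
ℚ-ring = fromCommutativeRing ℚ.+-*-commutativeRing (λ q → dec⇒maybe (0ℚ ℚ.≟ q))

+-interchange : ∀ a b c d → (a ℚ.+ b) ℚ.+ (c ℚ.+ d) ≡ (a ℚ.+ c) ℚ.+ (b ℚ.+ d)
+-interchange = solve-∀ ℚ-ring

infix 8 ∑[_]_

-- Opaque so that unification can read the list and the summand off a sum.
opaque
  ∑[_]_ : List A → (A → ℚ) → ℚ
  ∑[ as ] f = Σℚ (map f as)

  ∑-cong : ∀ {f g : A → ℚ} as → (∀ a → f a ≡ g a) → ∑[ as ] f ≡ ∑[ as ] g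
  ∑-cong []       eq = refl
  ∑-cong (a ∷ as) eq = cong₂ ℚ._+_ (eq a) (∑-cong as eq)

  ∑-congᴬ : ∀ {f g : A → ℚ} {as} → All (λ a → f a ≡ g a) as → ∑[ as ] f ≡ ∑[ as ] g
  ∑-congᴬ []         = refl
  ∑-congᴬ (eq ∷ eqs) = cong₂ ℚ._+_ eq (∑-congᴬ eqs)

  ∑-zero : ∀ (as : List A) → ∑[ as ] (λ _ → 0ℚ) ≡ 0ℚ
  ∑-zero []       = refl
  ∑-zero (a ∷ as) = trans (ℚ.+-identityˡ _) (∑-zero as)

  ∑-++ : ∀ (f : A → ℚ) as bs → ∑[ as ++ bs ] f ≡ ∑[ as ] f ℚ.+ ∑[ bs ] f
  ∑-++ f []       bs = sym (ℚ.+-identityˡ _)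
  ∑-++ f (a ∷ as) bs = trans (cong (f a ℚ.+_) (∑-++ f as bs)) (sym (ℚ.+-assoc (f a) _ _))

  ∑-map : ∀ (f : B → ℚ) (g : A → B) as → ∑[ map g as ] f ≡ ∑[ as ] (f ∘ g)
  ∑-map f g as = cong Σℚ (sym (map-∘ as))

  ∑-+ : ∀ (f g : A → ℚ) as → ∑[ as ] (λ a → f a ℚ.+ g a) ≡ ∑[ as ] f ℚ.+ ∑[ as ] g
  ∑-+ f g []       = refl
  ∑-+ f g (a ∷ as) = trans (cong (f a ℚ.+ g a ℚ.+_) (∑-+ f g as)) (+-interchange (f a) (g a) _ _)

  ∑-*ˡ : ∀ q (f : A → ℚ) as → ∑[ as ] (λ a → q ℚ.* f a) ≡ q ℚ.* ∑[ as ] f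
  ∑-*ˡ q f []       = sym (ℚ.*-zeroʳ q)
  ∑-*ˡ q f (a ∷ as) = trans (cong (q ℚ.* f a ℚ.+_) (∑-*ˡ q f as)) (sym (ℚ.*-distribˡ-+ q (f a) _))

  ∑-*ʳ : ∀ q (f : A → ℚ) as → ∑[ as ] (λ a → f a ℚ.* q) ≡ ∑[ as ] f ℚ.* q
  ∑-*ʳ q f as = trans (∑-cong as (λ a → ℚ.*-comm (f a) q)) (trans (∑-*ˡ q f as) (ℚ.*-comm q _))

  ∑-swap : ∀ (f : A → B → ℚ) as bs →
    ∑[ as ] (λ a → ∑[ bs ] (λ b → f a b)) ≡ ∑[ bs ] (λ b → ∑[ as ] (λ a → f a b))
  ∑-swap f []       bs = sym (∑-zero bs)
  ∑-swap f (a ∷ as) bs =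
    trans (cong (∑[ bs ] (f a) ℚ.+_) (∑-swap f as bs)) (sym (∑-+ (f a) _ bs))

  ∑-cartesianProductWith : ∀ (f : C → ℚ) (g : A → B → C) as bs →
    ∑[ cartesianProductWith g as bs ] f ≡ ∑[ as ] (λ a → ∑[ bs ] (λ b → f (g a b)))
  ∑-cartesianProductWith f g []       bs = refl
  ∑-cartesianProductWith f g (a ∷ as) bs =
    trans (∑-++ f (map (g a) bs) _) (cong₂ ℚ._+_ (∑-map f (g a) bs) (∑-cartesianProductWith f g as bs))

  ∑-splits-[] : ∀ (F : Monomial × Monomial → ℚ) → ∑[ splits [] ] F ≡ F ([] , [])
  ∑-splits-[] F = ℚ.+-identityʳ _

  ∑-splitℕ-zero : ∀ (F : ℕ × ℕ → ℚ) → ∑[ splitℕ 0 ] F ≡ F (0 , 0)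
  ∑-splitℕ-zero F = ℚ.+-identityʳ _

  ∑-splitBool-false : ∀ (F : Bool × Bool → ℚ) → ∑[ splitBool false ] F ≡ F (false , false)
  ∑-splitBool-false F = ℚ.+-identityʳ _

  ∑-splitBool-true : ∀ (F : Bool × Bool → ℚ) → ∑[ splitBool true ] F ≡ F (true , false) ℚ.+ F (false , true)
  ∑-splitBool-true F = cong (F (true , false) ℚ.+_) (ℚ.+-identityʳ _)

  ∑-splitℕ-suc : ∀ n (F : ℕ → ℕ → ℚ) →
    ∑[ splitℕ (suc n) ] uncurry F ≡ F 0 (suc n) ℚ.+ ∑[ splitℕ n ] (λ (a , b) → F (suc a) b)
  ∑-splitℕ-suc n F = cong (F 0 (suc n) ℚ.+_) (begin
    ∑[ map (λ k → k , suc n ℕ.∸ k) (applyUpTo suc (suc n)) ] uncurry F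
      ≡⟨ cong (λ ks → ∑[ map (λ k → k , suc n ℕ.∸ k) ks ] uncurry F) (map-upTo suc (suc n)) ⟨
    ∑[ map (λ k → k , suc n ℕ.∸ k) (map suc (upTo (suc n))) ] uncurry F
      ≡⟨ ∑-map (uncurry F) (λ k → k , suc n ℕ.∸ k) (map suc (upTo (suc n))) ⟩
    ∑[ map suc (upTo (suc n)) ] (λ k → F k (suc n ℕ.∸ k))
      ≡⟨ ∑-map (λ k → F k (suc n ℕ.∸ k)) suc (upTo (suc n)) ⟩
    ∑[ upTo (suc n) ] (λ k → F (suc k) (n ℕ.∸ k))
      ≡⟨ ∑-map (λ (a , b) → F (suc a) b) (λ k → k , n ℕ.∸ k) (upTo (suc n)) ⟨
    ∑[ splitℕ n ] (λ (a , b) → F (suc a) b) ∎)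
    where open ≡-Reasoning

-- Sums over factorisations

-- A comultiplication a ↦ Σ b ⊗ c that is cocommutative and coassociative. The laws are tested
-- against arbitrary functions because the underlying lists of factorisations agree only up to
-- reordering.
record Cocommutative {A : Set} (split : A → List (A × A)) : Set where
  field
    ∑-comm  : ∀ a (F : A → A → ℚ) → ∑[ split a ] uncurry F ≡ ∑[ split a ] (λ (b , c) → F c b)
    ∑-assoc : ∀ a (F : A → A → A → ℚ) →
      ∑[ split a ] (λ (d , e) → ∑[ split d ] (λ (b , c) → F b c e)) ≡
      ∑[ split a ] (λ (b , d) → ∑[ split d ] (λ (c , e) → F b c e))

open Cocommutative

splitProduct : (A → List (A × A)) → (B → List (B × B)) → A × B → List ((A × B) × (A × B))
splitProduct s t (a , b) = cartesianProductWith (λ (a₁ , a₂) (b₁ , b₂) → (a₁ , b₁) , (a₂ , b₂)) (s a) (t b)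

-- By Fubini a sum over factorisations of a pair is an iterated sum, and each law can be applied to
-- one coordinate at a time.
splitProduct-cocommutative : ∀ {s : A → List (A × A)} {t : B → List (B × B)} →
  Cocommutative s → Cocommutative t → Cocommutative (splitProduct s t)
splitProduct-cocommutative {A} {B} {s} {t} cs ct = record { ∑-comm = comm ; ∑-assoc = assoc }
  where
  open ≡-Reasoning
  st = splitProduct s t
  fubini : ∀ a b (F : A × B → A × B → ℚ) →
    ∑[ st (a , b) ] uncurry F ≡ ∑[ s a ] (λ (a₁ , a₂) → ∑[ t b ] (λ (b₁ , b₂) → F (a₁ , b₁) (a₂ , b₂)))
  fubini a b F = ∑-cartesianProductWith (uncurry F) _ (s a) (t b)
  comm : ∀ ab (F : A × B → A × B → ℚ) → ∑[ st ab ] uncurry F ≡ ∑[ st ab ] (λ (b , c) → F c b)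
  comm (a , b) F = begin
    ∑[ st (a , b) ] uncurry F
      ≡⟨ fubini a b F ⟩
    ∑[ s a ] (λ (a₁ , a₂) → ∑[ t b ] (λ (b₁ , b₂) → F (a₁ , b₁) (a₂ , b₂)))
      ≡⟨ ∑-cong (s a) (λ (a₁ , a₂) → ∑-comm ct b (λ b₁ b₂ → F (a₁ , b₁) (a₂ , b₂))) ⟩
    ∑[ s a ] (λ (a₁ , a₂) → ∑[ t b ] (λ (b₁ , b₂) → F (a₁ , b₂) (a₂ , b₁)))
      ≡⟨ ∑-comm cs a (λ a₁ a₂ → ∑[ t b ] (λ (b₁ , b₂) → F (a₁ , b₂) (a₂ , b₁))) ⟩
    ∑[ s a ] (λ (a₁ , a₂) → ∑[ t b ] (λ (b₁ , b₂) → F (a₂ , b₂) (a₁ , b₁)))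
      ≡⟨ fubini a b (λ b c → F c b) ⟨
    ∑[ st (a , b) ] (λ (b , c) → F c b) ∎
  assoc : ∀ ab (F : A × B → A × B → A × B → ℚ) →
      ∑[ st ab ] (λ (d , e) → ∑[ st d ] (λ (b , c) → F b c e)) ≡
      ∑[ st ab ] (λ (b , d) → ∑[ st d ] (λ (c , e) → F b c e))
  assoc (a , b) F = begin
    ∑[ st (a , b) ] (λ (d , e) → ∑[ st d ] (λ (b , c) → F b c e))
      ≡⟨ fubini a b (λ d e → ∑[ st d ] (λ (b , c) → F b c e)) ⟩
    ∑[ s a ] (λ (a′ , a₃) → ∑[ t b ] (λ (b′ , b₃) → ∑[ st (a′ , b′) ] (λ (b , c) → F b c (a₃ , b₃))))
      ≡⟨ ∑-cong (s a) (λ (a′ , a₃) → ∑-cong (t b) (λ (b′ , b₃) → fubini a′ b′ (λ b c → F b c (a₃ , b₃)))) ⟩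
    ∑[ s a ] (λ (a′ , a₃) → ∑[ t b ] (λ (b′ , b₃) → ∑[ s a′ ] (λ (a₁ , a₂) → ∑[ t b′ ] (λ (b₁ , b₂) →
      F (a₁ , b₁) (a₂ , b₂) (a₃ , b₃)))))
      ≡⟨ ∑-cong (s a) (λ (a′ , a₃) → ∑-swap _ (t b) (s a′)) ⟩
    ∑[ s a ] (λ (a′ , a₃) → ∑[ s a′ ] (λ (a₁ , a₂) → ∑[ t b ] (λ (b′ , b₃) → ∑[ t b′ ] (λ (b₁ , b₂) →
      F (a₁ , b₁) (a₂ , b₂) (a₃ , b₃)))))
      ≡⟨ ∑-assoc cs a (λ a₁ a₂ a₃ → ∑[ t b ] (λ (b′ , b₃) → ∑[ t b′ ] (λ (b₁ , b₂) → F (a₁ , b₁) (a₂ , b₂) (a₃ , b₃)))) ⟩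
    ∑[ s a ] (λ (a₁ , a′) → ∑[ s a′ ] (λ (a₂ , a₃) → ∑[ t b ] (λ (b′ , b₃) → ∑[ t b′ ] (λ (b₁ , b₂) →
      F (a₁ , b₁) (a₂ , b₂) (a₃ , b₃)))))
      ≡⟨ ∑-cong (s a) (λ (a₁ , a′) → ∑-cong (s a′) (λ (a₂ , a₃) → ∑-assoc ct b (λ b₁ b₂ b₃ → F (a₁ , b₁) (a₂ , b₂) (a₃ , b₃)))) ⟩
    ∑[ s a ] (λ (a₁ , a′) → ∑[ s a′ ] (λ (a₂ , a₃) → ∑[ t b ] (λ (b₁ , b′) → ∑[ t b′ ] (λ (b₂ , b₃) →
      F (a₁ , b₁) (a₂ , b₂) (a₃ , b₃)))))
      ≡⟨ ∑-cong (s a) (λ (a₁ , a′) → ∑-swap _ (s a′) (t b)) ⟩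
    ∑[ s a ] (λ (a₁ , a′) → ∑[ t b ] (λ (b₁ , b′) → ∑[ s a′ ] (λ (a₂ , a₃) → ∑[ t b′ ] (λ (b₂ , b₃) →
      F (a₁ , b₁) (a₂ , b₂) (a₃ , b₃)))))
      ≡⟨ ∑-cong (s a) (λ (a₁ , a′) → ∑-cong (t b) (λ (b₁ , b′) → fubini a′ b′ (λ c e → F (a₁ , b₁) c e))) ⟨
    ∑[ s a ] (λ (a₁ , a′) → ∑[ t b ] (λ (b₁ , b′) → ∑[ st (a′ , b′) ] (λ (c , e) → F (a₁ , b₁) c e)))
      ≡⟨ fubini a b (λ b d → ∑[ st d ] (λ (c , e) → F b c e)) ⟨
    ∑[ st (a , b) ] (λ (b , d) → ∑[ st d ] (λ (c , e) → F b c e)) ∎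

-- The mirror image of `∑-splitℕ-suc`, taking off the other end of the list. Commutativity for ℕ
-- plays the two recursions against each other.
∑-splitℕ-sucʳ : ∀ n (F : ℕ → ℕ → ℚ) →
  ∑[ splitℕ (suc n) ] uncurry F ≡ F (suc n) 0 ℚ.+ ∑[ splitℕ n ] (λ (a , b) → F a (suc b))
∑-splitℕ-sucʳ zero    F = begin
  ∑[ splitℕ 1 ] uncurry F                             ≡⟨ ∑-splitℕ-suc 0 F ⟩
  F 0 1 ℚ.+ ∑[ splitℕ 0 ] (λ (a , b) → F (suc a) b)   ≡⟨ cong (F 0 1 ℚ.+_) (∑-splitℕ-zero _) ⟩
  F 0 1 ℚ.+ F 1 0                                     ≡⟨ ℚ.+-comm (F 0 1) (F 1 0) ⟩
  F 1 0 ℚ.+ F 0 1                                     ≡⟨ cong (F 1 0 ℚ.+_) (∑-splitℕ-zero _) ⟨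
  F 1 0 ℚ.+ ∑[ splitℕ 0 ] (λ (a , b) → F a (suc b))   ∎
  where open ≡-Reasoning
∑-splitℕ-sucʳ (suc n) F = begin
  ∑[ splitℕ (suc (suc n)) ] uncurry F
    ≡⟨ ∑-splitℕ-suc (suc n) F ⟩
  F 0 (suc (suc n)) ℚ.+ ∑[ splitℕ (suc n) ] (λ (a , b) → F (suc a) b)
    ≡⟨ cong (F 0 (suc (suc n)) ℚ.+_) (∑-splitℕ-sucʳ n (λ a b → F (suc a) b)) ⟩
  F 0 (suc (suc n)) ℚ.+ (F (suc (suc n)) 0 ℚ.+ ∑[ splitℕ n ] (λ (a , b) → F (suc a) (suc b)))
    ≡⟨ lemma (F 0 (suc (suc n))) (F (suc (suc n)) 0) _ ⟩
  F (suc (suc n)) 0 ℚ.+ (F 0 (suc (suc n)) ℚ.+ ∑[ splitℕ n ] (λ (a , b) → F (suc a) (suc b)))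
    ≡⟨ cong (F (suc (suc n)) 0 ℚ.+_) (∑-splitℕ-suc n (λ a b → F a (suc b))) ⟨
  F (suc (suc n)) 0 ℚ.+ ∑[ splitℕ (suc n) ] (λ (a , b) → F a (suc b)) ∎
  where
  open ≡-Reasoning
  lemma : ∀ a b c → a ℚ.+ (b ℚ.+ c) ≡ b ℚ.+ (a ℚ.+ c)
  lemma = solve-∀ ℚ-ring

splitℕ-cocommutative : Cocommutative splitℕ
splitℕ-cocommutative = record { ∑-comm = comm ; ∑-assoc = assoc }
  where
  open ≡-Reasoning
  comm : ∀ n (F : ℕ → ℕ → ℚ) → ∑[ splitℕ n ] uncurry F ≡ ∑[ splitℕ n ] (λ (b , c) → F c b)
  comm zero    F = trans (∑-splitℕ-zero _) (sym (∑-splitℕ-zero _))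
  comm (suc n) F = begin
    ∑[ splitℕ (suc n) ] uncurry F
      ≡⟨ ∑-splitℕ-suc n F ⟩
    F 0 (suc n) ℚ.+ ∑[ splitℕ n ] (λ (a , b) → F (suc a) b)
      ≡⟨ cong (F 0 (suc n) ℚ.+_) (comm n (λ a b → F (suc a) b)) ⟩
    F 0 (suc n) ℚ.+ ∑[ splitℕ n ] (λ (a , b) → F (suc b) a)
      ≡⟨ ∑-splitℕ-sucʳ n (λ a b → F b a) ⟨
    ∑[ splitℕ (suc n) ] (λ (b , c) → F c b) ∎
  assoc : ∀ n (F : ℕ → ℕ → ℕ → ℚ) →
      ∑[ splitℕ n ] (λ (d , e) → ∑[ splitℕ d ] (λ (b , c) → F b c e)) ≡
      ∑[ splitℕ n ] (λ (b , d) → ∑[ splitℕ d ] (λ (c , e) → F b c e))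
  assoc zero    F =
    trans (trans (∑-splitℕ-zero _) (∑-splitℕ-zero _)) (sym (trans (∑-splitℕ-zero _) (∑-splitℕ-zero _)))
  -- The triples (b, c, e) are separated by whether b is 0. Those with b = 0 form a single sum over
  -- `splitℕ (suc n)`; the others are the statement for n with b shifted.
  assoc (suc n) F = begin
    ∑[ splitℕ (suc n) ] (λ (d , e) → ∑[ splitℕ d ] (λ (b , c) → F b c e))
      ≡⟨ ∑-splitℕ-suc n (λ d e → ∑[ splitℕ d ] (λ (b , c) → F b c e)) ⟩
    ∑[ splitℕ 0 ] (λ (b , c) → F b c (suc n)) ℚ.+ ∑[ splitℕ n ] (λ (d , e) → ∑[ splitℕ (suc d) ] (λ (b , c) → F b c e))
      ≡⟨ cong₂ ℚ._+_ (∑-splitℕ-zero _) (∑-cong (splitℕ n) (λ (d , e) → ∑-splitℕ-suc d (λ b c → F b c e))) ⟩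
    F 0 0 (suc n) ℚ.+ ∑[ splitℕ n ] (λ (d , e) → F 0 (suc d) e ℚ.+ ∑[ splitℕ d ] (λ (b , c) → F (suc b) c e))
      ≡⟨ cong (F 0 0 (suc n) ℚ.+_) (∑-+ _ _ (splitℕ n)) ⟩
    F 0 0 (suc n) ℚ.+ (∑[ splitℕ n ] (λ (d , e) → F 0 (suc d) e) ℚ.+
      ∑[ splitℕ n ] (λ (d , e) → ∑[ splitℕ d ] (λ (b , c) → F (suc b) c e)))
      ≡⟨ ℚ.+-assoc (F 0 0 (suc n)) _ _ ⟨
    (F 0 0 (suc n) ℚ.+ ∑[ splitℕ n ] (λ (d , e) → F 0 (suc d) e)) ℚ.+
      ∑[ splitℕ n ] (λ (d , e) → ∑[ splitℕ d ] (λ (b , c) → F (suc b) c e))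
      ≡⟨ cong₂ ℚ._+_ (sym (∑-splitℕ-suc n (λ d e → F 0 d e))) (assoc n (λ b c e → F (suc b) c e)) ⟩
    ∑[ splitℕ (suc n) ] (λ (d , e) → F 0 d e) ℚ.+
      ∑[ splitℕ n ] (λ (b , d) → ∑[ splitℕ d ] (λ (c , e) → F (suc b) c e))
      ≡⟨ ∑-splitℕ-suc n (λ b d → ∑[ splitℕ d ] (λ (c , e) → F b c e)) ⟨
    ∑[ splitℕ (suc n) ] (λ (b , d) → ∑[ splitℕ d ] (λ (c , e) → F b c e)) ∎

splitBool-cocommutative : Cocommutative splitBool
splitBool-cocommutative = record { ∑-comm = comm ; ∑-assoc = assoc }
  where
  comm : ∀ n (F : Bool → Bool → ℚ) → ∑[ splitBool n ] uncurry F ≡ ∑[ splitBool n ] (λ (b , c) → F c b)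
  comm false F = trans (∑-splitBool-false _) (sym (∑-splitBool-false _))
  comm true  F = trans (∑-splitBool-true _) (trans (ℚ.+-comm (F true false) _) (sym (∑-splitBool-true _)))
  assoc : ∀ n (F : Bool → Bool → Bool → ℚ) →
      ∑[ splitBool n ] (λ (d , e) → ∑[ splitBool d ] (λ (b , c) → F b c e)) ≡
      ∑[ splitBool n ] (λ (b , d) → ∑[ splitBool d ] (λ (c , e) → F b c e))
  assoc false F =
    trans (trans (∑-splitBool-false _) (∑-splitBool-false _)) (sym (trans (∑-splitBool-false _) (∑-splitBool-false _)))
  assoc true  F = begin
    ∑[ splitBool true ] (λ (d , e) → ∑[ splitBool d ] (λ (b , c) → F b c e))
      ≡⟨ ∑-splitBool-true _ ⟩
    ∑[ splitBool true ] (λ (b , c) → F b c false) ℚ.+ ∑[ splitBool false ] (λ (b , c) → F b c true)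
      ≡⟨ cong₂ ℚ._+_ (∑-splitBool-true _) (∑-splitBool-false _) ⟩
    (F true false false ℚ.+ F false true false) ℚ.+ F false false true
      ≡⟨ ℚ.+-assoc (F true false false) _ _ ⟩
    F true false false ℚ.+ (F false true false ℚ.+ F false false true)
      ≡⟨ cong₂ ℚ._+_ (∑-splitBool-false _) (∑-splitBool-true _) ⟨
    ∑[ splitBool false ] (λ (c , e) → F true c e) ℚ.+ ∑[ splitBool true ] (λ (c , e) → F false c e)
      ≡⟨ ∑-splitBool-true _ ⟨
    ∑[ splitBool true ] (λ (b , d) → ∑[ splitBool d ] (λ (c , e) → F b c e)) ∎
    where open ≡-Reasoning

∑-splitExps : ∀ a b s t (F : Exponents → Exponents → ℚ) →
  ∑[ splitExps (exps a b s t) ] uncurry F ≡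
  ∑[ splitℕ a ] (λ (a₁ , a₂) → ∑[ splitℕ b ] (λ (b₁ , b₂) →
    ∑[ splitBool s ] (λ (s₁ , s₂) → ∑[ splitBool t ] (λ (t₁ , t₂) →
      F (exps a₁ b₁ s₁ t₁) (exps a₂ b₂ s₂ t₂)))))
∑-splitExps a b s t F =
  trans (∑-cartesianProductWith (uncurry F) _ (cartesianProduct (splitℕ a) (splitℕ b)) _)
  (trans (∑-cartesianProductWith _ _,_ (splitℕ a) (splitℕ b))
    (∑-cong (splitℕ a) (λ _ → ∑-cong (splitℕ b) (λ _ → ∑-cartesianProductWith _ _,_ (splitBool s) (splitBool t)))))

toExps : (ℕ × ℕ) × (Bool × Bool) → Exponents
toExps ((a , b) , (s , t)) = exps a b s t

-- Up to the relabelling `toExps`, `splitExps` is a product of two copies of `splitℕ` and two of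
-- `splitBool`.
splitExps-cocommutative : Cocommutative splitExps
splitExps-cocommutative = record { ∑-comm = comm ; ∑-assoc = assoc }
  where
  open ≡-Reasoning
  s² = splitProduct (splitProduct splitℕ splitℕ) (splitProduct splitBool splitBool)
  c² : Cocommutative s²
  c² = splitProduct-cocommutative
    (splitProduct-cocommutative splitℕ-cocommutative splitℕ-cocommutative)
    (splitProduct-cocommutative splitBool-cocommutative splitBool-cocommutative)
  transport : ∀ c (F : Exponents → Exponents → ℚ) →
    ∑[ splitExps (toExps c) ] uncurry F ≡ ∑[ s² c ] (λ (d , e) → F (toExps d) (toExps e))
  transport ((a , b) , (s , t)) F = trans (∑-splitExps a b s t F) (sym
    (trans (∑-cartesianProductWith _ _ (splitProduct splitℕ splitℕ (a , b)) _)
    (trans (∑-cartesianProductWith _ _ (splitℕ a) (splitℕ b))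
      (∑-cong (splitℕ a) (λ _ → ∑-cong (splitℕ b) (λ _ → ∑-cartesianProductWith _ _ (splitBool s) (splitBool t)))))))
  comm : ∀ c (F : Exponents → Exponents → ℚ) →
    ∑[ splitExps c ] uncurry F ≡ ∑[ splitExps c ] (λ (d , e) → F e d)
  comm (exps a b s t) F =
    trans (transport c F) (trans (∑-comm c² c (λ d e → F (toExps d) (toExps e))) (sym (transport c (λ d e → F e d))))
    where c = (a , b) , (s , t)
  assoc : ∀ c (F : Exponents → Exponents → Exponents → ℚ) →
      ∑[ splitExps c ] (λ (d , e) → ∑[ splitExps d ] (λ (b , c) → F b c e)) ≡
      ∑[ splitExps c ] (λ (b , d) → ∑[ splitExps d ] (λ (c , e) → F b c e))
  assoc (exps a b s t) F = begin
    ∑[ splitExps (toExps c) ] (λ (d , e) → ∑[ splitExps d ] (λ (b , c) → F b c e))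
      ≡⟨ transport c (λ d e → ∑[ splitExps d ] (λ (b , c) → F b c e)) ⟩
    ∑[ s² c ] (λ (d , e) → ∑[ splitExps (toExps d) ] (λ (b , c) → F b c (toExps e)))
      ≡⟨ ∑-cong (s² c) (λ (d , e) → transport d (λ b c → F b c (toExps e))) ⟩
    ∑[ s² c ] (λ (d , e) → ∑[ s² d ] (λ (b , c) → F (toExps b) (toExps c) (toExps e)))
      ≡⟨ ∑-assoc c² c (λ b c e → F (toExps b) (toExps c) (toExps e)) ⟩
    ∑[ s² c ] (λ (b , d) → ∑[ s² d ] (λ (c , e) → F (toExps b) (toExps c) (toExps e)))
      ≡⟨ ∑-cong (s² c) (λ (b , d) → transport d (λ c e → F (toExps b) c e)) ⟨
    ∑[ s² c ] (λ (b , d) → ∑[ splitExps (toExps d) ] (λ (c , e) → F (toExps b) c e))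
      ≡⟨ transport c (λ b d → ∑[ splitExps d ] (λ (c , e) → F b c e)) ⟨
    ∑[ splitExps (toExps c) ] (λ (b , d) → ∑[ splitExps d ] (λ (c , e) → F b c e)) ∎
    where c = (a , b) , (s , t)

∑-splits-∷ : ∀ c m (F : Monomial → Monomial → ℚ) →
  ∑[ splits (c ∷ m) ] uncurry F ≡ ∑[ splitExps c ] (λ (d , e) → ∑[ splits m ] (λ (a , b) → F (d ∷ a) (e ∷ b)))
∑-splits-∷ c m F = ∑-cartesianProductWith (uncurry F) consPair (splitExps c) (splits m)

-- Not an instance of `splitProduct-cocommutative`: during the induction the laws of `splits` are
-- available only at the tail `m`, so the Fubini argument is repeated there.
splits-cocommutative : Cocommutative splits
splits-cocommutative = record { ∑-comm = comm ; ∑-assoc = assoc }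
  where
  open ≡-Reasoning
  s² = splitProduct splitExps splits
  transport : ∀ c m (F : Monomial → Monomial → ℚ) →
    ∑[ splits (c ∷ m) ] uncurry F ≡ ∑[ s² (c , m) ] (λ (d , e) → F (uncurry _∷_ d) (uncurry _∷_ e))
  transport c m F = trans (∑-splits-∷ c m F) (sym (∑-cartesianProductWith _ _ (splitExps c) (splits m)))
  comm : ∀ m (F : Monomial → Monomial → ℚ) → ∑[ splits m ] uncurry F ≡ ∑[ splits m ] (λ (b , c) → F c b)
  comm []      F = trans (∑-splits-[] _) (sym (∑-splits-[] _))
  comm (c ∷ m) F = begin
    ∑[ splits (c ∷ m) ] uncurry F
      ≡⟨ ∑-splits-∷ c m F ⟩
    ∑[ splitExps c ] (λ (d , e) → ∑[ splits m ] (λ (a , b) → F (d ∷ a) (e ∷ b)))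
      ≡⟨ ∑-cong (splitExps c) (λ (d , e) → comm m (λ a b → F (d ∷ a) (e ∷ b))) ⟩
    ∑[ splitExps c ] (λ (d , e) → ∑[ splits m ] (λ (a , b) → F (d ∷ b) (e ∷ a)))
      ≡⟨ ∑-comm splitExps-cocommutative c (λ d e → ∑[ splits m ] (λ (a , b) → F (d ∷ b) (e ∷ a))) ⟩
    ∑[ splitExps c ] (λ (d , e) → ∑[ splits m ] (λ (a , b) → F (e ∷ b) (d ∷ a)))
      ≡⟨ ∑-splits-∷ c m (λ b c → F c b) ⟨
    ∑[ splits (c ∷ m) ] (λ (b , c) → F c b) ∎
  assoc : ∀ m (F : Monomial → Monomial → Monomial → ℚ) →
      ∑[ splits m ] (λ (d , e) → ∑[ splits d ] (λ (b , c) → F b c e)) ≡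
      ∑[ splits m ] (λ (b , d) → ∑[ splits d ] (λ (c , e) → F b c e))
  assoc []      F =
    trans (trans (∑-splits-[] _) (∑-splits-[] _)) (sym (trans (∑-splits-[] _) (∑-splits-[] _)))
  assoc (c ∷ m) F = begin
    ∑[ splits (c ∷ m) ] (λ (d , e) → ∑[ splits d ] (λ (b , c) → F b c e))
      ≡⟨ ∑-splits-∷ c m (λ d e → ∑[ splits d ] (λ (b , c) → F b c e)) ⟩
    ∑[ splitExps c ] (λ (c′ , c₃) → ∑[ splits m ] (λ (m′ , m₃) → ∑[ splits (c′ ∷ m′) ] (λ (b , c) → F b c (c₃ ∷ m₃))))
      ≡⟨ ∑-cong (splitExps c) (λ (c′ , c₃) → ∑-cong (splits m) (λ (m′ , m₃) → ∑-splits-∷ c′ m′ (λ b c → F b c (c₃ ∷ m₃)))) ⟩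
    ∑[ splitExps c ] (λ (c′ , c₃) → ∑[ splits m ] (λ (m′ , m₃) →
      ∑[ splitExps c′ ] (λ (c₁ , c₂) → ∑[ splits m′ ] (λ (m₁ , m₂) → F (c₁ ∷ m₁) (c₂ ∷ m₂) (c₃ ∷ m₃)))))
      ≡⟨ ∑-cong (splitExps c) (λ (c′ , c₃) → ∑-swap _ (splits m) (splitExps c′)) ⟩
    ∑[ splitExps c ] (λ (c′ , c₃) → ∑[ splitExps c′ ] (λ (c₁ , c₂) →
      ∑[ splits m ] (λ (m′ , m₃) → ∑[ splits m′ ] (λ (m₁ , m₂) → F (c₁ ∷ m₁) (c₂ ∷ m₂) (c₃ ∷ m₃)))))
      ≡⟨ ∑-assoc splitExps-cocommutative c (λ c₁ c₂ c₃ →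
           ∑[ splits m ] (λ (m′ , m₃) → ∑[ splits m′ ] (λ (m₁ , m₂) → F (c₁ ∷ m₁) (c₂ ∷ m₂) (c₃ ∷ m₃)))) ⟩
    ∑[ splitExps c ] (λ (c₁ , c′) → ∑[ splitExps c′ ] (λ (c₂ , c₃) →
      ∑[ splits m ] (λ (m′ , m₃) → ∑[ splits m′ ] (λ (m₁ , m₂) → F (c₁ ∷ m₁) (c₂ ∷ m₂) (c₃ ∷ m₃)))))
      ≡⟨ ∑-cong (splitExps c) (λ (c₁ , c′) → ∑-cong (splitExps c′) (λ (c₂ , c₃) →
           assoc m (λ m₁ m₂ m₃ → F (c₁ ∷ m₁) (c₂ ∷ m₂) (c₃ ∷ m₃)))) ⟩
    ∑[ splitExps c ] (λ (c₁ , c′) → ∑[ splitExps c′ ] (λ (c₂ , c₃) →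
      ∑[ splits m ] (λ (m₁ , m′) → ∑[ splits m′ ] (λ (m₂ , m₃) → F (c₁ ∷ m₁) (c₂ ∷ m₂) (c₃ ∷ m₃)))))
      ≡⟨ ∑-cong (splitExps c) (λ (c₁ , c′) → ∑-swap _ (splitExps c′) (splits m)) ⟩
    ∑[ splitExps c ] (λ (c₁ , c′) → ∑[ splits m ] (λ (m₁ , m′) →
      ∑[ splitExps c′ ] (λ (c₂ , c₃) → ∑[ splits m′ ] (λ (m₂ , m₃) → F (c₁ ∷ m₁) (c₂ ∷ m₂) (c₃ ∷ m₃)))))
      ≡⟨ ∑-cong (splitExps c) (λ (c₁ , c′) → ∑-cong (splits m) (λ (m₁ , m′) → ∑-splits-∷ c′ m′ (λ c e → F (c₁ ∷ m₁) c e))) ⟨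
    ∑[ splitExps c ] (λ (c₁ , c′) → ∑[ splits m ] (λ (m₁ , m′) → ∑[ splits (c′ ∷ m′) ] (λ (c , e) → F (c₁ ∷ m₁) c e)))
      ≡⟨ ∑-splits-∷ c m (λ b d → ∑[ splits d ] (λ (c , e) → F b c e)) ⟨
    ∑[ splits (c ∷ m) ] (λ (b , d) → ∑[ splits d ] (λ (c , e) → F b c e)) ∎

-- Factorisations as a relation, and the signs of their crossings

data SplitsBool : Bool → Bool → Bool → Set where
  neither : SplitsBool false false false
  left    : SplitsBool true false true
  right   : SplitsBool false true true

record SplitsExps (c d e : Exponents) : Set where
  constructor splitsExps
  field
    splits-x : xᵉ c ℕ.+ xᵉ d ≡ xᵉ e
    splits-y : yᵉ c ℕ.+ yᵉ d ≡ yᵉ e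
    splits-θ : SplitsBool (θᵉ c) (θᵉ d) (θᵉ e)
    splits-φ : SplitsBool (φᵉ c) (φᵉ d) (φᵉ e)

open SplitsExps

-- The relation that `splits` enumerates. Lengths, degrees and crossings are treated by recursion on
-- it, which membership in the list would not allow directly.
data Splits : Monomial → Monomial → Monomial → Set where
  []  : Splits [] [] []
  _∷_ : ∀ {c d e a b m} → SplitsExps c d e → Splits a b m → Splits (c ∷ a) (d ∷ b) (e ∷ m)

All-cartesianProductWith : ∀ {P : A → Set} {Q : B → Set} {R : C → Set} {g : A → B → C} {as bs} →
  (∀ {a b} → P a → Q b → R (g a b)) → All P as → All Q bs → All R (cartesianProductWith g as bs)
All-cartesianProductWith r []         qbs = []
All-cartesianProductWith r (pa ∷ pas) qbs =
  All.++⁺ (All.map⁺ (All.map (r pa) qbs)) (All-cartesianProductWith r pas qbs)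

splitℕ-sound : ∀ n → All (λ (a , b) → a ℕ.+ b ≡ n) (splitℕ n)
splitℕ-sound n = All.map⁺ (All.applyUpTo⁺₁ (λ k → k) (suc n) (λ i<1+n → ℕ.m+[n∸m]≡n (ℕ.s≤s⁻¹ i<1+n)))

splitBool-sound : ∀ s → All (λ (a , b) → SplitsBool a b s) (splitBool s)
splitBool-sound false = neither ∷ []
splitBool-sound true  = left ∷ right ∷ []

splitExps-sound : ∀ e → All (λ (c , d) → SplitsExps c d e) (splitExps e)
splitExps-sound (exps a b s t) =
  All-cartesianProductWith (λ (sa , sb) (ss , st) → splitsExps sa sb ss st)
    (All-cartesianProductWith _,_ (splitℕ-sound a) (splitℕ-sound b))
    (All-cartesianProductWith _,_ (splitBool-sound s) (splitBool-sound t))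

splits-sound : ∀ m → All (λ (a , b) → Splits a b m) (splits m)
splits-sound []      = [] ∷ []
splits-sound (c ∷ m) = All-cartesianProductWith _∷_ (splitExps-sound c) (splits-sound m)

∑-splits-cong : ∀ {f g : Monomial × Monomial → ℚ} m →
  (∀ {a b} → Splits a b m → f (a , b) ≡ g (a , b)) → ∑[ splits m ] f ≡ ∑[ splits m ] g
∑-splits-cong m eq = ∑-congᴬ (All.map eq (splits-sound m))

Splits-lengthˡ : ∀ {a b m} → Splits a b m → length a ≡ length m
Splits-lengthˡ []      = refl
Splits-lengthˡ (_ ∷ s) = cong suc (Splits-lengthˡ s)

Splits-lengthʳ : ∀ {a b m} → Splits a b m → length b ≡ length m
Splits-lengthʳ []      = refl
Splits-lengthʳ (_ ∷ s) = cong suc (Splits-lengthʳ s)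

bit-+ : ∀ {s t u} → SplitsBool s t u → bit s ℕ.+ bit t ≡ bit u
bit-+ neither = refl
bit-+ left    = refl
bit-+ right   = refl

-- This is where θᵢ² = φᵢ² = 0 enters: `SplitsBool` has no constructor with both parts `true`.
bit-* : ∀ {s t u} → SplitsBool s t u → bit s ℕ.* bit t ≡ 0
bit-* neither = refl
bit-* left    = refl
bit-* right   = refl

oddDegree-+ : ∀ {a b m} → Splits a b m → oddDegree a ℕ.+ oddDegree b ≡ oddDegree m
oddDegree-+ [] = refl
oddDegree-+ {c ∷ a} {d ∷ b} (s ∷ ss)
  rewrite sym (oddDegree-+ ss) | sym (bit-+ (splits-θ s)) | sym (bit-+ (splits-φ s)) =
  lemma (bit (θᵉ c)) (bit (φᵉ c)) (oddDegree a) (bit (θᵉ d)) (bit (φᵉ d)) (oddDegree b)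
  where
  lemma : ∀ p q r p′ q′ r′ → p ℕ.+ q ℕ.+ r ℕ.+ (p′ ℕ.+ q′ ℕ.+ r′) ≡ p ℕ.+ p′ ℕ.+ (q ℕ.+ q′) ℕ.+ (r ℕ.+ r′)
  lemma = ℕ-Solver.solve-∀

-- Crossings count pairs of variables, hence are additive in each argument. The sign is thereby
-- multiplicative in each argument, which is what associativity of the product rests on.
crossings-+ˡ : ∀ {a b d} → Splits a b d → ∀ e → crossings a e ℕ.+ crossings b e ≡ crossings d e
crossings-+ˡ []       e  = refl
crossings-+ˡ (s ∷ ss) [] = refl
crossings-+ˡ {c ∷ a} {c′ ∷ b} (s ∷ ss) (d ∷ e)
  rewrite sym (oddDegree-+ ss) | sym (crossings-+ˡ ss e) | sym (bit-+ (splits-φ s)) =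
  lemma (bit (φᵉ c)) (oddDegree a) (crossings a e) (bit (φᵉ c′)) (oddDegree b) (crossings b e) (bit (θᵉ d)) (bit (φᵉ d))
  where
  lemma : ∀ p q r p′ q′ r′ u v →
    p ℕ.* u ℕ.+ q ℕ.* (u ℕ.+ v) ℕ.+ r ℕ.+ (p′ ℕ.* u ℕ.+ q′ ℕ.* (u ℕ.+ v) ℕ.+ r′) ≡
    (p ℕ.+ p′) ℕ.* u ℕ.+ (q ℕ.+ q′) ℕ.* (u ℕ.+ v) ℕ.+ (r ℕ.+ r′)
  lemma = ℕ-Solver.solve-∀

crossings-+ʳ : ∀ {a b d} → Splits a b d → ∀ e → crossings e a ℕ.+ crossings e b ≡ crossings e d
crossings-+ʳ []       e  = cong₂ ℕ._+_ (crossings-[]ʳ e) refl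
crossings-+ʳ (s ∷ ss) [] = refl
crossings-+ʳ {c ∷ a} {c′ ∷ b} (s ∷ ss) (d ∷ e)
  rewrite sym (crossings-+ʳ ss e) | sym (bit-+ (splits-φ s)) | sym (bit-+ (splits-θ s)) =
  lemma (bit (φᵉ d)) (oddDegree e) (bit (θᵉ c)) (bit (φᵉ c)) (crossings e a) (bit (θᵉ c′)) (bit (φᵉ c′)) (crossings e b)
  where
  lemma : ∀ p q u v r u′ v′ r′ →
    p ℕ.* u ℕ.+ q ℕ.* (u ℕ.+ v) ℕ.+ r ℕ.+ (p ℕ.* u′ ℕ.+ q ℕ.* (u′ ℕ.+ v′) ℕ.+ r′) ≡
    p ℕ.* (u ℕ.+ u′) ℕ.+ q ℕ.* ((u ℕ.+ u′) ℕ.+ (v ℕ.+ v′)) ℕ.+ (r ℕ.+ r′)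
  lemma = ℕ-Solver.solve-∀

-- The monomials a and b share no odd variable, so an odd variable of a and one of b are out of
-- order in exactly one of the juxtapositions a b and b a.
crossings-swap : ∀ {a b m} → Splits a b m → crossings a b ℕ.+ crossings b a ≡ oddDegree a ℕ.* oddDegree b
crossings-swap [] = refl
crossings-swap {c ∷ a} {d ∷ b} (s ∷ ss) = begin
  bit (φᵉ c) ℕ.* bit (θᵉ d) ℕ.+ oddDegree a ℕ.* (bit (θᵉ d) ℕ.+ bit (φᵉ d)) ℕ.+ crossings a b ℕ.+
  (bit (φᵉ d) ℕ.* bit (θᵉ c) ℕ.+ oddDegree b ℕ.* (bit (θᵉ c) ℕ.+ bit (φᵉ c)) ℕ.+ crossings b a)
    ≡⟨ lemma₁ (bit (θᵉ c)) (bit (φᵉ c)) (bit (θᵉ d)) (bit (φᵉ d)) (oddDegree a) (oddDegree b) (crossings a b) (crossings b a) ⟩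
  (crossings a b ℕ.+ crossings b a) ℕ.+ rest
    ≡⟨ cong (ℕ._+ rest) (crossings-swap ss) ⟩
  oddDegree a ℕ.* oddDegree b ℕ.+ rest
    -- The pairs (θᵢ, θᵢ) and (φᵢ, φᵢ), which are no crossings, are inserted as zeros to complete
    -- the product of the two odd degrees.
    ≡⟨ cong₂ (λ u v → u ℕ.+ v ℕ.+ (oddDegree a ℕ.* oddDegree b ℕ.+ rest)) (bit-* (splits-θ s)) (bit-* (splits-φ s)) ⟨
  (bit (θᵉ c) ℕ.* bit (θᵉ d)) ℕ.+ (bit (φᵉ c) ℕ.* bit (φᵉ d)) ℕ.+ (oddDegree a ℕ.* oddDegree b ℕ.+ rest)
    ≡⟨ lemma₂ (bit (θᵉ c)) (bit (φᵉ c)) (bit (θᵉ d)) (bit (φᵉ d)) (oddDegree a) (oddDegree b) ⟩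
  (bit (θᵉ c) ℕ.+ bit (φᵉ c) ℕ.+ oddDegree a) ℕ.* (bit (θᵉ d) ℕ.+ bit (φᵉ d) ℕ.+ oddDegree b) ∎
  where
  open ≡-Reasoning
  rest = bit (φᵉ c) ℕ.* bit (θᵉ d) ℕ.+ bit (φᵉ d) ℕ.* bit (θᵉ c) ℕ.+
    (oddDegree a ℕ.* (bit (θᵉ d) ℕ.+ bit (φᵉ d)) ℕ.+ oddDegree b ℕ.* (bit (θᵉ c) ℕ.+ bit (φᵉ c)))
  lemma₁ : ∀ t f t′ f′ o o′ r r′ →
    f ℕ.* t′ ℕ.+ o ℕ.* (t′ ℕ.+ f′) ℕ.+ r ℕ.+ (f′ ℕ.* t ℕ.+ o′ ℕ.* (t ℕ.+ f) ℕ.+ r′) ≡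
    (r ℕ.+ r′) ℕ.+ (f ℕ.* t′ ℕ.+ f′ ℕ.* t ℕ.+ (o ℕ.* (t′ ℕ.+ f′) ℕ.+ o′ ℕ.* (t ℕ.+ f)))
  lemma₁ = ℕ-Solver.solve-∀
  lemma₂ : ∀ t f t′ f′ o o′ →
    (t ℕ.* t′) ℕ.+ (f ℕ.* f′) ℕ.+ (o ℕ.* o′ ℕ.+ (f ℕ.* t′ ℕ.+ f′ ℕ.* t ℕ.+ (o ℕ.* (t′ ℕ.+ f′) ℕ.+ o′ ℕ.* (t ℕ.+ f)))) ≡
    (t ℕ.+ f ℕ.+ o) ℕ.* (t′ ℕ.+ f′ ℕ.+ o′)
  lemma₂ = ℕ-Solver.solve-∀

crossings-even : ∀ a b → oddDegree a ≡ 0 → crossings a b ≡ 0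
crossings-even []                         b       eq = refl
crossings-even (c ∷ a)                    []      eq = refl
crossings-even (exps _ _ false false ∷ a) (d ∷ b) eq rewrite eq | crossings-even a b eq = refl

sign-+ : ∀ m n → sign (m ℕ.+ n) ≡ sign m ℚ.* sign n
sign-+ zero    n = sym (ℚ.*-identityˡ (sign n))
sign-+ (suc m) n = trans (cong ℚ.-_ (sign-+ m n)) (ℚ.neg-distribˡ-* (sign m) (sign n))

sign-² : ∀ n → sign n ℚ.* sign n ≡ 1ℚ
sign-² zero    = refl
sign-² (suc n) = trans (lemma (sign n)) (sign-² n)
  where
  lemma : ∀ q → (ℚ.- q) ℚ.* (ℚ.- q) ≡ q ℚ.* q
  lemma = solve-∀ ℚ-ring

-- Convolution of indicator functions

χ : Bool → ℚ
χ b = if b then 1ℚ else 0ℚ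

χ-∧ : ∀ s t → χ (s ∧ t) ≡ χ s ℚ.* χ t
χ-∧ true  t = sym (ℚ.*-identityˡ (χ t))
χ-∧ false t = sym (ℚ.*-zeroˡ (χ t))

∑-splitℕ-unit : ∀ n (F : ℕ → ℕ → ℚ) → ∑[ splitℕ n ] (λ (a , b) → χ (does (0 ℕ.≟ a)) ℚ.* F a b) ≡ F 0 n
∑-splitℕ-unit zero    F = trans (∑-splitℕ-zero _) (ℚ.*-identityˡ _)
∑-splitℕ-unit (suc n) F = begin
  ∑[ splitℕ (suc n) ] (λ (a , b) → χ (does (0 ℕ.≟ a)) ℚ.* F a b)
    ≡⟨ ∑-splitℕ-suc n (λ a b → χ (does (0 ℕ.≟ a)) ℚ.* F a b) ⟩
  1ℚ ℚ.* F 0 (suc n) ℚ.+ ∑[ splitℕ n ] (λ (a , b) → 0ℚ ℚ.* F (suc a) b)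
    ≡⟨ cong₂ ℚ._+_ (ℚ.*-identityˡ (F 0 (suc n))) (∑-*ˡ 0ℚ (λ (a , b) → F (suc a) b) (splitℕ n)) ⟩
  F 0 (suc n) ℚ.+ 0ℚ ℚ.* ∑[ splitℕ n ] (λ (a , b) → F (suc a) b)
    ≡⟨ cong (F 0 (suc n) ℚ.+_) (ℚ.*-zeroˡ (∑[ splitℕ n ] (λ (a , b) → F (suc a) b))) ⟩
  F 0 (suc n) ℚ.+ 0ℚ
    ≡⟨ ℚ.+-identityʳ _ ⟩
  F 0 (suc n) ∎
  where open ≡-Reasoning

∑-splitBool-unit : ∀ s (F : Bool → Bool → ℚ) →
  ∑[ splitBool s ] (λ (a , b) → χ (does (false Bool.≟ a)) ℚ.* F a b) ≡ F false s
∑-splitBool-unit false F = trans (∑-splitBool-false _) (ℚ.*-identityˡ _)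
∑-splitBool-unit true  F = trans (∑-splitBool-true _) (lemma (F true false) (F false true))
  where
  lemma : ∀ p q → 0ℚ ℚ.* p ℚ.+ 1ℚ ℚ.* q ≡ q
  lemma = solve-∀ ℚ-ring

∑-splitℕ-χ : ∀ p q n →
  ∑[ splitℕ n ] (λ (a , b) → χ (does (p ℕ.≟ a)) ℚ.* χ (does (q ℕ.≟ b))) ≡ χ (does (p ℕ.+ q ℕ.≟ n))
∑-splitℕ-χ zero    q n       = ∑-splitℕ-unit n (λ _ b → χ (does (q ℕ.≟ b)))
∑-splitℕ-χ (suc p) q zero    = trans (∑-splitℕ-zero _) (ℚ.*-zeroˡ (χ (does (q ℕ.≟ 0))))
∑-splitℕ-χ (suc p) q (suc n) = begin
  ∑[ splitℕ (suc n) ] (λ (a , b) → χ (does (suc p ℕ.≟ a)) ℚ.* χ (does (q ℕ.≟ b)))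
    ≡⟨ ∑-splitℕ-suc n (λ a b → χ (does (suc p ℕ.≟ a)) ℚ.* χ (does (q ℕ.≟ b))) ⟩
  0ℚ ℚ.* χ (does (q ℕ.≟ suc n)) ℚ.+ ∑[ splitℕ n ] (λ (a , b) → χ (does (p ℕ.≟ a)) ℚ.* χ (does (q ℕ.≟ b)))
    ≡⟨ cong₂ ℚ._+_ (ℚ.*-zeroˡ (χ (does (q ℕ.≟ suc n)))) (∑-splitℕ-χ p q n) ⟩
  0ℚ ℚ.+ χ (does (p ℕ.+ q ℕ.≟ n))
    ≡⟨ ℚ.+-identityˡ _ ⟩
  χ (does (p ℕ.+ q ℕ.≟ n)) ∎
  where open ≡-Reasoning

χ-exps : ∀ a b s t a′ b′ s′ t′ → χ (does (exps a b s t ≟ᵉ exps a′ b′ s′ t′)) ≡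
  χ (does (a ℕ.≟ a′)) ℚ.* (χ (does (b ℕ.≟ b′)) ℚ.* (χ (does (s Bool.≟ s′)) ℚ.* χ (does (t Bool.≟ t′))))
χ-exps a b s t a′ b′ s′ t′ =
  trans (χ-∧ (does (a ℕ.≟ a′)) _) (cong (χ (does (a ℕ.≟ a′)) ℚ.*_)
  (trans (χ-∧ (does (b ℕ.≟ b′)) _) (cong (χ (does (b ℕ.≟ b′)) ℚ.*_)
  (χ-∧ (does (s Bool.≟ s′)) _))))

-- The indicator of 𝟘 is a product of four indicators. They are regrouped from the innermost sum
-- outwards, so that each sum is contracted by its own unit law.
∑-splitExps-unit : ∀ e (F : Exponents → Exponents → ℚ) →
  ∑[ splitExps e ] (λ (c , d) → χ (does (𝟘 ≟ᵉ c)) ℚ.* F c d) ≡ F 𝟘 e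
∑-splitExps-unit (exps a b s t) F = begin
  ∑[ splitExps (exps a b s t) ] (λ (c , d) → χ (does (𝟘 ≟ᵉ c)) ℚ.* F c d)
    ≡⟨ ∑-splitExps a b s t (λ c d → χ (does (𝟘 ≟ᵉ c)) ℚ.* F c d) ⟩
  ∑[ splitℕ a ] (λ (a₁ , a₂) → ∑[ splitℕ b ] (λ (b₁ , b₂) →
    ∑[ splitBool s ] (λ (s₁ , s₂) → ∑[ splitBool t ] (λ (t₁ , t₂) →
      χ (does (𝟘 ≟ᵉ exps a₁ b₁ s₁ t₁)) ℚ.* F (exps a₁ b₁ s₁ t₁) (exps a₂ b₂ s₂ t₂)))))
    ≡⟨ ∑-cong (splitℕ a) (λ (a₁ , a₂) → ∑-cong (splitℕ b) (λ (b₁ , b₂) → ∑-cong (splitBool s) (λ (s₁ , s₂) →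
         trans (∑-cong (splitBool t) (λ (t₁ , t₂) →
           trans (cong (ℚ._* F (exps a₁ b₁ s₁ t₁) (exps a₂ b₂ s₂ t₂)) (χ-exps 0 0 false false a₁ b₁ s₁ t₁))
             (regroup (χ (does (0 ℕ.≟ a₁))) (χ (does (0 ℕ.≟ b₁))) (χ (does (false Bool.≟ s₁))) (χ (does (false Bool.≟ t₁))) _)))
           (∑-splitBool-unit t _)))) ⟩
  ∑[ splitℕ a ] (λ (a₁ , a₂) → ∑[ splitℕ b ] (λ (b₁ , b₂) → ∑[ splitBool s ] (λ (s₁ , s₂) →
    χ (does (false Bool.≟ s₁)) ℚ.* (χ (does (0 ℕ.≟ b₁)) ℚ.* (χ (does (0 ℕ.≟ a₁)) ℚ.*
      F (exps a₁ b₁ s₁ false) (exps a₂ b₂ s₂ t))))))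
    ≡⟨ ∑-cong (splitℕ a) (λ (a₁ , a₂) → ∑-cong (splitℕ b) (λ (b₁ , b₂) → ∑-splitBool-unit s (λ s₁ s₂ →
         χ (does (0 ℕ.≟ b₁)) ℚ.* (χ (does (0 ℕ.≟ a₁)) ℚ.* F (exps a₁ b₁ s₁ false) (exps a₂ b₂ s₂ t))))) ⟩
  ∑[ splitℕ a ] (λ (a₁ , a₂) → ∑[ splitℕ b ] (λ (b₁ , b₂) →
    χ (does (0 ℕ.≟ b₁)) ℚ.* (χ (does (0 ℕ.≟ a₁)) ℚ.* F (exps a₁ b₁ false false) (exps a₂ b₂ s t))))
    ≡⟨ ∑-cong (splitℕ a) (λ (a₁ , a₂) → ∑-splitℕ-unit b (λ b₁ b₂ →
         χ (does (0 ℕ.≟ a₁)) ℚ.* F (exps a₁ b₁ false false) (exps a₂ b₂ s t))) ⟩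
  ∑[ splitℕ a ] (λ (a₁ , a₂) → χ (does (0 ℕ.≟ a₁)) ℚ.* F (exps a₁ 0 false false) (exps a₂ b s t))
    ≡⟨ ∑-splitℕ-unit a (λ a₁ a₂ → F (exps a₁ 0 false false) (exps a₂ b s t)) ⟩
  F 𝟘 (exps a b s t) ∎
  where
  open ≡-Reasoning
  regroup : ∀ p q r s f → (p ℚ.* (q ℚ.* (r ℚ.* s))) ℚ.* f ≡ s ℚ.* (r ℚ.* (q ℚ.* (p ℚ.* f)))
  regroup = solve-∀ ℚ-ring

-- Only the second factor may carry odd variables, which leaves no sign and no repeated odd variable
-- to consider. The Boolean sums collapse by unit laws; the exponents of x and y give genuine
-- convolutions.
∑-splitExps-χ : ∀ a b a′ b′ s t e →
  ∑[ splitExps e ] (λ (c , d) → χ (does (exps a b false false ≟ᵉ c)) ℚ.* χ (does (exps a′ b′ s t ≟ᵉ d))) ≡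
  χ (does (exps (a ℕ.+ a′) (b ℕ.+ b′) s t ≟ᵉ e))
∑-splitExps-χ a b a′ b′ s t (exps a″ b″ s″ t″) = begin
  ∑[ splitExps (exps a″ b″ s″ t″) ] (λ (c , d) → χ (does (exps a b false false ≟ᵉ c)) ℚ.* χ (does (exps a′ b′ s t ≟ᵉ d)))
    ≡⟨ ∑-splitExps a″ b″ s″ t″ (λ c d → χ (does (exps a b false false ≟ᵉ c)) ℚ.* χ (does (exps a′ b′ s t ≟ᵉ d))) ⟩
  ∑[ splitℕ a″ ] (λ (a₁ , a₂) → ∑[ splitℕ b″ ] (λ (b₁ , b₂) →
    ∑[ splitBool s″ ] (λ (s₁ , s₂) → ∑[ splitBool t″ ] (λ (t₁ , t₂) →
      χ (does (exps a b false false ≟ᵉ exps a₁ b₁ s₁ t₁)) ℚ.* χ (does (exps a′ b′ s t ≟ᵉ exps a₂ b₂ s₂ t₂))))))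
    ≡⟨ ∑-cong (splitℕ a″) (λ (a₁ , a₂) → ∑-cong (splitℕ b″) (λ (b₁ , b₂) → ∑-cong (splitBool s″) (λ (s₁ , s₂) →
         trans (∑-cong (splitBool t″) (λ (t₁ , t₂) →
           trans (cong₂ ℚ._*_ (χ-exps a b false false a₁ b₁ s₁ t₁) (χ-exps a′ b′ s t a₂ b₂ s₂ t₂))
             (regroup (χ (does (a ℕ.≟ a₁))) (χ (does (b ℕ.≟ b₁))) (χ (does (false Bool.≟ s₁))) (χ (does (false Bool.≟ t₁)))
                      (χ (does (a′ ℕ.≟ a₂))) (χ (does (b′ ℕ.≟ b₂))) (χ (does (s Bool.≟ s₂))) (χ (does (t Bool.≟ t₂))))))
           (∑-splitBool-unit t″ (λ t₁ t₂ → χ (does (false Bool.≟ s₁)) ℚ.* (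
             (χ (does (s Bool.≟ s₂)) ℚ.* χ (does (t Bool.≟ t₂))) ℚ.*
             ((χ (does (b ℕ.≟ b₁)) ℚ.* χ (does (b′ ℕ.≟ b₂))) ℚ.*
              (χ (does (a ℕ.≟ a₁)) ℚ.* χ (does (a′ ℕ.≟ a₂)))))))))) ⟩
  ∑[ splitℕ a″ ] (λ (a₁ , a₂) → ∑[ splitℕ b″ ] (λ (b₁ , b₂) → ∑[ splitBool s″ ] (λ (s₁ , s₂) →
    χ (does (false Bool.≟ s₁)) ℚ.* (
             (χ (does (s Bool.≟ s₂)) ℚ.* χ (does (t Bool.≟ t″))) ℚ.*
             ((χ (does (b ℕ.≟ b₁)) ℚ.* χ (does (b′ ℕ.≟ b₂))) ℚ.*
              (χ (does (a ℕ.≟ a₁)) ℚ.* χ (does (a′ ℕ.≟ a₂))))))))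
    ≡⟨ ∑-cong (splitℕ a″) (λ (a₁ , a₂) → ∑-cong (splitℕ b″) (λ (b₁ , b₂) → ∑-splitBool-unit s″ (λ s₁ s₂ →
             (χ (does (s Bool.≟ s₂)) ℚ.* χ (does (t Bool.≟ t″))) ℚ.*
             ((χ (does (b ℕ.≟ b₁)) ℚ.* χ (does (b′ ℕ.≟ b₂))) ℚ.*
              (χ (does (a ℕ.≟ a₁)) ℚ.* χ (does (a′ ℕ.≟ a₂))))))) ⟩
  ∑[ splitℕ a″ ] (λ (a₁ , a₂) → ∑[ splitℕ b″ ] (λ (b₁ , b₂) →
             st ℚ.*
             ((χ (does (b ℕ.≟ b₁)) ℚ.* χ (does (b′ ℕ.≟ b₂))) ℚ.*
              (χ (does (a ℕ.≟ a₁)) ℚ.* χ (does (a′ ℕ.≟ a₂))))))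
    ≡⟨ ∑-cong (splitℕ a″) (λ (a₁ , a₂) → trans (∑-*ˡ st _ (splitℕ b″))
         (cong (st ℚ.*_) (trans (∑-*ʳ (χ (does (a ℕ.≟ a₁)) ℚ.* χ (does (a′ ℕ.≟ a₂))) _ (splitℕ b″))
           (cong (ℚ._* (χ (does (a ℕ.≟ a₁)) ℚ.* χ (does (a′ ℕ.≟ a₂)))) (∑-splitℕ-χ b b′ b″))))) ⟩
  ∑[ splitℕ a″ ] (λ (a₁ , a₂) →
             st ℚ.*
             (χ (does (b ℕ.+ b′ ℕ.≟ b″)) ℚ.*
              (χ (does (a ℕ.≟ a₁)) ℚ.* χ (does (a′ ℕ.≟ a₂)))))
    ≡⟨ trans (∑-*ˡ st _ (splitℕ a″)) (cong (st ℚ.*_) 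
         (trans (∑-*ˡ (χ (does (b ℕ.+ b′ ℕ.≟ b″))) _ (splitℕ a″)) (cong (χ (does (b ℕ.+ b′ ℕ.≟ b″)) ℚ.*_) (∑-splitℕ-χ a a′ a″)))) ⟩
  st ℚ.* (χ (does (b ℕ.+ b′ ℕ.≟ b″)) ℚ.* χ (does (a ℕ.+ a′ ℕ.≟ a″)))
    ≡⟨ regroup′ st (χ (does (b ℕ.+ b′ ℕ.≟ b″))) (χ (does (a ℕ.+ a′ ℕ.≟ a″))) ⟩
  χ (does (a ℕ.+ a′ ℕ.≟ a″)) ℚ.* (χ (does (b ℕ.+ b′ ℕ.≟ b″)) ℚ.* st)
    ≡⟨ χ-exps (a ℕ.+ a′) (b ℕ.+ b′) s t a″ b″ s″ t″ ⟨
  χ (does (exps (a ℕ.+ a′) (b ℕ.+ b′) s t ≟ᵉ exps a″ b″ s″ t″)) ∎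
  where
  open ≡-Reasoning
  st = χ (does (s Bool.≟ s″)) ℚ.* χ (does (t Bool.≟ t″))
  regroup : ∀ p q r s p′ q′ r′ s′ → (p ℚ.* (q ℚ.* (r ℚ.* s))) ℚ.* (p′ ℚ.* (q′ ℚ.* (r′ ℚ.* s′))) ≡
    s ℚ.* (r ℚ.* ((r′ ℚ.* s′) ℚ.* ((q ℚ.* q′) ℚ.* (p ℚ.* p′))))
  regroup = solve-∀ ℚ-ring
  regroup′ : ∀ p q r → p ℚ.* (q ℚ.* r) ≡ r ℚ.* (q ℚ.* p)
  regroup′ = solve-∀ ℚ-ring

-- The representative of the monomial 1 that occurs in `splits m`, where all lists have the length
-- of `m`.
one : Monomial → Monomial
one = map (λ _ → 𝟘)

∑-splits-unit : ∀ m (F : Monomial → Monomial → ℚ) →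
  ∑[ splits m ] (λ (a , b) → χ (sameMonomial [] a) ℚ.* F a b) ≡ F (one m) m
∑-splits-unit []      F = trans (∑-splits-[] _) (ℚ.*-identityˡ _)
∑-splits-unit (c ∷ m) F = begin
  ∑[ splits (c ∷ m) ] (λ (a , b) → χ (sameMonomial [] a) ℚ.* F a b)
    ≡⟨ ∑-splits-∷ c m (λ a b → χ (sameMonomial [] a) ℚ.* F a b) ⟩
  ∑[ splitExps c ] (λ (d , e) → ∑[ splits m ] (λ (a , b) → χ (does (𝟘 ≟ᵉ d) ∧ sameMonomial [] a) ℚ.* F (d ∷ a) (e ∷ b)))
    ≡⟨ ∑-cong (splitExps c) (λ (d , e) → trans
         (∑-cong (splits m) (λ (a , b) →
           trans (cong (ℚ._* F (d ∷ a) (e ∷ b)) (χ-∧ (does (𝟘 ≟ᵉ d)) (sameMonomial [] a)))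
                 (ℚ.*-assoc (χ (does (𝟘 ≟ᵉ d))) _ _)))
         (trans (∑-*ˡ (χ (does (𝟘 ≟ᵉ d))) _ (splits m))
           (cong (χ (does (𝟘 ≟ᵉ d)) ℚ.*_) (∑-splits-unit m (λ a b → F (d ∷ a) (e ∷ b)))))) ⟩
  ∑[ splitExps c ] (λ (d , e) → χ (does (𝟘 ≟ᵉ d)) ℚ.* F (d ∷ one m) (e ∷ m))
    ≡⟨ ∑-splitExps-unit c (λ d e → F (d ∷ one m) (e ∷ m)) ⟩
  F (one (c ∷ m)) (c ∷ m) ∎
  where open ≡-Reasoning

oddDegree-one : ∀ m → oddDegree (one m) ≡ 0
oddDegree-one []      = refl
oddDegree-one (c ∷ m) = oddDegree-one m

∑-splits-χ-∷ : ∀ a b a′ b′ s t k k′ k″ e m →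
  ∑[ splits m ] (λ (u , v) → χ (sameMonomial k u) ℚ.* χ (sameMonomial k′ v)) ≡ χ (sameMonomial k″ m) →
  ∑[ splitExps e ] (λ (c , d) → ∑[ splits m ] (λ (u , v) →
    χ (does (exps a b false false ≟ᵉ c) ∧ sameMonomial k u) ℚ.* χ (does (exps a′ b′ s t ≟ᵉ d) ∧ sameMonomial k′ v))) ≡
  χ (does (exps (a ℕ.+ a′) (b ℕ.+ b′) s t ≟ᵉ e) ∧ sameMonomial k″ m)
∑-splits-χ-∷ a b a′ b′ s t k k′ k″ e m eq = begin
  ∑[ splitExps e ] (λ (c , d) → ∑[ splits m ] (λ (u , v) →
    χ (does (exps a b false false ≟ᵉ c) ∧ sameMonomial k u) ℚ.* χ (does (exps a′ b′ s t ≟ᵉ d) ∧ sameMonomial k′ v)))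
    ≡⟨ ∑-cong (splitExps e) (λ (c , d) → trans
         (∑-cong (splits m) (λ (u , v) → trans
           (cong₂ ℚ._*_ (χ-∧ (does (exps a b false false ≟ᵉ c)) (sameMonomial k u))
                        (χ-∧ (does (exps a′ b′ s t ≟ᵉ d)) (sameMonomial k′ v)))
           (regroup (χ (does (exps a b false false ≟ᵉ c))) (χ (sameMonomial k u))
                    (χ (does (exps a′ b′ s t ≟ᵉ d))) (χ (sameMonomial k′ v)))))
         (trans (∑-*ˡ (χ (does (exps a b false false ≟ᵉ c)) ℚ.* χ (does (exps a′ b′ s t ≟ᵉ d))) _ (splits m))
           (cong ((χ (does (exps a b false false ≟ᵉ c)) ℚ.* χ (does (exps a′ b′ s t ≟ᵉ d))) ℚ.*_) eq))) ⟩
  ∑[ splitExps e ] (λ (c , d) →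
    (χ (does (exps a b false false ≟ᵉ c)) ℚ.* χ (does (exps a′ b′ s t ≟ᵉ d))) ℚ.* χ (sameMonomial k″ m))
    ≡⟨ ∑-*ʳ (χ (sameMonomial k″ m)) _ (splitExps e) ⟩
  ∑[ splitExps e ] (λ (c , d) →
    χ (does (exps a b false false ≟ᵉ c)) ℚ.* χ (does (exps a′ b′ s t ≟ᵉ d))) ℚ.* χ (sameMonomial k″ m)
    ≡⟨ cong (ℚ._* χ (sameMonomial k″ m)) (∑-splitExps-χ a b a′ b′ s t e) ⟩
  χ (does (exps (a ℕ.+ a′) (b ℕ.+ b′) s t ≟ᵉ e)) ℚ.* χ (sameMonomial k″ m)
    ≡⟨ χ-∧ (does (exps (a ℕ.+ a′) (b ℕ.+ b′) s t ≟ᵉ e)) (sameMonomial k″ m) ⟨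
  χ (does (exps (a ℕ.+ a′) (b ℕ.+ b′) s t ≟ᵉ e) ∧ sameMonomial k″ m) ∎
  where
  open ≡-Reasoning
  regroup : ∀ p q r s → (p ℚ.* q) ℚ.* (r ℚ.* s) ≡ (p ℚ.* r) ℚ.* (q ℚ.* s)
  regroup = solve-∀ ℚ-ring

∑-splits-χ-at : ∀ a b a′ b′ s t i m → i ℕ.< length m →
  ∑[ splits m ] (λ (u , v) → χ (sameMonomial (at i (exps a b false false)) u) ℚ.* χ (sameMonomial (at i (exps a′ b′ s t)) v)) ≡
  χ (sameMonomial (at i (exps (a ℕ.+ a′) (b ℕ.+ b′) s t)) m)
∑-splits-χ-at a b a′ b′ s t zero    (e ∷ m) _ =
  trans (∑-splits-∷ e m _) (∑-splits-χ-∷ a b a′ b′ s t [] [] [] e m (∑-splits-unit m (λ _ v → χ (sameMonomial [] v))))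
∑-splits-χ-at a b a′ b′ s t (suc i) (e ∷ m) (s≤s i<m) =
  trans (∑-splits-∷ e m _) (∑-splits-χ-∷ 0 0 0 0 false false
    (at i (exps a b false false)) (at i (exps a′ b′ s t)) (at i (exps (a ℕ.+ a′) (b ℕ.+ b′) s t)) e m (∑-splits-χ-at a b a′ b′ s t i m i<m))

-- Gradings

does-true : ∀ {P : Set} (P? : Dec P) → does P? ≡ true → P
does-true (yes p) _ = p

ℕ-interchange : ∀ p q r s → p ℕ.+ q ℕ.+ (r ℕ.+ s) ≡ p ℕ.+ r ℕ.+ (q ℕ.+ s)
ℕ-interchange = ℕ-Solver.solve-∀

-- One notion for three degrees: `oddGrading` governs commutation, `θ-grading` the reversal sign,
-- `xθ-grading` the Euler derivation and the truncation.
record Grading : Set where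
  field
    weight   : Exponents → ℕ
    weight-𝟘 : weight 𝟘 ≡ 0
    weight-+ : ∀ {c d e} → SplitsExps c d e → weight c ℕ.+ weight d ≡ weight e

  degree : Monomial → ℕ
  degree []      = 0
  degree (c ∷ m) = weight c ℕ.+ degree m

  degree-∷ʳ : ∀ m → degree (m ∷ʳ 𝟘) ≡ degree m
  degree-∷ʳ []      = trans (ℕ.+-identityʳ _) weight-𝟘
  degree-∷ʳ (c ∷ m) = cong (weight c ℕ.+_) (degree-∷ʳ m)

  degree-+ : ∀ {a b m} → Splits a b m → degree a ℕ.+ degree b ≡ degree m
  degree-+ []                       = refl
  degree-+ {c ∷ a} {d ∷ b} (s ∷ ss) =
    trans (ℕ-interchange (weight c) (degree a) (weight d) (degree b)) (cong₂ ℕ._+_ (weight-+ s) (degree-+ ss))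

  degree-at : ∀ i e → degree (at i e) ≡ weight e
  degree-at zero    e = ℕ.+-identityʳ _
  degree-at (suc i) e = trans (cong (ℕ._+ degree (at i e)) weight-𝟘) (degree-at i e)

  degree-same : ∀ k m → sameMonomial k m ≡ true → degree k ≡ degree m
  degree-same []      []      _  = refl
  degree-same []      (d ∷ m) eq =
    cong₂ ℕ._+_ (trans (sym weight-𝟘) (cong weight (does-true (𝟘 ≟ᵉ d) (Bool.∧-conicalˡ _ _ eq))))
                (degree-same [] m (Bool.∧-conicalʳ (does (𝟘 ≟ᵉ d)) _ eq))
  degree-same (c ∷ k) []      eq =
    cong₂ ℕ._+_ (trans (cong weight (does-true (c ≟ᵉ 𝟘) (Bool.∧-conicalˡ _ _ eq))) weight-𝟘)
                (degree-same k [] (Bool.∧-conicalʳ (does (c ≟ᵉ 𝟘)) _ eq))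
  degree-same (c ∷ k) (d ∷ m) eq =
    cong₂ ℕ._+_ (cong weight (does-true (c ≟ᵉ d) (Bool.∧-conicalˡ _ _ eq)))
                (degree-same k m (Bool.∧-conicalʳ (does (c ≟ᵉ d)) _ eq))

  Homogeneous : Series → ℕ → Set
  Homogeneous f d = ∀ m → degree m ≢ d → coeff f m ≡ 0ℚ

  Homogeneous-monomial : ∀ k → Homogeneous (monomial k) (degree k)
  Homogeneous-monomial k m m≢k with sameMonomial k m in eq
  ... | true  = ⊥-elim (m≢k (sym (degree-same k m eq)))
  ... | false = refl

  Homogeneous-at : ∀ i e → Homogeneous (monomial (at i e)) (weight e)
  Homogeneous-at i e = subst (Homogeneous (monomial (at i e))) (degree-at i e) (Homogeneous-monomial (at i e))

  Homogeneous-sumOverVariables : ∀ e e≢𝟘 → Homogeneous (sumOverVariables e e≢𝟘) (weight e)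
  Homogeneous-sumOverVariables e e≢𝟘 m m≢e = vanish (length m)
    where
    vanish : ∀ n → Σ< n (λ i → coeff (monomial (at i e)) m) ≡ 0ℚ
    vanish zero    = refl
    vanish (suc n) = cong₂ ℚ._+_ (vanish n) (Homogeneous-at n e m m≢e)

open Grading

oddGrading θ-grading xθ-grading : Grading
oddGrading .weight c = bit (θᵉ c) ℕ.+ bit (φᵉ c)
oddGrading .weight-𝟘 = refl
oddGrading .weight-+ {c} {d} s =
  trans (ℕ-interchange (bit (θᵉ c)) (bit (φᵉ c)) (bit (θᵉ d)) (bit (φᵉ d))) (cong₂ ℕ._+_ (bit-+ (splits-θ s)) (bit-+ (splits-φ s)))
θ-grading .weight c = bit (θᵉ c)
θ-grading .weight-𝟘 = refl
θ-grading .weight-+ s = bit-+ (splits-θ s)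
xθ-grading .weight c = xᵉ c ℕ.+ bit (θᵉ c)
xθ-grading .weight-𝟘 = refl
xθ-grading .weight-+ {c} {d} s =
  trans (ℕ-interchange (xᵉ c) (bit (θᵉ c)) (xᵉ d) (bit (θᵉ d))) (cong₂ ℕ._+_ (splits-x s) (bit-+ (splits-θ s)))

oddDegree≡degree : ∀ m → oddDegree m ≡ degree oddGrading m
oddDegree≡degree []      = refl
oddDegree≡degree (c ∷ m) = cong (bit (θᵉ c) ℕ.+ bit (φᵉ c) ℕ.+_) (oddDegree≡degree m)

θ-degree≡degree : ∀ m → θ-degree m ≡ degree θ-grading m
θ-degree≡degree []      = refl
θ-degree≡degree (c ∷ m) = cong (bit (θᵉ c) ℕ.+_) (θ-degree≡degree m)

-- Recursive rather than a quotient by 1, whose normalisation by a gcd does not reduce when n is a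
-- variable.
fromℕ : ℕ → ℚ
fromℕ zero    = 0ℚ
fromℕ (suc n) = 1ℚ ℚ.+ fromℕ n

fromℕ-+ : ∀ m n → fromℕ (m ℕ.+ n) ≡ fromℕ m ℚ.+ fromℕ n
fromℕ-+ zero    n = sym (ℚ.+-identityˡ (fromℕ n))
fromℕ-+ (suc m) n = trans (cong (1ℚ ℚ.+_) (fromℕ-+ m n)) (sym (ℚ.+-assoc 1ℚ (fromℕ m) (fromℕ n)))

fromℕ-* : ∀ m n → fromℕ (m ℕ.* n) ≡ fromℕ m ℚ.* fromℕ n
fromℕ-* zero    n = sym (ℚ.*-zeroˡ (fromℕ n))
fromℕ-* (suc m) n = begin
  fromℕ (n ℕ.+ m ℕ.* n)                    ≡⟨ fromℕ-+ n (m ℕ.* n) ⟩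
  fromℕ n ℚ.+ fromℕ (m ℕ.* n)              ≡⟨ cong (fromℕ n ℚ.+_) (fromℕ-* m n) ⟩
  fromℕ n ℚ.+ fromℕ m ℚ.* fromℕ n          ≡⟨ lemma (fromℕ m) (fromℕ n) ⟩
  (1ℚ ℚ.+ fromℕ m) ℚ.* fromℕ n             ∎
  where
  open ≡-Reasoning
  lemma : ∀ p q → q ℚ.+ p ℚ.* q ≡ (1ℚ ℚ.+ p) ℚ.* q
  lemma = solve-∀ ℚ-ring

-- The superalgebra of formal series and its Euler derivation

infix  8 ⊖_
infixl 6 _⊕_
infixl 7 _⊗_
infixr 8 _⊙_

-- Opaque copies of the operations on series: the originals, being defined by
-- copatterns, are compared coefficient by coefficient during unification.
opaque
  unfolding ∑[_]_

  𝟎 𝟏 : Series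
  𝟎 = 0#
  𝟏 = 1#

  ⊖_ : Series → Series
  (⊖ f) .coeff    m = ℚ.- coeff f m
  (⊖ f) .coherent m = cong ℚ.-_ (coherent f m)

  _⊕_ _⊗_ : Series → Series → Series
  _⊕_ = _+_
  _⊗_ = _*_

  _⊙_ : ℚ → Series → Series
  _⊙_ = _•_

  -- The Euler derivation, Σᵢ (xᵢ ∂/∂xᵢ + θᵢ ∂/∂θᵢ).
  E : Series → Series
  E f .coeff    m = fromℕ (degree xθ-grading m) ℚ.* coeff f m
  E f .coherent m = cong₂ (λ d q → fromℕ d ℚ.* q) (degree-∷ʳ xθ-grading m) (coherent f m)

  0≡𝟎 : 0# ≡ 𝟎
  0≡𝟎 = refl

  1≡𝟏 : 1# ≡ 𝟏
  1≡𝟏 = refl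

  +≡⊕ : ∀ f g → f + g ≡ f ⊕ g
  +≡⊕ f g = refl

  *≡⊗ : ∀ f g → f * g ≡ f ⊗ g
  *≡⊗ f g = refl

  •≡⊙ : ∀ q f → q • f ≡ q ⊙ f
  •≡⊙ q f = refl

  coeff-𝟎 : ∀ m → coeff 𝟎 m ≡ 0ℚ
  coeff-𝟎 m = refl

  coeff-⊕ : ∀ f g m → coeff (f ⊕ g) m ≡ coeff f m ℚ.+ coeff g m
  coeff-⊕ f g m = refl

  coeff-⊖ : ∀ f m → coeff (⊖ f) m ≡ ℚ.- coeff f m
  coeff-⊖ f m = refl

  coeff-⊙ : ∀ q f m → coeff (q ⊙ f) m ≡ q ℚ.* coeff f m
  coeff-⊙ q f m = refl

  coeff-E : ∀ f m → coeff (E f) m ≡ fromℕ (degree xθ-grading m) ℚ.* coeff f m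
  coeff-E f m = refl

  coeff-⊗ : ∀ f g m → coeff (f ⊗ g) m ≡ ∑[ splits m ] productTerm f g
  coeff-⊗ f g m = refl

-- A coefficient of a product involves only factors of the given monomial. This is what makes
-- agreement up to a truncation a congruence.
⊗-cong-at : ∀ f f′ g g′ m → (∀ {a b} → Splits a b m → coeff f a ≡ coeff f′ a) →
  (∀ {a b} → Splits a b m → coeff g b ≡ coeff g′ b) → coeff (f ⊗ g) m ≡ coeff (f′ ⊗ g′) m
⊗-cong-at f f′ g g′ m f≡ g≡ = trans (coeff-⊗ f g m) (trans
  (∑-splits-cong m (λ {a} {b} s → cong₂ (λ u v → sign (crossings a b) ℚ.* (u ℚ.* v)) (f≡ s) (g≡ s)))
  (sym (coeff-⊗ f′ g′ m)))

⊗-assoc-≈ : ∀ f g h → (f ⊗ g) ⊗ h ≈ f ⊗ (g ⊗ h)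
⊗-assoc-≈ f g h m = begin
  coeff ((f ⊗ g) ⊗ h) m
    ≡⟨ coeff-⊗ (f ⊗ g) h m ⟩
  ∑[ splits m ] (λ (d , e) → sign (crossings d e) ℚ.* (coeff (f ⊗ g) d ℚ.* coeff h e))
    ≡⟨ ∑-cong (splits m) (λ (d , e) → expandˡ d e) ⟩
  ∑[ splits m ] (λ (d , e) → ∑[ splits d ] (λ (b , c) → F b c e))
    ≡⟨ ∑-assoc splits-cocommutative m F ⟩
  ∑[ splits m ] (λ (b , d) → ∑[ splits d ] (λ (c , e) → F b c e))
    ≡⟨ ∑-cong (splits m) (λ (b , d) → expandʳ b d) ⟨
  ∑[ splits m ] (λ (b , d) → sign (crossings b d) ℚ.* (coeff f b ℚ.* coeff (g ⊗ h) d))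
    ≡⟨ coeff-⊗ f (g ⊗ h) m ⟨
  coeff (f ⊗ (g ⊗ h)) m ∎
  where
  open ≡-Reasoning
  -- The sign for putting b c e in normal order, with one factor for each pair; the bracketing has
  -- disappeared from it.
  F : Monomial → Monomial → Monomial → ℚ
  F b c e = sign (crossings b c) ℚ.* sign (crossings b e) ℚ.* sign (crossings c e) ℚ.* (coeff f b ℚ.* coeff g c ℚ.* coeff h e)
  regroupˡ : ∀ bc be ce p q r → (be ℚ.* ce ℚ.* r) ℚ.* (bc ℚ.* (p ℚ.* q)) ≡ bc ℚ.* be ℚ.* ce ℚ.* (p ℚ.* q ℚ.* r)
  regroupˡ = solve-∀ ℚ-ring
  regroupʳ : ∀ bc be ce p q r → (bc ℚ.* be ℚ.* p) ℚ.* (ce ℚ.* (q ℚ.* r)) ≡ bc ℚ.* be ℚ.* ce ℚ.* (p ℚ.* q ℚ.* r)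
  regroupʳ = solve-∀ ℚ-ring
  swapʳ : ∀ p q r → p ℚ.* (q ℚ.* r) ≡ (p ℚ.* r) ℚ.* q
  swapʳ = solve-∀ ℚ-ring
  expandˡ : ∀ d e → sign (crossings d e) ℚ.* (coeff (f ⊗ g) d ℚ.* coeff h e) ≡ ∑[ splits d ] (λ (b , c) → F b c e)
  expandˡ d e = begin
    sign (crossings d e) ℚ.* (coeff (f ⊗ g) d ℚ.* coeff h e)
      ≡⟨ swapʳ (sign (crossings d e)) (coeff (f ⊗ g) d) (coeff h e) ⟩
    (sign (crossings d e) ℚ.* coeff h e) ℚ.* coeff (f ⊗ g) d
      ≡⟨ cong ((sign (crossings d e) ℚ.* coeff h e) ℚ.*_) (coeff-⊗ f g d) ⟩
    (sign (crossings d e) ℚ.* coeff h e) ℚ.* ∑[ splits d ] productTerm f g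
      ≡⟨ ∑-*ˡ (sign (crossings d e) ℚ.* coeff h e) (productTerm f g) (splits d) ⟨
    ∑[ splits d ] (λ bc → (sign (crossings d e) ℚ.* coeff h e) ℚ.* productTerm f g bc)
      ≡⟨ ∑-splits-cong d (λ {b} {c} s → trans
           (cong (λ u → (u ℚ.* coeff h e) ℚ.* productTerm f g (b , c))
             (trans (cong sign (sym (crossings-+ˡ s e))) (sign-+ (crossings b e) (crossings c e))))
           (regroupˡ (sign (crossings b c)) (sign (crossings b e)) (sign (crossings c e)) (coeff f b) (coeff g c) (coeff h e))) ⟩
    ∑[ splits d ] (λ (b , c) → F b c e) ∎
  expandʳ : ∀ b d → sign (crossings b d) ℚ.* (coeff f b ℚ.* coeff (g ⊗ h) d) ≡ ∑[ splits d ] (λ (c , e) → F b c e)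
  expandʳ b d = begin
    sign (crossings b d) ℚ.* (coeff f b ℚ.* coeff (g ⊗ h) d)
      ≡⟨ ℚ.*-assoc (sign (crossings b d)) (coeff f b) (coeff (g ⊗ h) d) ⟨
    (sign (crossings b d) ℚ.* coeff f b) ℚ.* coeff (g ⊗ h) d
      ≡⟨ cong ((sign (crossings b d) ℚ.* coeff f b) ℚ.*_) (coeff-⊗ g h d) ⟩
    (sign (crossings b d) ℚ.* coeff f b) ℚ.* ∑[ splits d ] productTerm g h
      ≡⟨ ∑-*ˡ (sign (crossings b d) ℚ.* coeff f b) (productTerm g h) (splits d) ⟨
    ∑[ splits d ] (λ ce → (sign (crossings b d) ℚ.* coeff f b) ℚ.* productTerm g h ce)
      ≡⟨ ∑-splits-cong d (λ {c} {e} s → trans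
           (cong (λ u → (u ℚ.* coeff f b) ℚ.* productTerm g h (c , e))
             (trans (cong sign (sym (crossings-+ʳ s b))) (sign-+ (crossings b c) (crossings b e))))
           (regroupʳ (sign (crossings b c)) (sign (crossings b e)) (sign (crossings c e)) (coeff f b) (coeff g c) (coeff h e))) ⟩
    ∑[ splits d ] (λ (c , e) → F b c e) ∎

⊗-distribˡ-≈ : ∀ f g h → f ⊗ (g ⊕ h) ≈ f ⊗ g ⊕ f ⊗ h
⊗-distribˡ-≈ f g h m = begin
  coeff (f ⊗ (g ⊕ h)) m
    ≡⟨ coeff-⊗ f (g ⊕ h) m ⟩
  ∑[ splits m ] productTerm f (g ⊕ h)
    ≡⟨ ∑-cong (splits m) (λ (a , b) → trans
         (cong (λ u → sign (crossings a b) ℚ.* (coeff f a ℚ.* u)) (coeff-⊕ g h b))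
         (distrib (sign (crossings a b)) (coeff f a) (coeff g b) (coeff h b))) ⟩
  ∑[ splits m ] (λ ab → productTerm f g ab ℚ.+ productTerm f h ab)
    ≡⟨ ∑-+ (productTerm f g) (productTerm f h) (splits m) ⟩
  ∑[ splits m ] productTerm f g ℚ.+ ∑[ splits m ] productTerm f h
    ≡⟨ cong₂ ℚ._+_ (coeff-⊗ f g m) (coeff-⊗ f h m) ⟨
  coeff (f ⊗ g) m ℚ.+ coeff (f ⊗ h) m
    ≡⟨ coeff-⊕ (f ⊗ g) (f ⊗ h) m ⟨
  coeff (f ⊗ g ⊕ f ⊗ h) m ∎
  where
  open ≡-Reasoning
  distrib : ∀ s p q r → s ℚ.* (p ℚ.* (q ℚ.+ r)) ≡ s ℚ.* (p ℚ.* q) ℚ.+ s ℚ.* (p ℚ.* r)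
  distrib = solve-∀ ℚ-ring

⊗-distribʳ-≈ : ∀ f g h → (g ⊕ h) ⊗ f ≈ g ⊗ f ⊕ h ⊗ f
⊗-distribʳ-≈ f g h m = begin
  coeff ((g ⊕ h) ⊗ f) m
    ≡⟨ coeff-⊗ (g ⊕ h) f m ⟩
  ∑[ splits m ] productTerm (g ⊕ h) f
    ≡⟨ ∑-cong (splits m) (λ (a , b) → trans
         (cong (λ u → sign (crossings a b) ℚ.* (u ℚ.* coeff f b)) (coeff-⊕ g h a))
         (distrib (sign (crossings a b)) (coeff f b) (coeff g a) (coeff h a))) ⟩
  ∑[ splits m ] (λ ab → productTerm g f ab ℚ.+ productTerm h f ab)
    ≡⟨ ∑-+ (productTerm g f) (productTerm h f) (splits m) ⟩
  ∑[ splits m ] productTerm g f ℚ.+ ∑[ splits m ] productTerm h f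
    ≡⟨ cong₂ ℚ._+_ (coeff-⊗ g f m) (coeff-⊗ h f m) ⟨
  coeff (g ⊗ f) m ℚ.+ coeff (h ⊗ f) m
    ≡⟨ coeff-⊕ (g ⊗ f) (h ⊗ f) m ⟨
  coeff (g ⊗ f ⊕ h ⊗ f) m ∎
  where
  open ≡-Reasoning
  distrib : ∀ s p q r → s ℚ.* ((q ℚ.+ r) ℚ.* p) ≡ s ℚ.* (q ℚ.* p) ℚ.+ s ℚ.* (r ℚ.* p)
  distrib = solve-∀ ℚ-ring

⊙-⊗ˡ-≈ : ∀ q f g → (q ⊙ f) ⊗ g ≈ q ⊙ (f ⊗ g)
⊙-⊗ˡ-≈ q f g m = begin
  coeff ((q ⊙ f) ⊗ g) m
    ≡⟨ coeff-⊗ (q ⊙ f) g m ⟩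
  ∑[ splits m ] productTerm (q ⊙ f) g
    ≡⟨ ∑-cong (splits m) (λ (a , b) → trans
         (cong (λ u → sign (crossings a b) ℚ.* (u ℚ.* coeff g b)) (coeff-⊙ q f a))
         (regroup (sign (crossings a b)) q (coeff f a) (coeff g b))) ⟩
  ∑[ splits m ] (λ ab → q ℚ.* productTerm f g ab)
    ≡⟨ ∑-*ˡ q (productTerm f g) (splits m) ⟩
  q ℚ.* ∑[ splits m ] productTerm f g
    ≡⟨ cong (q ℚ.*_) (coeff-⊗ f g m) ⟨
  q ℚ.* coeff (f ⊗ g) m
    ≡⟨ coeff-⊙ q (f ⊗ g) m ⟨
  coeff (q ⊙ (f ⊗ g)) m ∎
  where
  open ≡-Reasoning
  regroup : ∀ s q f g → s ℚ.* ((q ℚ.* f) ℚ.* g) ≡ q ℚ.* (s ℚ.* (f ℚ.* g))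
  regroup = solve-∀ ℚ-ring

-- By `crossings-swap` the two orders differ by the sign of the product of the odd degrees. The
-- hypothesis is weighted with the coefficients, so that pairs with a vanishing coefficient impose
-- nothing; it covers supercommutation as well as centrality of even series.
⊗-sign-comm-≈ : ∀ s f g →
  (∀ a b → sign (oddDegree a ℕ.* oddDegree b) ℚ.* (coeff f a ℚ.* coeff g b) ≡ s ℚ.* (coeff f a ℚ.* coeff g b)) →
  f ⊗ g ≈ s ⊙ (g ⊗ f)
⊗-sign-comm-≈ s f g eq m = begin
  coeff (f ⊗ g) m
    ≡⟨ coeff-⊗ f g m ⟩
  ∑[ splits m ] productTerm f g
    ≡⟨ ∑-splits-cong m (λ {a} {b} → swapped {a} {b}) ⟩
  ∑[ splits m ] (λ (a , b) → s ℚ.* productTerm g f (b , a))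
    ≡⟨ ∑-comm splits-cocommutative m (λ a b → s ℚ.* productTerm g f (b , a)) ⟩
  ∑[ splits m ] (λ ab → s ℚ.* productTerm g f ab)
    ≡⟨ ∑-*ˡ s (productTerm g f) (splits m) ⟩
  s ℚ.* ∑[ splits m ] productTerm g f
    ≡⟨ cong (s ℚ.*_) (coeff-⊗ g f m) ⟨
  s ℚ.* coeff (g ⊗ f) m
    ≡⟨ coeff-⊙ s (g ⊗ f) m ⟨
  coeff (s ⊙ (g ⊗ f)) m ∎
  where
  open ≡-Reasoning
  regroup₁ : ∀ u v p q → (u ℚ.* (v ℚ.* v)) ℚ.* (p ℚ.* q) ≡ v ℚ.* ((u ℚ.* v) ℚ.* (p ℚ.* q))
  regroup₁ = solve-∀ ℚ-ring
  regroup₂ : ∀ s v p q → v ℚ.* (s ℚ.* (p ℚ.* q)) ≡ s ℚ.* (v ℚ.* (q ℚ.* p))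
  regroup₂ = solve-∀ ℚ-ring
  swapped : ∀ {a b} → Splits a b m → productTerm f g (a , b) ≡ s ℚ.* productTerm g f (b , a)
  swapped {a} {b} ab = begin
    sign (crossings a b) ℚ.* (coeff f a ℚ.* coeff g b)
      ≡⟨ cong (ℚ._* (coeff f a ℚ.* coeff g b)) (ℚ.*-identityʳ (sign (crossings a b))) ⟨
    (sign (crossings a b) ℚ.* 1ℚ) ℚ.* (coeff f a ℚ.* coeff g b)
      -- The opposite sign is inserted twice: one copy combines with `sign (crossings a b)`, the
      -- other becomes the sign of the exchanged product.
      ≡⟨ cong (λ u → (sign (crossings a b) ℚ.* u) ℚ.* (coeff f a ℚ.* coeff g b)) (sign-² (crossings b a)) ⟨
    (sign (crossings a b) ℚ.* (sign (crossings b a) ℚ.* sign (crossings b a))) ℚ.* (coeff f a ℚ.* coeff g b)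
      ≡⟨ regroup₁ (sign (crossings a b)) (sign (crossings b a)) (coeff f a) (coeff g b) ⟩
    sign (crossings b a) ℚ.* ((sign (crossings a b) ℚ.* sign (crossings b a)) ℚ.* (coeff f a ℚ.* coeff g b))
      ≡⟨ cong (λ u → sign (crossings b a) ℚ.* (u ℚ.* (coeff f a ℚ.* coeff g b)))
           (trans (sym (sign-+ (crossings a b) (crossings b a))) (cong sign (crossings-swap ab))) ⟩
    sign (crossings b a) ℚ.* (sign (oddDegree a ℕ.* oddDegree b) ℚ.* (coeff f a ℚ.* coeff g b))
      ≡⟨ cong (sign (crossings b a) ℚ.*_) (eq a b) ⟩
    sign (crossings b a) ℚ.* (s ℚ.* (coeff f a ℚ.* coeff g b))
      ≡⟨ regroup₂ s (sign (crossings b a)) (coeff f a) (coeff g b) ⟩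
    s ℚ.* (sign (crossings b a) ℚ.* (coeff g b ℚ.* coeff f a)) ∎

-- Either the monomial has the odd degree of the series, or its coefficient is 0 and the sign does
-- not matter.
sign-homogeneous : ∀ {f d} → Homogeneous oddGrading f d → ∀ n a q →
  sign (oddDegree a ℕ.* n) ℚ.* (coeff f a ℚ.* q) ≡ sign (d ℕ.* n) ℚ.* (coeff f a ℚ.* q)
sign-homogeneous {f} {d} hf n a q with degree oddGrading a ℕ.≟ d
... | yes refl = cong (λ e → sign (e ℕ.* n) ℚ.* (coeff f a ℚ.* q)) (oddDegree≡degree a)
... | no  a≢d rewrite hf a a≢d = trans (vanish (sign (oddDegree a ℕ.* n)) q) (sym (vanish (sign (d ℕ.* n)) q))
  where
  vanish : ∀ p q → p ℚ.* (0ℚ ℚ.* q) ≡ 0ℚ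
  vanish = solve-∀ ℚ-ring

⊗-supercomm-≈ : ∀ {f g d e} → Homogeneous oddGrading f d → Homogeneous oddGrading g e →
  f ⊗ g ≈ sign (d ℕ.* e) ⊙ (g ⊗ f)
⊗-supercomm-≈ {f} {g} {d} {e} hf hg = ⊗-sign-comm-≈ (sign (d ℕ.* e)) f g (λ a b → begin
  sign (oddDegree a ℕ.* oddDegree b) ℚ.* (coeff f a ℚ.* coeff g b)
    ≡⟨ sign-homogeneous {f} hf (oddDegree b) a (coeff g b) ⟩
  sign (d ℕ.* oddDegree b) ℚ.* (coeff f a ℚ.* coeff g b)
    ≡⟨ cong₂ (λ n q → sign n ℚ.* q) (ℕ.*-comm d (oddDegree b)) (ℚ.*-comm (coeff f a) (coeff g b)) ⟩
  sign (oddDegree b ℕ.* d) ℚ.* (coeff g b ℚ.* coeff f a)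
    ≡⟨ sign-homogeneous {g} hg d b (coeff f a) ⟩
  sign (e ℕ.* d) ℚ.* (coeff g b ℚ.* coeff f a)
    ≡⟨ cong₂ (λ n q → sign n ℚ.* q) (ℕ.*-comm e d) (ℚ.*-comm (coeff g b) (coeff f a)) ⟩
  sign (d ℕ.* e) ℚ.* (coeff f a ℚ.* coeff g b) ∎)
  where open ≡-Reasoning

sign-even : ∀ k n → sign ((k ℕ.+ k) ℕ.* n) ≡ 1ℚ
sign-even k n = trans (cong sign (ℕ.*-distribʳ-+ n k k)) (trans (sign-+ (k ℕ.* n) (k ℕ.* n)) (sign-² (k ℕ.* n)))

-- Evenness is presented as k + k, which turns the sign into a square: k = 0 for series without odd
-- variables, k = 1 for products of two odd series. Nothing is assumed about the parity of g.
even-central-≈ : ∀ {f} k → Homogeneous oddGrading f (k ℕ.+ k) → ∀ g → f ⊗ g ≈ 1ℚ ⊙ (g ⊗ f)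
even-central-≈ {f} k hf g = ⊗-sign-comm-≈ 1ℚ f g (λ a b →
  trans (sign-homogeneous {f} hf (oddDegree b) a (coeff g b))
        (cong (ℚ._* (coeff f a ℚ.* coeff g b)) (sign-even k (oddDegree b))))

⊗-identityˡ-≈ : ∀ f → 𝟏 ⊗ f ≈ f
⊗-identityˡ-≈ f m = begin
  coeff (𝟏 ⊗ f) m
    ≡⟨ cong (λ u → coeff (u ⊗ f) m) 1≡𝟏 ⟨
  coeff (1# ⊗ f) m
    ≡⟨ coeff-⊗ 1# f m ⟩
  ∑[ splits m ] (λ (a , b) → sign (crossings a b) ℚ.* (χ (sameMonomial [] a) ℚ.* coeff f b))
    ≡⟨ ∑-cong (splits m) (λ (a , b) → swap (sign (crossings a b)) (χ (sameMonomial [] a)) (coeff f b)) ⟩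
  ∑[ splits m ] (λ (a , b) → χ (sameMonomial [] a) ℚ.* (sign (crossings a b) ℚ.* coeff f b))
    ≡⟨ ∑-splits-unit m (λ a b → sign (crossings a b) ℚ.* coeff f b) ⟩
  sign (crossings (one m) m) ℚ.* coeff f m
    ≡⟨ cong (λ n → sign n ℚ.* coeff f m) (crossings-even (one m) m (oddDegree-one m)) ⟩
  1ℚ ℚ.* coeff f m
    ≡⟨ ℚ.*-identityˡ (coeff f m) ⟩
  coeff f m ∎
  where
  open ≡-Reasoning
  swap : ∀ p q r → p ℚ.* (q ℚ.* r) ≡ q ℚ.* (p ℚ.* r)
  swap = solve-∀ ℚ-ring

⊗-even-at : ∀ {f g} → Homogeneous oddGrading f 0 → ∀ m →
  coeff (f ⊗ g) m ≡ ∑[ splits m ] (λ (a , b) → coeff f a ℚ.* coeff g b)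
⊗-even-at {f} {g} hf m = trans (coeff-⊗ f g m) (∑-cong (splits m) (λ (a , b) → term a b))
  where
  term : ∀ a b → productTerm f g (a , b) ≡ coeff f a ℚ.* coeff g b
  term a b with degree oddGrading a ℕ.≟ 0
  ... | yes a≡0 rewrite crossings-even a b (trans (oddDegree≡degree a) a≡0) = ℚ.*-identityˡ _
  ... | no  a≢0 rewrite hf a a≢0 = trans (cong (sign (crossings a b) ℚ.*_) (ℚ.*-zeroˡ (coeff g b)))
                                    (trans (ℚ.*-zeroʳ (sign (crossings a b))) (sym (ℚ.*-zeroˡ (coeff g b))))

Homogeneous-𝟏 : ∀ G → Homogeneous G 𝟏 0
Homogeneous-𝟏 G = subst (λ f → Homogeneous G f 0) 1≡𝟏 (Homogeneous-monomial G [])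

Homogeneous-⊗ : ∀ G {f g d e} → Homogeneous G f d → Homogeneous G g e → Homogeneous G (f ⊗ g) (d ℕ.+ e)
Homogeneous-⊗ G {f} {g} {d} {e} hf hg m m≢ =
  trans (coeff-⊗ f g m) (trans (∑-splits-cong m (λ {a} {b} → vanish {a} {b})) (∑-zero (splits m)))
  where
  vanish : ∀ {a b} → Splits a b m → productTerm f g (a , b) ≡ 0ℚ
  vanish {a} {b} s with degree G a ℕ.≟ d
  ... | no  a≢d rewrite hf a a≢d = trans (cong (sign (crossings a b) ℚ.*_) (ℚ.*-zeroˡ (coeff g b))) (ℚ.*-zeroʳ (sign (crossings a b)))
  ... | yes refl rewrite hg b (λ b≡e → m≢ (trans (sym (degree-+ G s)) (cong (degree G a ℕ.+_) b≡e))) =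
    trans (cong (sign (crossings a b) ℚ.*_) (ℚ.*-zeroʳ (coeff f a))) (ℚ.*-zeroʳ (sign (crossings a b)))

-- `E` rescales each monomial by an additive degree and moves no variable, so the Leibniz rule
-- carries no sign.
E-⊗-≈ : ∀ f g → E (f ⊗ g) ≈ E f ⊗ g ⊕ f ⊗ E g
E-⊗-≈ f g m = begin
  coeff (E (f ⊗ g)) m
    ≡⟨ trans (coeff-E (f ⊗ g) m) (cong (fromℕ (deg m) ℚ.*_) (coeff-⊗ f g m)) ⟩
  fromℕ (deg m) ℚ.* ∑[ splits m ] productTerm f g
    ≡⟨ ∑-*ˡ (fromℕ (deg m)) (productTerm f g) (splits m) ⟨
  ∑[ splits m ] (λ ab → fromℕ (deg m) ℚ.* productTerm f g ab)
    ≡⟨ ∑-splits-cong m (λ {a} {b} → leibniz {a} {b}) ⟩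
  ∑[ splits m ] (λ ab → productTerm (E f) g ab ℚ.+ productTerm f (E g) ab)
    ≡⟨ ∑-+ (productTerm (E f) g) (productTerm f (E g)) (splits m) ⟩
  ∑[ splits m ] productTerm (E f) g ℚ.+ ∑[ splits m ] productTerm f (E g)
    ≡⟨ cong₂ ℚ._+_ (coeff-⊗ (E f) g m) (coeff-⊗ f (E g) m) ⟨
  coeff (E f ⊗ g) m ℚ.+ coeff (f ⊗ E g) m
    ≡⟨ coeff-⊕ (E f ⊗ g) (f ⊗ E g) m ⟨
  coeff (E f ⊗ g ⊕ f ⊗ E g) m ∎
  where
  open ≡-Reasoning
  deg = degree xθ-grading
  expand : ∀ p q s u v → (p ℚ.+ q) ℚ.* (s ℚ.* (u ℚ.* v)) ≡ s ℚ.* ((p ℚ.* u) ℚ.* v) ℚ.+ s ℚ.* (u ℚ.* (q ℚ.* v))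
  expand = solve-∀ ℚ-ring
  leibniz : ∀ {a b} → Splits a b m →
    fromℕ (deg m) ℚ.* productTerm f g (a , b) ≡ productTerm (E f) g (a , b) ℚ.+ productTerm f (E g) (a , b)
  leibniz {a} {b} s = begin
    fromℕ (deg m) ℚ.* productTerm f g (a , b)
      ≡⟨ cong (ℚ._* productTerm f g (a , b)) (trans (cong fromℕ (sym (degree-+ xθ-grading s))) (fromℕ-+ (deg a) (deg b))) ⟩
    (fromℕ (deg a) ℚ.+ fromℕ (deg b)) ℚ.* (sign (crossings a b) ℚ.* (coeff f a ℚ.* coeff g b))
      ≡⟨ expand (fromℕ (deg a)) (fromℕ (deg b)) (sign (crossings a b)) (coeff f a) (coeff g b) ⟩
    sign (crossings a b) ℚ.* ((fromℕ (deg a) ℚ.* coeff f a) ℚ.* coeff g b) ℚ.+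
    sign (crossings a b) ℚ.* (coeff f a ℚ.* (fromℕ (deg b) ℚ.* coeff g b))
      ≡⟨ cong₂ (λ u v → sign (crossings a b) ℚ.* (u ℚ.* coeff g b) ℚ.+ sign (crossings a b) ℚ.* (coeff f a ℚ.* v))
           (coeff-E f a) (coeff-E g b) ⟨
    productTerm (E f) g (a , b) ℚ.+ productTerm f (E g) (a , b) ∎

E-homogeneous-≈ : ∀ {f d} → Homogeneous xθ-grading f d → E f ≈ fromℕ d ⊙ f
E-homogeneous-≈ {f} {d} hf m with degree xθ-grading m ℕ.≟ d
... | yes refl = trans (coeff-E f m) (sym (coeff-⊙ (fromℕ d) f m))
... | no  m≢d  = trans (coeff-E f m) (trans (vanish (fromℕ (degree xθ-grading m))) (trans (sym (vanish (fromℕ d))) (sym (coeff-⊙ (fromℕ d) f m))))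
  where
  vanish : ∀ q → q ℚ.* coeff f m ≡ 0ℚ
  vanish q = trans (cong (q ℚ.*_) (hf m m≢d)) (ℚ.*-zeroʳ q)

-- Junk value 0 at 0.
reciprocal : ℕ → ℚ
reciprocal zero    = 0ℚ
reciprocal (suc n) = ℤ.+ 1 ℚ./ suc n

-- Normalised quotients of variables do not compute, so the comparison is made in the unnormalised
-- rationals.
fromℕ≡/1 : ∀ n → fromℕ n ≡ ℤ.+ n ℚ./ 1
fromℕ≡/1 zero    = refl
fromℕ≡/1 (suc n) = trans (cong (1ℚ ℚ.+_) (fromℕ≡/1 n)) (ℚ.toℚᵘ-injective (begin
  ℚ.toℚᵘ (1ℚ ℚ.+ (ℤ.+ n ℚ./ 1))               ≈⟨ ℚ.toℚᵘ-homo-+ 1ℚ (ℤ.+ n ℚ./ 1) ⟩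
  ℚᵘ.1ℚᵘ ℚᵘ.+ ℚ.toℚᵘ (ℚ.fromℚᵘ (ℚᵘ.mkℚᵘ (ℤ.+ n) 0)) ≈⟨ ℚᵘ.+-congʳ ℚᵘ.1ℚᵘ (ℚ.toℚᵘ-fromℚᵘ (ℚᵘ.mkℚᵘ (ℤ.+ n) 0)) ⟩
  ℚᵘ.1ℚᵘ ℚᵘ.+ ℚᵘ.mkℚᵘ (ℤ.+ n) 0              ≡⟨ cong (λ k → ℚᵘ.mkℚᵘ (ℤ.+ 1 ℤ.+ k) 0) (ℤ.*-identityʳ (ℤ.+ n)) ⟩
  ℚᵘ.mkℚᵘ (ℤ.+ suc n) 0                        ≈⟨ ℚ.toℚᵘ-fromℚᵘ (ℚᵘ.mkℚᵘ (ℤ.+ suc n) 0) ⟨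
  ℚ.toℚᵘ (ℤ.+ suc n ℚ./ 1)                     ∎))
  where open SetoidReasoning ℚᵘ.≃-setoid

fromℕ-*-reciprocal : ∀ n → fromℕ (suc n) ℚ.* reciprocal (suc n) ≡ 1ℚ
fromℕ-*-reciprocal n = trans (cong (ℚ._* reciprocal (suc n)) (fromℕ≡/1 (suc n))) (ℚ.toℚᵘ-injective (begin
  ℚ.toℚᵘ ((ℤ.+ suc n ℚ./ 1) ℚ.* (ℤ.+ 1 ℚ./ suc n))
    ≈⟨ ℚ.toℚᵘ-homo-* (ℤ.+ suc n ℚ./ 1) (ℤ.+ 1 ℚ./ suc n) ⟩
  ℚ.toℚᵘ (ℚ.fromℚᵘ (ℚᵘ.mkℚᵘ (ℤ.+ suc n) 0)) ℚᵘ.* ℚ.toℚᵘ (ℚ.fromℚᵘ (ℚᵘ.mkℚᵘ (ℤ.+ 1) n))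
    ≈⟨ ℚᵘ.*-cong (ℚ.toℚᵘ-fromℚᵘ (ℚᵘ.mkℚᵘ (ℤ.+ suc n) 0)) (ℚ.toℚᵘ-fromℚᵘ (ℚᵘ.mkℚᵘ (ℤ.+ 1) n)) ⟩
  ℚᵘ.mkℚᵘ (ℤ.+ suc n) 0 ℚᵘ.* ℚᵘ.mkℚᵘ (ℤ.+ 1) n
    ≈⟨ ℚᵘ.*≡* (trans (ℤ.*-identityʳ _) (trans (ℤ.*-identityʳ (ℤ.+ suc n)) (trans (cong (λ k → ℤ.+ suc k) (sym (ℕ.+-identityʳ n))) (sym (ℤ.*-identityˡ _))))) ⟩
  ℚᵘ.1ℚᵘ ∎))
  where open SetoidReasoning ℚᵘ.≃-setoid

fromℕ-cancel : ∀ n {p q} → fromℕ (suc n) ℚ.* p ≡ fromℕ (suc n) ℚ.* q → p ≡ q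
fromℕ-cancel n {p} {q} eq = trans (sym (undo p)) (trans (cong (reciprocal (suc n) ℚ.*_) eq) (undo q))
  where
  undo : ∀ r → reciprocal (suc n) ℚ.* (fromℕ (suc n) ℚ.* r) ≡ r
  undo r = begin
    reciprocal (suc n) ℚ.* (fromℕ (suc n) ℚ.* r)   ≡⟨ regroup (reciprocal (suc n)) (fromℕ (suc n)) r ⟩
    (fromℕ (suc n) ℚ.* reciprocal (suc n)) ℚ.* r   ≡⟨ cong (ℚ._* r) (fromℕ-*-reciprocal n) ⟩
    1ℚ ℚ.* r                                       ≡⟨ ℚ.*-identityˡ r ⟩
    r                                              ∎
    where
    open ≡-Reasoning
    regroup : ∀ p q r → p ℚ.* (q ℚ.* r) ≡ (q ℚ.* p) ℚ.* r
    regroup = solve-∀ ℚ-ring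

-- Truncated series and logarithmic derivatives

xθ-degree : Monomial → ℕ
xθ-degree = degree xθ-grading

power : Series → ℕ → Series
power f zero    = 𝟏
power f (suc n) = f ⊗ power f n

sumTo : (ℕ → Series) → ℕ → Series
sumTo f zero    = 𝟎
sumTo f (suc n) = sumTo f n ⊕ f n

⨁ ⨂ : (A → Series) → List A → Series
⨁ f = foldr (λ a s → f a ⊕ s) 𝟎
⨂ f = foldr (λ a s → f a ⊗ s) 𝟏

Homogeneous-power : ∀ G {f d} n → Homogeneous G f d → Homogeneous G (power f n) (n ℕ.* d)
Homogeneous-power G zero    hf = Homogeneous-𝟏 G
Homogeneous-power G (suc n) hf = Homogeneous-⊗ G hf (Homogeneous-power G n hf)

-- Series in the variables of index < N, modulo terms of degree > D in (x, θ).
module Truncated (N D : ℕ) where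

  infix 4 _∼_
  -- A record, so that f and g can be inferred from a proof. Length exactly N suffices for the first
  -- N variables, since shorter lists can be padded by coherence, and it is preserved by
  -- factorisation.
  record _∼_ (f g : Series) : Set where
    constructor agreeing
    field
      agree : ∀ m → length m ≡ N → xθ-degree m ≤ D → coeff f m ≡ coeff g m

  open _∼_ public

  ≈⇒∼ : ∀ {f g} → f ≈ g → f ∼ g
  ≈⇒∼ f≈g = agreeing (λ m _ _ → f≈g m)

  ≡⇒∼ : ∀ {f g} → f ≡ g → f ∼ g
  ≡⇒∼ refl = agreeing (λ _ _ _ → refl)

  ⊕-cong : ∀ {f f′ g g′} → f ∼ f′ → g ∼ g′ → f ⊕ g ∼ f′ ⊕ g′
  ⊕-cong {f} {f′} {g} {g′} p q = agreeing (λ m l d → trans (coeff-⊕ f g m)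
    (trans (cong₂ ℚ._+_ (agree p m l d) (agree q m l d)) (sym (coeff-⊕ f′ g′ m))))

  ⊖-cong : ∀ {f f′} → f ∼ f′ → ⊖ f ∼ ⊖ f′
  ⊖-cong {f} {f′} p = agreeing (λ m l d → trans (coeff-⊖ f m) (trans (cong ℚ.-_ (agree p m l d)) (sym (coeff-⊖ f′ m))))

  ⊙-cong : ∀ q {f f′} → f ∼ f′ → q ⊙ f ∼ q ⊙ f′
  ⊙-cong q {f} {f′} p = agreeing (λ m l d → trans (coeff-⊙ q f m)
    (trans (cong (q ℚ.*_) (agree p m l d)) (sym (coeff-⊙ q f′ m))))

  E-cong : ∀ {f f′} → f ∼ f′ → E f ∼ E f′
  E-cong {f} {f′} p = agreeing (λ m l d → trans (coeff-E f m)
    (trans (cong (fromℕ (xθ-degree m) ℚ.*_) (agree p m l d)) (sym (coeff-E f′ m))))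

  ⊗-cong : ∀ {f f′ g g′} → f ∼ f′ → g ∼ g′ → f ⊗ g ∼ f′ ⊗ g′
  ⊗-cong {f} {f′} {g} {g′} p q = agreeing (λ m l d → ⊗-cong-at f f′ g g′ m
    (λ {a} {b} s → agree p a (trans (Splits-lengthˡ s) l) (ℕ.≤-trans (ℕ.m+n≤o⇒m≤o _ (ℕ.≤-reflexive (degree-+ xθ-grading s))) d))
    (λ {a} {b} s → agree q b (trans (Splits-lengthʳ s) l) (ℕ.≤-trans (ℕ.m+n≤o⇒n≤o (xθ-degree a) (ℕ.≤-reflexive (degree-+ xθ-grading s))) d)))

  even-central : ∀ {f} k → Homogeneous oddGrading f (k ℕ.+ k) → ∀ g → f ⊗ g ∼ g ⊗ f
  even-central {f} k hf g = agreeing (λ m _ _ → trans (even-central-≈ {f} k hf g m)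
    (trans (coeff-⊙ 1ℚ (g ⊗ f) m) (ℚ.*-identityˡ _)))

  seriesRing : Ring 0ℓ 0ℓ
  seriesRing = record
    { Carrier = Series ; _≈_ = _∼_ ; _+_ = _⊕_ ; _*_ = _⊗_ ; -_ = ⊖_ ; 0# = 𝟎 ; 1# = 𝟏
    ; isRing = record
      { +-isAbelianGroup = record
        { isGroup = record
          { isMonoid = record
            { isSemigroup = record
              { isMagma = record
                { isEquivalence = record
                  { refl  = agreeing (λ _ _ _ → refl)
                  ; sym   = λ p → agreeing (λ m l d → sym (agree p m l d))
                  ; trans = λ p q → agreeing (λ m l d → trans (agree p m l d) (agree q m l d)) }
                ; ∙-cong = ⊕-cong }
              ; assoc = λ f g h → agreeing (λ m _ _ → begin
                  coeff (f ⊕ g ⊕ h) m                          ≡⟨ trans (coeff-⊕ (f ⊕ g) h m) (cong (ℚ._+ coeff h m) (coeff-⊕ f g m)) ⟩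
                  (coeff f m ℚ.+ coeff g m) ℚ.+ coeff h m      ≡⟨ ℚ.+-assoc (coeff f m) (coeff g m) (coeff h m) ⟩
                  coeff f m ℚ.+ (coeff g m ℚ.+ coeff h m)      ≡⟨ trans (coeff-⊕ f (g ⊕ h) m) (cong (coeff f m ℚ.+_) (coeff-⊕ g h m)) ⟨
                  coeff (f ⊕ (g ⊕ h)) m                        ∎) }
            ; identity = +-identityˡ , λ f → ⊕-trans (+-comm f 𝟎) (+-identityˡ f) }
          ; inverse = +-inverseˡ , λ f → ⊕-trans (+-comm f (⊖ f)) (+-inverseˡ f)
          ; ⁻¹-cong = ⊖-cong }
        ; comm = +-comm }
      ; *-cong = ⊗-cong
      ; *-assoc = λ f g h → ≈⇒∼ (⊗-assoc-≈ f g h)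
      ; *-identity = (λ f → ≈⇒∼ (⊗-identityˡ-≈ f)) ,
          (λ f → ⊕-trans (⊕-sym (even-central {𝟏} 0 (Homogeneous-𝟏 oddGrading) f)) (≈⇒∼ (⊗-identityˡ-≈ f)))
      ; distrib = (λ f g h → ≈⇒∼ (⊗-distribˡ-≈ f g h)) , (λ f g h → ≈⇒∼ (⊗-distribʳ-≈ f g h)) } }
    where
    open ≡-Reasoning
    ⊕-trans : ∀ {f g h} → f ∼ g → g ∼ h → f ∼ h
    ⊕-trans p q = agreeing (λ m l d → trans (agree p m l d) (agree q m l d))
    ⊕-sym : ∀ {f g} → f ∼ g → g ∼ f
    ⊕-sym p = agreeing (λ m l d → sym (agree p m l d))
    +-comm : ∀ f g → f ⊕ g ∼ g ⊕ f
    +-comm f g = agreeing (λ m _ _ → trans (coeff-⊕ f g m) (trans (ℚ.+-comm (coeff f m) (coeff g m)) (sym (coeff-⊕ g f m))))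
    +-identityˡ : ∀ f → 𝟎 ⊕ f ∼ f
    +-identityˡ f = agreeing (λ m _ _ → trans (coeff-⊕ 𝟎 f m) (trans (cong (ℚ._+ coeff f m) (coeff-𝟎 m)) (ℚ.+-identityˡ (coeff f m))))
    +-inverseˡ : ∀ f → ⊖ f ⊕ f ∼ 𝟎
    +-inverseˡ f = agreeing (λ m _ _ → trans (coeff-⊕ (⊖ f) f m)
      (trans (cong (ℚ._+ coeff f m) (coeff-⊖ f m)) (trans (ℚ.+-inverseˡ (coeff f m)) (sym (coeff-𝟎 m)))))

  open Ring seriesRing public
    using (+-comm; +-assoc; +-identityˡ; +-identityʳ; +-congˡ; +-congʳ; -‿inverseʳ;
           *-assoc; *-identityˡ; *-identityʳ; *-congˡ; *-congʳ; distribˡ; distribʳ; zeroˡ; zeroʳ; setoid)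
    renaming (refl to ∼-refl; sym to ∼-sym; trans to ∼-trans)
  open RingProperties seriesRing public using (-‿distribˡ-*)
  open SetoidReasoning setoid

  homogeneous-vanish : ∀ {f d} → Homogeneous xθ-grading f d → D < d → f ∼ 𝟎
  homogeneous-vanish {f} {d} hf D<d = agreeing (λ m _ m≤D →
    trans (hf m (λ m≡d → ℕ.<⇒≱ D<d (ℕ.≤-trans (ℕ.≤-reflexive (sym m≡d)) m≤D))) (sym (coeff-𝟎 m)))

  ⊙-assoc : ∀ p q f → p ⊙ q ⊙ f ∼ (p ℚ.* q) ⊙ f
  ⊙-assoc p q f = agreeing (λ m _ _ → trans (coeff-⊙ p (q ⊙ f) m) (trans (cong (p ℚ.*_) (coeff-⊙ q f m))
    (trans (sym (ℚ.*-assoc p q (coeff f m))) (sym (coeff-⊙ (p ℚ.* q) f m)))))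

  ⊙-identity : ∀ f → 1ℚ ⊙ f ∼ f
  ⊙-identity f = agreeing (λ m _ _ → trans (coeff-⊙ 1ℚ f m) (ℚ.*-identityˡ (coeff f m)))

  ⊙-zero : ∀ f → 0ℚ ⊙ f ∼ 𝟎
  ⊙-zero f = agreeing (λ m _ _ → trans (coeff-⊙ 0ℚ f m) (trans (ℚ.*-zeroˡ (coeff f m)) (sym (coeff-𝟎 m))))

  ⊙-distribʳ : ∀ p q f → (p ℚ.+ q) ⊙ f ∼ p ⊙ f ⊕ q ⊙ f
  ⊙-distribʳ p q f = agreeing (λ m _ _ → trans (coeff-⊙ (p ℚ.+ q) f m)
    (trans (ℚ.*-distribʳ-+ (coeff f m) p q)
      (sym (trans (coeff-⊕ (p ⊙ f) (q ⊙ f) m) (cong₂ ℚ._+_ (coeff-⊙ p f m) (coeff-⊙ q f m))))))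

  ⊙-⊗ˡ : ∀ q f g → (q ⊙ f) ⊗ g ∼ q ⊙ (f ⊗ g)
  ⊙-⊗ˡ q f g = ≈⇒∼ (⊙-⊗ˡ-≈ q f g)

  -- The ring is not commutative; exchanges of even factors below go through this predicate.
  Central : Series → Set
  Central f = ∀ g → f ⊗ g ∼ g ⊗ f

  Central-scalar : ∀ q → Central (q ⊙ 𝟏)
  Central-scalar q = even-central 0 (λ m m≢0 → trans (coeff-⊙ q 𝟏 m)
    (trans (cong (q ℚ.*_) (Homogeneous-𝟏 oddGrading m m≢0)) (ℚ.*-zeroʳ q)))

  ⊙-as-⊗ : ∀ q f → q ⊙ f ∼ (q ⊙ 𝟏) ⊗ f
  ⊙-as-⊗ q f = ∼-sym (∼-trans (⊙-⊗ˡ q 𝟏 f) (⊙-cong q (*-identityˡ f)))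

  ⊙-⊗ʳ : ∀ q f g → f ⊗ (q ⊙ g) ∼ q ⊙ (f ⊗ g)
  ⊙-⊗ʳ q f g = begin
    f ⊗ (q ⊙ g)          ≈⟨ *-congˡ (⊙-as-⊗ q g) ⟩
    f ⊗ ((q ⊙ 𝟏) ⊗ g)    ≈⟨ *-assoc f (q ⊙ 𝟏) g ⟨
    (f ⊗ (q ⊙ 𝟏)) ⊗ g    ≈⟨ *-congʳ (Central-scalar q f) ⟨
    ((q ⊙ 𝟏) ⊗ f) ⊗ g    ≈⟨ *-assoc (q ⊙ 𝟏) f g ⟩
    (q ⊙ 𝟏) ⊗ (f ⊗ g)    ≈⟨ ⊙-as-⊗ q (f ⊗ g) ⟨
    q ⊙ (f ⊗ g)          ∎

  Central-resp : ∀ {f g} → f ∼ g → Central f → Central g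
  Central-resp f∼g cf h = ∼-trans (*-congʳ (∼-sym f∼g)) (∼-trans (cf h) (*-congˡ f∼g))

  Central-𝟎 : Central 𝟎
  Central-𝟎 g = ∼-trans (zeroˡ g) (∼-sym (zeroʳ g))

  Central-𝟏 : Central 𝟏
  Central-𝟏 g = ∼-trans (*-identityˡ g) (∼-sym (*-identityʳ g))

  Central-⊕ : ∀ {f g} → Central f → Central g → Central (f ⊕ g)
  Central-⊕ {f} {g} cf cg h = ∼-trans (distribʳ h f g) (∼-trans (⊕-cong (cf h) (cg h)) (∼-sym (distribˡ h f g)))

  Central-⊗ : ∀ {f g} → Central f → Central g → Central (f ⊗ g)
  Central-⊗ {f} {g} cf cg h = begin
    (f ⊗ g) ⊗ h   ≈⟨ *-assoc f g h ⟩
    f ⊗ (g ⊗ h)   ≈⟨ *-congˡ (cg h) ⟩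
    f ⊗ (h ⊗ g)   ≈⟨ *-assoc f h g ⟨
    (f ⊗ h) ⊗ g   ≈⟨ *-congʳ (cf h) ⟩
    (h ⊗ f) ⊗ g   ≈⟨ *-assoc h f g ⟩
    h ⊗ (f ⊗ g)   ∎

  Central-⊙ : ∀ q {f} → Central f → Central (q ⊙ f)
  Central-⊙ q {f} cf = Central-resp (∼-sym (⊙-as-⊗ q f)) (Central-⊗ (Central-scalar q) cf)

  Central-power : ∀ {f} n → Central f → Central (power f n)
  Central-power zero    cf = Central-𝟏
  Central-power (suc n) cf = Central-⊗ cf (Central-power n cf)

  Central-sumTo : ∀ {f} n → (∀ i → Central (f i)) → Central (sumTo f n)
  Central-sumTo zero    cf = Central-𝟎
  Central-sumTo (suc n) cf = Central-⊕ (Central-sumTo n cf) (cf n)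

  Central-⨁ : ∀ {f : A → Series} as → (∀ a → Central (f a)) → Central (⨁ f as)
  Central-⨁ []       cf = Central-𝟎
  Central-⨁ (a ∷ as) cf = Central-⊕ (cf a) (Central-⨁ as cf)

  ⊕-interchange : ∀ a b c d → (a ⊕ b) ⊕ (c ⊕ d) ∼ (a ⊕ c) ⊕ (b ⊕ d)
  ⊕-interchange a b c d = begin
    (a ⊕ b) ⊕ (c ⊕ d)   ≈⟨ +-assoc a b (c ⊕ d) ⟩
    a ⊕ (b ⊕ (c ⊕ d))   ≈⟨ +-congˡ (+-assoc b c d) ⟨
    a ⊕ ((b ⊕ c) ⊕ d)   ≈⟨ +-congˡ (+-congʳ (+-comm b c)) ⟩
    a ⊕ ((c ⊕ b) ⊕ d)   ≈⟨ +-congˡ (+-assoc c b d) ⟩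
    a ⊕ (c ⊕ (b ⊕ d))   ≈⟨ +-assoc a c (b ⊕ d) ⟨
    (a ⊕ c) ⊕ (b ⊕ d)   ∎

  ⊗-interchange : ∀ a {b} c d → (∀ f → b ⊗ f ∼ f ⊗ b) → (a ⊗ b) ⊗ (c ⊗ d) ∼ (a ⊗ c) ⊗ (b ⊗ d)
  ⊗-interchange a {b} c d cb = begin
    (a ⊗ b) ⊗ (c ⊗ d)   ≈⟨ *-assoc a b (c ⊗ d) ⟩
    a ⊗ (b ⊗ (c ⊗ d))   ≈⟨ *-congˡ (*-assoc b c d) ⟨
    a ⊗ ((b ⊗ c) ⊗ d)   ≈⟨ *-congˡ (*-congʳ (cb c)) ⟩
    a ⊗ ((c ⊗ b) ⊗ d)   ≈⟨ *-congˡ (*-assoc c b d) ⟩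
    a ⊗ (c ⊗ (b ⊗ d))   ≈⟨ *-assoc a c (b ⊗ d) ⟨
    (a ⊗ c) ⊗ (b ⊗ d)   ∎

  sumTo-cong : ∀ {f g} n → (∀ i → f i ∼ g i) → sumTo f n ∼ sumTo g n
  sumTo-cong zero    eq = ∼-refl
  sumTo-cong (suc n) eq = ⊕-cong (sumTo-cong n eq) (eq n)

  sumTo-⊕ : ∀ f g n → sumTo (λ i → f i ⊕ g i) n ∼ sumTo f n ⊕ sumTo g n
  sumTo-⊕ f g zero    = ∼-sym (+-identityˡ 𝟎)
  sumTo-⊕ f g (suc n) = ∼-trans (+-congʳ (sumTo-⊕ f g n)) (⊕-interchange (sumTo f n) (sumTo g n) (f n) (g n))

  ⨁-cong : ∀ {f g : A → Series} as → (∀ {a} → a ∈ as → f a ∼ g a) → ⨁ f as ∼ ⨁ g as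
  ⨁-cong []       eq = ∼-refl
  ⨁-cong (a ∷ as) eq = ⊕-cong (eq (here refl)) (⨁-cong as (eq ∘ there))

  ⨁-++ : ∀ (f : A → Series) as bs → ⨁ f (as ++ bs) ∼ ⨁ f as ⊕ ⨁ f bs
  ⨁-++ f []       bs = ∼-sym (+-identityˡ _)
  ⨁-++ f (a ∷ as) bs = ∼-trans (+-congˡ (⨁-++ f as bs)) (∼-sym (+-assoc (f a) (⨁ f as) (⨁ f bs)))

  ⨁-map : ∀ (f : B → Series) (g : A → B) as → ⨁ f (map g as) ∼ ⨁ (f ∘ g) as
  ⨁-map f g []       = ∼-refl
  ⨁-map f g (a ∷ as) = +-congˡ (⨁-map f g as)

  ⨁-⊕ : ∀ (f g : A → Series) as → ⨁ (λ a → f a ⊕ g a) as ∼ ⨁ f as ⊕ ⨁ g as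
  ⨁-⊕ f g []       = ∼-sym (+-identityˡ 𝟎)
  ⨁-⊕ f g (a ∷ as) = ∼-trans (+-congˡ (⨁-⊕ f g as)) (⊕-interchange (f a) (g a) (⨁ f as) (⨁ g as))

  ⨁-⊗ˡ : ∀ g (f : A → Series) as → ⨁ (λ a → g ⊗ f a) as ∼ g ⊗ ⨁ f as
  ⨁-⊗ˡ g f []       = ∼-sym (zeroʳ g)
  ⨁-⊗ˡ g f (a ∷ as) = ∼-trans (+-congˡ (⨁-⊗ˡ g f as)) (∼-sym (distribˡ g (f a) (⨁ f as)))

  ⨁-⊙ : ∀ q (f : A → Series) as → ⨁ (λ a → q ⊙ f a) as ∼ q ⊙ ⨁ f as
  ⨁-⊙ q f as = ∼-trans (⨁-cong as (λ {a} _ → ⊙-as-⊗ q (f a)))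
    (∼-trans (⨁-⊗ˡ (q ⊙ 𝟏) f as) (∼-sym (⊙-as-⊗ q (⨁ f as))))

  ⨁-𝟎 : ∀ {f : A → Series} as → (∀ {a} → a ∈ as → f a ∼ 𝟎) → ⨁ f as ∼ 𝟎
  ⨁-𝟎 []       eq = ∼-refl
  ⨁-𝟎 (a ∷ as) eq = ∼-trans (⊕-cong (eq (here refl)) (⨁-𝟎 as (eq ∘ there))) (+-identityˡ 𝟎)

  -- Serves twice: to write a product of two power sums as a sum over pairs of indices, and to
  -- factor the sum over superpartitions into its strict and its weak part.
  ⨁-cartesianProduct : ∀ (f : A → Series) (g : B → Series) as bs →
    ⨁ (λ (a , b) → f a ⊗ g b) (cartesianProduct as bs) ∼ ⨁ f as ⊗ ⨁ g bs
  ⨁-cartesianProduct f g []       bs = ∼-sym (zeroˡ _)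
  ⨁-cartesianProduct f g (a ∷ as) bs = begin
    ⨁ h (map (a ,_) bs ++ cartesianProduct as bs)            ≈⟨ ⨁-++ h (map (a ,_) bs) (cartesianProduct as bs) ⟩
    ⨁ h (map (a ,_) bs) ⊕ ⨁ h (cartesianProduct as bs)       ≈⟨ ⊕-cong (⨁-map h (a ,_) bs) (⨁-cartesianProduct f g as bs) ⟩
    ⨁ (λ b → f a ⊗ g b) bs ⊕ ⨁ f as ⊗ ⨁ g bs                 ≈⟨ +-congʳ (⨁-⊗ˡ (f a) g bs) ⟩
    f a ⊗ ⨁ g bs ⊕ ⨁ f as ⊗ ⨁ g bs                           ≈⟨ distribʳ (⨁ g bs) (f a) (⨁ f as) ⟨
    (f a ⊕ ⨁ f as) ⊗ ⨁ g bs                                  ∎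
    where
    h = λ (a , b) → f a ⊗ g b

  ⨁-upTo : ∀ f n → ⨁ f (upTo n) ∼ sumTo f n
  ⨁-upTo f zero    = ∼-refl
  ⨁-upTo f (suc n) = begin
    ⨁ f (upTo (suc n))          ≡⟨ cong (⨁ f) (upTo-∷ʳ n) ⟨
    ⨁ f (upTo n ++ n ∷ [])      ≈⟨ ⨁-++ f (upTo n) (n ∷ []) ⟩
    ⨁ f (upTo n) ⊕ (f n ⊕ 𝟎)    ≈⟨ ⊕-cong (⨁-upTo f n) (+-identityʳ (f n)) ⟩
    sumTo f n ⊕ f n             ∎

  ⨁-sumTo : ∀ (f : ℕ → A → Series) as n → ⨁ (λ a → sumTo (λ i → f i a) n) as ∼ sumTo (λ i → ⨁ (f i) as) n
  ⨁-sumTo f as zero    = ⨁-𝟎 as (λ _ → ∼-refl)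
  ⨁-sumTo f as (suc n) = ∼-trans (⨁-⊕ _ (f n) as) (+-congʳ (⨁-sumTo f as n))

  ⨁-∃++ : ∀ (f : A → Series) as a bs → ⨁ f (as ++ a ∷ bs) ∼ f a ⊕ ⨁ f (as ++ bs)
  ⨁-∃++ f []        a bs = ∼-refl
  ⨁-∃++ f (a′ ∷ as) a bs = begin
    f a′ ⊕ ⨁ f (as ++ a ∷ bs)        ≈⟨ +-congˡ (⨁-∃++ f as a bs) ⟩
    f a′ ⊕ (f a ⊕ ⨁ f (as ++ bs))    ≈⟨ +-assoc (f a′) (f a) _ ⟨
    (f a′ ⊕ f a) ⊕ ⨁ f (as ++ bs)    ≈⟨ +-congʳ (+-comm (f a′) (f a)) ⟩
    (f a ⊕ f a′) ⊕ ⨁ f (as ++ bs)    ≈⟨ +-assoc (f a) (f a′) _ ⟩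
    f a ⊕ (f a′ ⊕ ⨁ f (as ++ bs))    ∎

  -- Unconditional convergence speaks of all sufficiently large duplicate-free lists; this replaces
  -- such a list by a fixed one. Each element of `as` is located in `bs`, moved to the front and
  -- split off, and what remains at the end vanishes.
  ⨁-⊆ : ∀ (f : A → Series) {as bs} → Unique as → Unique bs → as ⊆ bs →
    (∀ {b} → b ∈ bs → b ∉ as → f b ∼ 𝟎) → ⨁ f bs ∼ ⨁ f as
  ⨁-⊆ f {[]}     {bs} _ _ _ vanish = ⨁-𝟎 bs (λ b∈bs → vanish b∈bs (λ ()))
  ⨁-⊆ {A} f {a ∷ as} {bs} uas@(_ ∷ uas′) ubs as⊆bs vanish
    with bs₁ , bs₂ , refl ← ∈-∃++ (as⊆bs (here refl)) = begin
      ⨁ f (bs₁ ++ a ∷ bs₂)      ≈⟨ ⨁-∃++ f bs₁ a bs₂ ⟩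
      f a ⊕ ⨁ f (bs₁ ++ bs₂)    ≈⟨ +-congˡ (⨁-⊆ f uas′ (unique-tail ubs′) as⊆bs′ vanish′) ⟩
      f a ⊕ ⨁ f as              ∎
      where
      move : bs₁ ++ a ∷ bs₂ ↭ a ∷ bs₁ ++ bs₂
      move = shift a bs₁ bs₂
      ubs′ : Unique (a ∷ bs₁ ++ bs₂)
      ubs′ = Permutation.Unique-resp-↭ (≡.setoid A) (↭⇒↭ₛ move) ubs
      unique-tail : ∀ {c cs} → Unique (c ∷ cs) → Unique {A = A} cs
      unique-tail (_ ∷ u) = u
      as⊆bs′ : as ⊆ bs₁ ++ bs₂
      as⊆bs′ c∈as with ∈-resp-↭ move (as⊆bs (there c∈as))
      ... | here refl = ⊥-elim (Unique[x∷xs]⇒x∉xs uas c∈as)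
      ... | there c∈  = c∈
      vanish′ : ∀ {b} → b ∈ bs₁ ++ bs₂ → b ∉ as → f b ∼ 𝟎
      vanish′ {b} b∈ b∉as = vanish b∈bs (λ { (here refl) → Unique[x∷xs]⇒x∉xs ubs′ b∈ ; (there b∈as) → b∉as b∈as })
        where
        b∈bs : b ∈ bs₁ ++ a ∷ bs₂
        b∈bs with ∈-++⁻ bs₁ b∈
        ... | inj₁ b∈₁ = ∈-++⁺ˡ b∈₁
        ... | inj₂ b∈₂ = ∈-++⁺ʳ bs₁ (there b∈₂)

  E-⊗ : ∀ f g → E (f ⊗ g) ∼ E f ⊗ g ⊕ f ⊗ E g
  E-⊗ f g = ≈⇒∼ (E-⊗-≈ f g)

  E-homogeneous : ∀ {f d} → Homogeneous xθ-grading f d → E f ∼ fromℕ d ⊙ f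
  E-homogeneous {f} hf = ≈⇒∼ (E-homogeneous-≈ {f} hf)

  E-⊕ : ∀ f g → E (f ⊕ g) ∼ E f ⊕ E g
  E-⊕ f g = agreeing (λ m _ _ → trans (coeff-E (f ⊕ g) m) (trans (cong (fromℕ (xθ-degree m) ℚ.*_) (coeff-⊕ f g m))
    (trans (ℚ.*-distribˡ-+ (fromℕ (xθ-degree m)) (coeff f m) (coeff g m))
      (sym (trans (coeff-⊕ (E f) (E g) m) (cong₂ ℚ._+_ (coeff-E f m) (coeff-E g m)))))))

  E-⊙ : ∀ q f → E (q ⊙ f) ∼ q ⊙ E f
  E-⊙ q f = agreeing (λ m _ _ → trans (coeff-E (q ⊙ f) m) (trans (cong (fromℕ (xθ-degree m) ℚ.*_) (coeff-⊙ q f m))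
    (trans (swap (fromℕ (xθ-degree m)) q (coeff f m)) (sym (trans (coeff-⊙ q (E f) m) (cong (q ℚ.*_) (coeff-E f m)))))))
    where
    swap : ∀ p q r → p ℚ.* (q ℚ.* r) ≡ q ℚ.* (p ℚ.* r)
    swap = solve-∀ ℚ-ring

  E-𝟏 : E 𝟏 ∼ 𝟎
  E-𝟏 = ∼-trans (E-homogeneous (Homogeneous-𝟏 xθ-grading)) (⊙-zero 𝟏)

  infix 4 _HasLogDerivative_
  -- Stated without division, so that f need not be shown invertible.
  _HasLogDerivative_ : Series → Series → Set
  f HasLogDerivative M = E f ∼ M ⊗ f

  HasLogDerivative-resp : ∀ {f f′ M M′} → f ∼ f′ → M ∼ M′ → f HasLogDerivative M → f′ HasLogDerivative M′
  HasLogDerivative-resp f∼ M∼ h = ∼-trans (E-cong (∼-sym f∼)) (∼-trans h (⊗-cong M∼ f∼))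

  HasLogDerivative-𝟏 : 𝟏 HasLogDerivative 𝟎
  HasLogDerivative-𝟏 = ∼-trans E-𝟏 (∼-sym (zeroˡ 𝟏))

  -- In the second Leibniz term P stands behind f and has to be moved to the front; hence the
  -- centrality of P.
  HasLogDerivative-⊗ : ∀ {f g M P} → Central P → f HasLogDerivative M → g HasLogDerivative P → f ⊗ g HasLogDerivative M ⊕ P
  HasLogDerivative-⊗ {f} {g} {M} {P} cP hf hg = begin
    E (f ⊗ g)                     ≈⟨ E-⊗ f g ⟩
    E f ⊗ g ⊕ f ⊗ E g             ≈⟨ ⊕-cong (*-congʳ hf) (*-congˡ hg) ⟩
    (M ⊗ f) ⊗ g ⊕ f ⊗ (P ⊗ g)     ≈⟨ ⊕-cong (*-assoc M f g) (∼-sym (*-assoc f P g)) ⟩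
    M ⊗ (f ⊗ g) ⊕ (f ⊗ P) ⊗ g     ≈⟨ +-congˡ (*-congʳ (cP f)) ⟨
    M ⊗ (f ⊗ g) ⊕ (P ⊗ f) ⊗ g     ≈⟨ +-congˡ (*-assoc P f g) ⟩
    M ⊗ (f ⊗ g) ⊕ P ⊗ (f ⊗ g)     ≈⟨ distribʳ (f ⊗ g) M P ⟨
    (M ⊕ P) ⊗ (f ⊗ g)             ∎

  HasLogDerivative-⨂ : ∀ {f M : A → Series} as → (∀ a → Central (M a)) → (∀ a → f a HasLogDerivative M a) →
    ⨂ f as HasLogDerivative ⨁ M as
  HasLogDerivative-⨂ []       cM h = HasLogDerivative-𝟏
  HasLogDerivative-⨂ (a ∷ as) cM h = HasLogDerivative-⊗ (Central-⨁ as cM) (h a) (HasLogDerivative-⨂ as cM h)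

  -- In degree d > 0 the equation expresses d · coeff f m by coefficients of f of lower degree.
  logDerivative-unique : ∀ {f g M} → f HasLogDerivative M → g HasLogDerivative M →
    (∀ m → length m ≡ N → xθ-degree m ≡ 0 → coeff M m ≡ 0ℚ) →
    (∀ m → length m ≡ N → xθ-degree m ≡ 0 → coeff f m ≡ coeff g m) → f ∼ g
  logDerivative-unique {f} {g} {M} hf hg M₀ f₀≡g₀ = agreeing (λ m l d → go (xθ-degree m) m l ℕ.≤-refl d)
    where
    -- Induction on a bound n for the degree, because the factors b met below are only known to have
    -- smaller degree than m.
    go : ∀ n m → length m ≡ N → xθ-degree m ≤ n → xθ-degree m ≤ D → coeff f m ≡ coeff g m
    go n m l m≤n m≤D with xθ-degree m in eq
    ... | zero = f₀≡g₀ m l eq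
    go (suc n) m l (s≤s d≤n) m≤D | suc d = fromℕ-cancel d (≡-Reasoning.begin
      fromℕ (suc d) ℚ.* coeff f m
        ≡-Reasoning.≡⟨ trans (cong (λ k → fromℕ k ℚ.* coeff f m) (sym eq)) (sym (coeff-E f m)) ⟩
      coeff (E f) m
        ≡-Reasoning.≡⟨ agree hf m l m≤D′ ⟩
      coeff (M ⊗ f) m
        ≡-Reasoning.≡⟨ trans (coeff-⊗ M f m) (trans (∑-splits-cong m (λ {a} {b} → term {a} {b})) (sym (coeff-⊗ M g m))) ⟩
      coeff (M ⊗ g) m
        ≡-Reasoning.≡⟨ agree hg m l m≤D′ ⟨
      coeff (E g) m
        ≡-Reasoning.≡⟨ trans (coeff-E g m) (cong (λ k → fromℕ k ℚ.* coeff g m) eq) ⟩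
      fromℕ (suc d) ℚ.* coeff g m ≡-Reasoning.∎)
      where
      m≤D′ : xθ-degree m ≤ D
      m≤D′ = ℕ.≤-trans (ℕ.≤-reflexive eq) m≤D
      term : ∀ {a b} → Splits a b m → productTerm M f (a , b) ≡ productTerm M g (a , b)
      term {a} {b} s with xθ-degree a in eqₐ
      -- Here b has the full degree of m, where f and g are not yet compared; the term disappears
      -- because `M` vanishes in degree 0.
      ... | zero rewrite M₀ a (trans (Splits-lengthˡ s) l) eqₐ =
        cong (sign (crossings a b) ℚ.*_) (trans (ℚ.*-zeroˡ (coeff f b)) (sym (ℚ.*-zeroˡ (coeff g b))))
      ... | suc k = cong (λ q → sign (crossings a b) ℚ.* (coeff M a ℚ.* q)) (go n b (trans (Splits-lengthʳ s) l) b≤n b≤D)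
        where
        sum≡ : suc (k ℕ.+ xθ-degree b) ≡ suc d
        sum≡ = trans (cong (ℕ._+ xθ-degree b) (sym eqₐ)) (trans (degree-+ xθ-grading s) eq)
        b≤d : xθ-degree b ≤ d
        b≤d = ℕ.≤-trans (ℕ.m≤n+m (xθ-degree b) k) (ℕ.≤-reflexive (ℕ.suc-injective sum≡))
        b≤n : xθ-degree b ≤ n
        b≤n = ℕ.≤-trans b≤d d≤n
        b≤D : xθ-degree b ≤ D
        b≤D = ℕ.≤-trans (ℕ.≤-trans b≤d (ℕ.n≤1+n d)) m≤D

-- The factors of the kernel and their logarithmic derivatives

X Θ τ : ℕ × ℕ → Series
X (i , j) = x i ⊗ y j
Θ (i , j) = θ i ⊗ φ j
τ ij = X ij ⊕ Θ ij

opaque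
  unfolding _⊕_

  denominator≈ : ∀ ij → denominator ij ≈ 𝟏 ⊕ ⊖ τ ij
  denominator≈ ij@(i , j) m = lemma (coeff 𝟏 m) (coeff (X ij) m) (coeff (Θ ij) m)
    where
    lemma : ∀ p q r → (p ℚ.+ ℚ.- q) ℚ.+ ℚ.- r ≡ p ℚ.+ ℚ.- (q ℚ.+ r)
    lemma = solve-∀ ℚ-ring

sameMonomial-at : ∀ {e} → e ≢ 𝟘 → ∀ i m → length m ≤ i → sameMonomial (at i e) m ≡ false
sameMonomial-at {e} e≢𝟘 zero    []      _       rewrite dec-false (e ≟ᵉ 𝟘) e≢𝟘 = refl
sameMonomial-at {e} e≢𝟘 (suc i) []      _       = sameMonomial-at e≢𝟘 i [] z≤n
sameMonomial-at {e} e≢𝟘 (suc i) (c ∷ m) (s≤s l) rewrite sameMonomial-at e≢𝟘 i m l = Bool.∧-zeroʳ (does (𝟘 ≟ᵉ c))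

q≡-q⇒q≡0 : ∀ q → q ≡ (ℚ.- 1ℚ) ℚ.* q → q ≡ 0ℚ
q≡-q⇒q≡0 q eq = fromℕ-cancel 1 (trans (expand q) (trans (cong (q ℚ.+_) eq) (trans (cancel q) (sym (ℚ.*-zeroʳ (fromℕ 2))))))
  where
  expand : ∀ q → (1ℚ ℚ.+ (1ℚ ℚ.+ 0ℚ)) ℚ.* q ≡ q ℚ.+ q
  expand = solve-∀ ℚ-ring
  cancel : ∀ q → q ℚ.+ (ℚ.- 1ℚ) ℚ.* q ≡ 0ℚ
  cancel = solve-∀ ℚ-ring

geometric : Series → ℕ → Series
geometric f = sumTo (power f)

-- Total in n, so that products over a list of parts need no proofs of nonzeroness. The filler 𝟏 at
-- 0 has the degree that the homogeneity formula predicts there.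
powerSum : Alphabet → ℕ → Series
powerSum a zero    = 𝟏
powerSum a (suc n) = p a (suc n)

u w : ℕ → Series
u n = powerSum xθ n ⊗ powerSum yφ n
w n = p̃ xθ n ⊗ p̃ yφ n

logDerivative : ℕ → Series
logDerivative n = sumTo (λ k → u (suc k)) n ⊕ sumTo (λ k → fromℕ (suc k) ⊙ w k) n

Homogeneous-⊕ : ∀ G {f g d} → Homogeneous G f d → Homogeneous G g d → Homogeneous G (f ⊕ g) d
Homogeneous-⊕ G {f} {g} hf hg m m≢d = trans (coeff-⊕ f g m) (cong₂ ℚ._+_ (hf m m≢d) (hg m m≢d))

X-homogeneous : ∀ G i j → Homogeneous G (X (i , j)) (weight G (bosonic xθ 1) ℕ.+ weight G (bosonic yφ 1))
X-homogeneous G i j = Homogeneous-⊗ G (Homogeneous-at G i (bosonic xθ 1)) (Homogeneous-at G j (bosonic yφ 1))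

Θ-homogeneous : ∀ G i j → Homogeneous G (Θ (i , j)) (weight G (fermionic xθ 0) ℕ.+ weight G (fermionic yφ 0))
Θ-homogeneous G i j = Homogeneous-⊗ G (Homogeneous-at G i (fermionic xθ 0)) (Homogeneous-at G j (fermionic yφ 0))

τ-homogeneous : ∀ ij → Homogeneous xθ-grading (τ ij) 1
τ-homogeneous (i , j) = Homogeneous-⊕ xθ-grading (X-homogeneous xθ-grading i j) (Θ-homogeneous xθ-grading i j)

pairs : ℕ → List (ℕ × ℕ)
pairs n = cartesianProduct (upTo n) (upTo n)

pairs-unique : ∀ n → Unique (pairs n)
pairs-unique n = cartesianProduct⁺ (upTo⁺ n) (upTo⁺ n)

∈-pairs⁺ : ∀ {n i j} → i < n → j < n → (i , j) ∈ pairs n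
∈-pairs⁺ i<n j<n = ∈-cartesianProduct⁺ (∈-upTo⁺ i<n) (∈-upTo⁺ j<n)

∈-pairs⁻ : ∀ {n i j} → (i , j) ∈ pairs n → i < n × j < n
∈-pairs⁻ {n} ij∈ with i∈ , j∈ ← ∈-cartesianProduct⁻ (upTo n) (upTo n) ij∈ = ∈-upTo⁻ i∈ , ∈-upTo⁻ j∈

module Kernel (N D : ℕ) where
  open Truncated N D public
  open SetoidReasoning setoid

  at-𝟎 : ∀ {e} → e ≢ 𝟘 → ∀ i → N ≤ i → monomial (at i e) ∼ 𝟎
  at-𝟎 {e} e≢𝟘 i N≤i = agreeing (λ m l _ →
    trans (cong χ (sameMonomial-at e≢𝟘 i m (subst (_≤ i) (sym l) N≤i))) (sym (coeff-𝟎 m)))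

  -- The cut-off in `sumOverVariables` depends on the monomial, but on lists of length N it is the
  -- constant N.
  sumOverVariables-sumTo : ∀ e e≢𝟘 → sumOverVariables e e≢𝟘 ∼ sumTo (λ i → monomial (at i e)) N
  sumOverVariables-sumTo e e≢𝟘 = agreeing (λ m l _ →
    trans (cong (λ n → Σ< n (λ i → coeff (monomial (at i e)) m)) l) (coeffs N m))
    where
    coeffs : ∀ n m → Σ< n (λ i → coeff (monomial (at i e)) m) ≡ coeff (sumTo (λ i → monomial (at i e)) n) m
    coeffs zero    m = sym (coeff-𝟎 m)
    coeffs (suc n) m = trans (cong (ℚ._+ coeff (monomial (at n e)) m) (coeffs n m)) (sym (coeff-⊕ _ _ m))

  at-⊗ : ∀ i → i < N → ∀ a b a′ b′ s t →
    monomial (at i (exps a b false false)) ⊗ monomial (at i (exps a′ b′ s t)) ∼ monomial (at i (exps (a ℕ.+ a′) (b ℕ.+ b′) s t))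
  at-⊗ i i<N a b a′ b′ s t = agreeing (λ m l _ →
    trans (⊗-even-at {monomial (at i (exps a b false false))} {monomial (at i (exps a′ b′ s t))}
             (Homogeneous-at oddGrading i (exps a b false false)) m)
          (∑-splits-χ-at a b a′ b′ s t i m (subst (i <_) (sym l) i<N)))

  odd-anticomm : ∀ {f g} → Homogeneous oddGrading f 1 → Homogeneous oddGrading g 1 → f ⊗ g ∼ sign 1 ⊙ (g ⊗ f)
  odd-anticomm {f} {g} hf hg = ≈⇒∼ (⊗-supercomm-≈ {f} {g} hf hg)

  -- f anticommutes with itself and 2 is invertible. This applies to the p̃ₙ, which involve
  -- infinitely many odd variables, and not only to single ones.
  odd-square : ∀ {f} → Homogeneous oddGrading f 1 → f ⊗ f ∼ 𝟎
  odd-square {f} hf = agreeing (λ m _ _ → trans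
    (q≡-q⇒q≡0 _ (trans (⊗-supercomm-≈ {f} {f} hf hf m) (coeff-⊙ (sign 1) (f ⊗ f) m))) (sym (coeff-𝟎 m)))

  odd-product-square : ∀ {f g} → Homogeneous oddGrading f 1 → Homogeneous oddGrading g 1 → (f ⊗ g) ⊗ (f ⊗ g) ∼ 𝟎
  odd-product-square {f} {g} hf hg = begin
    (f ⊗ g) ⊗ (f ⊗ g)               ≈⟨ *-assoc f g (f ⊗ g) ⟩
    f ⊗ (g ⊗ (f ⊗ g))               ≈⟨ *-congˡ (*-assoc g f g) ⟨
    f ⊗ ((g ⊗ f) ⊗ g)               ≈⟨ *-congˡ (*-congʳ (odd-anticomm hg hf)) ⟩
    f ⊗ ((sign 1 ⊙ (f ⊗ g)) ⊗ g)    ≈⟨ *-congˡ (⊙-⊗ˡ (sign 1) (f ⊗ g) g) ⟩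
    f ⊗ (sign 1 ⊙ ((f ⊗ g) ⊗ g))    ≈⟨ *-congˡ (⊙-cong (sign 1) (*-assoc f g g)) ⟩
    f ⊗ (sign 1 ⊙ (f ⊗ (g ⊗ g)))    ≈⟨ *-congˡ (⊙-cong (sign 1) (*-congˡ (odd-square hg))) ⟩
    f ⊗ (sign 1 ⊙ (f ⊗ 𝟎))          ≈⟨ *-congˡ (⊙-cong (sign 1) (zeroʳ f)) ⟩
    f ⊗ (sign 1 ⊙ 𝟎)                ≈⟨ ⊙-⊗ʳ (sign 1) f 𝟎 ⟩
    sign 1 ⊙ (f ⊗ 𝟎)                ≈⟨ ⊙-cong (sign 1) (zeroʳ f) ⟩
    sign 1 ⊙ 𝟎                      ≈⟨ ⊙-as-⊗ (sign 1) 𝟎 ⟩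
    (sign 1 ⊙ 𝟏) ⊗ 𝟎                ≈⟨ zeroʳ (sign 1 ⊙ 𝟏) ⟩
    𝟎                               ∎

  geometric-suc : ∀ f n → 𝟏 ⊕ f ⊗ geometric f n ∼ geometric f (suc n)
  geometric-suc f zero = begin
    𝟏 ⊕ f ⊗ 𝟎   ≈⟨ +-congˡ (zeroʳ f) ⟩
    𝟏 ⊕ 𝟎       ≈⟨ +-comm 𝟏 𝟎 ⟩
    𝟎 ⊕ 𝟏       ∎
  geometric-suc f (suc n) = begin
    𝟏 ⊕ f ⊗ (geometric f n ⊕ power f n)         ≈⟨ +-congˡ (distribˡ f (geometric f n) (power f n)) ⟩
    𝟏 ⊕ (f ⊗ geometric f n ⊕ f ⊗ power f n)     ≈⟨ +-assoc 𝟏 (f ⊗ geometric f n) (f ⊗ power f n) ⟨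
    𝟏 ⊕ f ⊗ geometric f n ⊕ f ⊗ power f n       ≈⟨ +-congʳ (geometric-suc f n) ⟩
    geometric f (suc n) ⊕ power f (suc n)       ∎

  geometric-⊗ : ∀ f n → sumTo (λ k → power f (suc k)) n ∼ f ⊗ geometric f n
  geometric-⊗ f zero    = ∼-sym (zeroʳ f)
  geometric-⊗ f (suc n) = ∼-trans (+-congʳ (geometric-⊗ f n)) (∼-sym (distribˡ f (geometric f n) (power f n)))

  power-vanish : ∀ {f} → Homogeneous xθ-grading f 1 → ∀ n → D < n → power f n ∼ 𝟎
  power-vanish hf n D<n = homogeneous-vanish (Homogeneous-power xθ-grading n hf) (subst (D <_) (sym (ℕ.*-identityʳ n)) D<n)

  -- The powers beyond the D-th have degree above D. The case k = 1 gives the fixed-point equation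
  -- of the geometric series; general k compares truncations at different degrees.
  geometric-stable : ∀ {f} → Homogeneous xθ-grading f 1 → ∀ k → geometric f (k ℕ.+ suc D) ∼ geometric f (suc D)
  geometric-stable hf zero    = ∼-refl
  geometric-stable hf (suc k) = ∼-trans (⊕-cong (geometric-stable hf k) (power-vanish hf (k ℕ.+ suc D) (ℕ.m≤n+m (suc D) k))) (+-identityʳ _)

  module _ {f : Series} (cf : Central f) (hf : Homogeneous xθ-grading f 1) where
    private
      g = geometric f (suc D)

    geometric-fixed : 𝟏 ⊕ f ⊗ g ∼ g
    geometric-fixed = ∼-trans (geometric-suc f (suc D)) (geometric-stable hf 1)

    geometric-central : Central g
    geometric-central = Central-sumTo (suc D) (λ n → Central-power n cf)

    geometric-inverseʳ : (𝟏 ⊕ ⊖ f) ⊗ g ∼ 𝟏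
    geometric-inverseʳ = begin
      (𝟏 ⊕ ⊖ f) ⊗ g                      ≈⟨ distribʳ g 𝟏 (⊖ f) ⟩
      𝟏 ⊗ g ⊕ ⊖ f ⊗ g                    ≈⟨ ⊕-cong (*-identityˡ g) (∼-sym (-‿distribˡ-* f g)) ⟩
      g ⊕ ⊖ (f ⊗ g)                      ≈⟨ +-congʳ geometric-fixed ⟨
      (𝟏 ⊕ f ⊗ g) ⊕ ⊖ (f ⊗ g)            ≈⟨ +-assoc 𝟏 (f ⊗ g) (⊖ (f ⊗ g)) ⟩
      𝟏 ⊕ (f ⊗ g ⊕ ⊖ (f ⊗ g))            ≈⟨ +-congˡ (-‿inverseʳ (f ⊗ g)) ⟩
      𝟏 ⊕ 𝟎                              ≈⟨ +-identityʳ 𝟏 ⟩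
      𝟏                                  ∎

    geometric-inverseˡ : g ⊗ (𝟏 ⊕ ⊖ f) ∼ 𝟏
    geometric-inverseˡ = ∼-trans (geometric-central (𝟏 ⊕ ⊖ f)) geometric-inverseʳ

    -- Applying E to g = 1 + f g gives (1 - f) E g = f g.
    geometric-logDerivative : g HasLogDerivative f ⊗ g
    geometric-logDerivative = begin
      E g                                  ≈⟨ *-identityˡ (E g) ⟨
      𝟏 ⊗ E g                              ≈⟨ *-congʳ geometric-inverseˡ ⟨
      (g ⊗ (𝟏 ⊕ ⊖ f)) ⊗ E g                ≈⟨ *-assoc g (𝟏 ⊕ ⊖ f) (E g) ⟩
      g ⊗ ((𝟏 ⊕ ⊖ f) ⊗ E g)                ≈⟨ *-congˡ (distribʳ (E g) 𝟏 (⊖ f)) ⟩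
      g ⊗ (𝟏 ⊗ E g ⊕ ⊖ f ⊗ E g)            ≈⟨ *-congˡ (⊕-cong (∼-trans (*-identityˡ (E g)) derivative) (∼-sym (-‿distribˡ-* f (E g)))) ⟩
      g ⊗ ((f ⊗ g ⊕ f ⊗ E g) ⊕ ⊖ (f ⊗ E g)) ≈⟨ *-congˡ (+-assoc (f ⊗ g) (f ⊗ E g) (⊖ (f ⊗ E g))) ⟩
      g ⊗ (f ⊗ g ⊕ (f ⊗ E g ⊕ ⊖ (f ⊗ E g))) ≈⟨ *-congˡ (+-congˡ (-‿inverseʳ (f ⊗ E g))) ⟩
      g ⊗ (f ⊗ g ⊕ 𝟎)                      ≈⟨ *-congˡ (+-identityʳ (f ⊗ g)) ⟩
      g ⊗ (f ⊗ g)                          ≈⟨ geometric-central (f ⊗ g) ⟩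
      (f ⊗ g) ⊗ g                          ∎
      where
      derivative : E g ∼ f ⊗ g ⊕ f ⊗ E g
      derivative = begin
        E g                         ≈⟨ E-cong geometric-fixed ⟨
        E (𝟏 ⊕ f ⊗ g)               ≈⟨ E-⊕ 𝟏 (f ⊗ g) ⟩
        E 𝟏 ⊕ E (f ⊗ g)             ≈⟨ ⊕-cong E-𝟏 (E-⊗ f g) ⟩
        𝟎 ⊕ (E f ⊗ g ⊕ f ⊗ E g)     ≈⟨ +-identityˡ (E f ⊗ g ⊕ f ⊗ E g) ⟩
        E f ⊗ g ⊕ f ⊗ E g           ≈⟨ +-congʳ (*-congʳ (∼-trans (E-homogeneous hf) (⊙-identity f))) ⟩
        f ⊗ g ⊕ f ⊗ E g             ∎

  X-central : ∀ ij → Central (X ij)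
  X-central (i , j) = even-central 0 (X-homogeneous oddGrading i j)

  Θ-central : ∀ ij → Central (Θ ij)
  Θ-central (i , j) = even-central 1 (Θ-homogeneous oddGrading i j)

  τ-central : ∀ ij → Central (τ ij)
  τ-central ij = Central-⊕ (X-central ij) (Θ-central ij)

  Θ-square : ∀ ij → Θ ij ⊗ Θ ij ∼ 𝟎
  Θ-square (i , j) = odd-product-square (Homogeneous-at oddGrading i (fermionic xθ 0)) (Homogeneous-at oddGrading j (fermionic yφ 0))

  -- The binomial theorem cut off after the first power of g.
  power-⊕-nilpotent : ∀ {f g} → Central f → Central g → g ⊗ g ∼ 𝟎 → ∀ n →
    power (f ⊕ g) (suc n) ∼ power f (suc n) ⊕ fromℕ (suc n) ⊙ (power f n ⊗ g)
  power-⊕-nilpotent {f} {g} cf cg gg zero = begin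
    (f ⊕ g) ⊗ 𝟏                 ≈⟨ distribʳ 𝟏 f g ⟩
    f ⊗ 𝟏 ⊕ g ⊗ 𝟏               ≈⟨ +-congˡ (Central-𝟏 g) ⟨
    f ⊗ 𝟏 ⊕ 𝟏 ⊗ g               ≈⟨ +-congˡ (⊙-identity (𝟏 ⊗ g)) ⟨
    f ⊗ 𝟏 ⊕ 1ℚ ⊙ (𝟏 ⊗ g)        ∎
  power-⊕-nilpotent {f} {g} cf cg gg (suc n) = begin
    (f ⊕ g) ⊗ power (f ⊕ g) (suc n)
      ≈⟨ *-congˡ (power-⊕-nilpotent cf cg gg n) ⟩
    (f ⊕ g) ⊗ (fₙ₊₁ ⊕ c ⊙ (fₙ ⊗ g))
      ≈⟨ distribʳ (fₙ₊₁ ⊕ c ⊙ (fₙ ⊗ g)) f g ⟩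
    f ⊗ (fₙ₊₁ ⊕ c ⊙ (fₙ ⊗ g)) ⊕ g ⊗ (fₙ₊₁ ⊕ c ⊙ (fₙ ⊗ g))
      ≈⟨ ⊕-cong (distribˡ f fₙ₊₁ (c ⊙ (fₙ ⊗ g))) (distribˡ g fₙ₊₁ (c ⊙ (fₙ ⊗ g))) ⟩
    (f ⊗ fₙ₊₁ ⊕ f ⊗ (c ⊙ (fₙ ⊗ g))) ⊕ (g ⊗ fₙ₊₁ ⊕ g ⊗ (c ⊙ (fₙ ⊗ g)))
      ≈⟨ ⊕-cong (+-congˡ (∼-trans (⊙-⊗ʳ c f (fₙ ⊗ g)) (⊙-cong c (∼-sym (*-assoc f fₙ g))))) (⊕-cong (cg fₙ₊₁) last) ⟩
    (f ⊗ fₙ₊₁ ⊕ c ⊙ (fₙ₊₁ ⊗ g)) ⊕ (fₙ₊₁ ⊗ g ⊕ 𝟎)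
      ≈⟨ +-congˡ (+-identityʳ (fₙ₊₁ ⊗ g)) ⟩
    (f ⊗ fₙ₊₁ ⊕ c ⊙ (fₙ₊₁ ⊗ g)) ⊕ fₙ₊₁ ⊗ g
      ≈⟨ +-assoc (f ⊗ fₙ₊₁) (c ⊙ (fₙ₊₁ ⊗ g)) (fₙ₊₁ ⊗ g) ⟩
    f ⊗ fₙ₊₁ ⊕ (c ⊙ (fₙ₊₁ ⊗ g) ⊕ fₙ₊₁ ⊗ g)
      ≈⟨ +-congˡ (∼-trans (+-comm (c ⊙ (fₙ₊₁ ⊗ g)) (fₙ₊₁ ⊗ g)) (+-congʳ (∼-sym (⊙-identity (fₙ₊₁ ⊗ g))))) ⟩
    f ⊗ fₙ₊₁ ⊕ (1ℚ ⊙ (fₙ₊₁ ⊗ g) ⊕ c ⊙ (fₙ₊₁ ⊗ g))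
      ≈⟨ +-congˡ (⊙-distribʳ 1ℚ c (fₙ₊₁ ⊗ g)) ⟨
    f ⊗ fₙ₊₁ ⊕ fromℕ (suc (suc n)) ⊙ (fₙ₊₁ ⊗ g) ∎
    where
    fₙ   = power f n
    fₙ₊₁ = power f (suc n)
    c    = fromℕ (suc n)
    last : g ⊗ (c ⊙ (fₙ ⊗ g)) ∼ 𝟎
    last = begin
      g ⊗ (c ⊙ (fₙ ⊗ g))    ≈⟨ cg (c ⊙ (fₙ ⊗ g)) ⟩
      (c ⊙ (fₙ ⊗ g)) ⊗ g    ≈⟨ *-congʳ (⊙-as-⊗ c (fₙ ⊗ g)) ⟩
      ((c ⊙ 𝟏) ⊗ (fₙ ⊗ g)) ⊗ g    ≈⟨ *-assoc (c ⊙ 𝟏) (fₙ ⊗ g) g ⟩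
      (c ⊙ 𝟏) ⊗ ((fₙ ⊗ g) ⊗ g)    ≈⟨ *-congˡ (*-assoc fₙ g g) ⟩
      (c ⊙ 𝟏) ⊗ (fₙ ⊗ (g ⊗ g))    ≈⟨ *-congˡ (*-congˡ gg) ⟩
      (c ⊙ 𝟏) ⊗ (fₙ ⊗ 𝟎)    ≈⟨ *-congˡ (zeroʳ fₙ) ⟩
      (c ⊙ 𝟏) ⊗ 𝟎           ≈⟨ zeroʳ (c ⊙ 𝟏) ⟩
      𝟎                     ∎

  bosonic-power : ∀ {i j} → i < N → j < N → ∀ n →
    monomial (at i (bosonic xθ (suc n))) ⊗ monomial (at j (bosonic yφ (suc n))) ∼ power (X (i , j)) (suc n)
  bosonic-power         i<N j<N zero    = ∼-sym (*-identityʳ _)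
  bosonic-power {i} {j} i<N j<N (suc n) = begin
    monomial (at i (bosonic xθ (suc (suc n)))) ⊗ monomial (at j (bosonic yφ (suc (suc n))))
      ≈⟨ ⊗-cong (at-⊗ i i<N 1 0 (suc n) 0 false false) (at-⊗ j j<N 0 1 0 (suc n) false false) ⟨
    (x i ⊗ monomial (at i (bosonic xθ (suc n)))) ⊗ (y j ⊗ monomial (at j (bosonic yφ (suc n))))
      ≈⟨ ⊗-interchange (x i) (y j) _ (even-central 0 (Homogeneous-at oddGrading i (bosonic xθ (suc n)))) ⟩
    X (i , j) ⊗ (monomial (at i (bosonic xθ (suc n))) ⊗ monomial (at j (bosonic yφ (suc n))))
      ≈⟨ *-congˡ (bosonic-power i<N j<N n) ⟩
    X (i , j) ⊗ power (X (i , j)) (suc n) ∎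

  fermionic-power : ∀ {i j} → i < N → j < N → ∀ n →
    monomial (at i (fermionic xθ n)) ⊗ monomial (at j (fermionic yφ n)) ∼ power (X (i , j)) n ⊗ Θ (i , j)
  fermionic-power         i<N j<N zero    = ∼-sym (*-identityˡ _)
  fermionic-power {i} {j} i<N j<N (suc n) = begin
    monomial (at i (fermionic xθ (suc n))) ⊗ monomial (at j (fermionic yφ (suc n)))
      -- Exponents are raised by xᵢ and yⱼ from the left, since `at-⊗` asks for a first factor
      -- without odd variables.
      ≈⟨ ⊗-cong (at-⊗ i i<N 1 0 n 0 true false) (at-⊗ j j<N 0 1 0 n false true) ⟨
    (x i ⊗ θᵢ) ⊗ (y j ⊗ φⱼ)
      ≈⟨ *-assoc (x i) θᵢ (y j ⊗ φⱼ) ⟩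
    x i ⊗ (θᵢ ⊗ (y j ⊗ φⱼ))
      ≈⟨ *-congˡ (*-assoc θᵢ (y j) φⱼ) ⟨
    x i ⊗ ((θᵢ ⊗ y j) ⊗ φⱼ)
      ≈⟨ *-congˡ (*-congʳ (even-central 0 (Homogeneous-at oddGrading j (bosonic yφ 1)) θᵢ)) ⟨
    x i ⊗ ((y j ⊗ θᵢ) ⊗ φⱼ)
      ≈⟨ *-congˡ (*-assoc (y j) θᵢ φⱼ) ⟩
    x i ⊗ (y j ⊗ (θᵢ ⊗ φⱼ))
      ≈⟨ *-assoc (x i) (y j) (θᵢ ⊗ φⱼ) ⟨
    X (i , j) ⊗ (θᵢ ⊗ φⱼ)
      ≈⟨ *-congˡ (fermionic-power i<N j<N n) ⟩
    X (i , j) ⊗ (power (X (i , j)) n ⊗ Θ (i , j))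
      ≈⟨ *-assoc (X (i , j)) (power (X (i , j)) n) (Θ (i , j)) ⟨
    power (X (i , j)) (suc n) ⊗ Θ (i , j) ∎
    where
    θᵢ = monomial (at i (fermionic xθ n))
    φⱼ = monomial (at j (fermionic yφ n))

  sumOverVariables-⊗ : ∀ e e≢𝟘 e′ e′≢𝟘 → sumOverVariables e e≢𝟘 ⊗ sumOverVariables e′ e′≢𝟘 ∼
    ⨁ (λ (i , j) → monomial (at i e) ⊗ monomial (at j e′)) (pairs N)
  sumOverVariables-⊗ e e≢𝟘 e′ e′≢𝟘 = begin
    sumOverVariables e e≢𝟘 ⊗ sumOverVariables e′ e′≢𝟘
      ≈⟨ ⊗-cong (sumOverVariables-sumTo e e≢𝟘) (sumOverVariables-sumTo e′ e′≢𝟘) ⟩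
    sumTo (λ i → monomial (at i e)) N ⊗ sumTo (λ j → monomial (at j e′)) N
      ≈⟨ ⊗-cong (⨁-upTo (λ i → monomial (at i e)) N) (⨁-upTo (λ j → monomial (at j e′)) N) ⟨
    ⨁ (λ i → monomial (at i e)) (upTo N) ⊗ ⨁ (λ j → monomial (at j e′)) (upTo N)
      ≈⟨ ⨁-cartesianProduct (λ i → monomial (at i e)) (λ j → monomial (at j e′)) (upTo N) (upTo N) ⟨
    ⨁ (λ (i , j) → monomial (at i e) ⊗ monomial (at j e′)) (pairs N) ∎

  ⨁-power-τ : ∀ n → ⨁ (λ ij → power (τ ij) (suc n)) (pairs N) ∼ u (suc n) ⊕ fromℕ (suc n) ⊙ w n
  ⨁-power-τ n = begin
    ⨁ (λ ij → power (τ ij) (suc n)) (pairs N)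
      ≈⟨ ⨁-cong (pairs N) (λ {ij} _ → power-⊕-nilpotent (X-central ij) (Θ-central ij) (Θ-square ij) n) ⟩
    ⨁ (λ ij → power (X ij) (suc n) ⊕ fromℕ (suc n) ⊙ (power (X ij) n ⊗ Θ ij)) (pairs N)
      ≈⟨ ⨁-⊕ (λ ij → power (X ij) (suc n)) (λ ij → fromℕ (suc n) ⊙ (power (X ij) n ⊗ Θ ij)) (pairs N) ⟩
    ⨁ (λ ij → power (X ij) (suc n)) (pairs N) ⊕ ⨁ (λ ij → fromℕ (suc n) ⊙ (power (X ij) n ⊗ Θ ij)) (pairs N)
      ≈⟨ +-congˡ (⨁-⊙ (fromℕ (suc n)) (λ ij → power (X ij) n ⊗ Θ ij) (pairs N)) ⟩
    ⨁ (λ ij → power (X ij) (suc n)) (pairs N) ⊕ fromℕ (suc n) ⊙ ⨁ (λ ij → power (X ij) n ⊗ Θ ij) (pairs N)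
      ≈⟨ ⊕-cong bosons (⊙-cong (fromℕ (suc n)) fermions) ⟨
    u (suc n) ⊕ fromℕ (suc n) ⊙ w n ∎
    where
    bosons : u (suc n) ∼ ⨁ (λ ij → power (X ij) (suc n)) (pairs N)
    bosons = ∼-trans (sumOverVariables-⊗ (bosonic xθ (suc n)) _ (bosonic yφ (suc n)) _)
      (⨁-cong (pairs N) (λ ij∈ → bosonic-power (proj₁ (∈-pairs⁻ ij∈)) (proj₂ (∈-pairs⁻ ij∈)) n))
    fermions : w n ∼ ⨁ (λ ij → power (X ij) n ⊗ Θ ij) (pairs N)
    fermions = ∼-trans (sumOverVariables-⊗ (fermionic xθ n) _ (fermionic yφ n) _)
      (⨁-cong (pairs N) (λ ij∈ → fermionic-power (proj₁ (∈-pairs⁻ ij∈)) (proj₂ (∈-pairs⁻ ij∈)) n))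

  -- A pair with an index outside the first N contributes nothing modulo the truncation, which
  -- reduces a product over any large list of pairs to `pairs N`.
  τ-𝟎 : ∀ i j → (i , j) ∉ pairs N → τ (i , j) ∼ 𝟎
  τ-𝟎 i j ij∉ with i ℕ.<? N
  ... | yes i<N with j ℕ.<? N
  ...   | yes j<N = ⊥-elim (ij∉ (∈-pairs⁺ i<N j<N))
  ...   | no  j≮N = ∼-trans (⊕-cong
    (∼-trans (*-congˡ (at-𝟎 (bosonic≢𝟘 yφ 1) j (ℕ.≮⇒≥ j≮N))) (zeroʳ (x i)))
    (∼-trans (*-congˡ (at-𝟎 (fermionic≢𝟘 yφ 0) j (ℕ.≮⇒≥ j≮N))) (zeroʳ (θ i)))) (+-identityˡ 𝟎)
  τ-𝟎 i j ij∉ | no i≮N = ∼-trans (⊕-cong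
    (∼-trans (*-congʳ (at-𝟎 (bosonic≢𝟘 xθ 1) i (ℕ.≮⇒≥ i≮N))) (zeroˡ (y j)))
    (∼-trans (*-congʳ (at-𝟎 (fermionic≢𝟘 xθ 0) i (ℕ.≮⇒≥ i≮N))) (zeroˡ (φ j)))) (+-identityˡ 𝟎)

  sumTo-𝟎 : ∀ {f} n → (∀ i → f i ∼ 𝟎) → sumTo f n ∼ 𝟎
  sumTo-𝟎 zero    eq = ∼-refl
  sumTo-𝟎 (suc n) eq = ∼-trans (⊕-cong (sumTo-𝟎 n eq) (eq n)) (+-identityˡ 𝟎)

  -- This is t / (1 - t) modulo degree above D, kept as a sum of powers so that the sum over (i, j)
  -- can be taken one power at a time.
  logDerivative-factor : ℕ × ℕ → Series
  logDerivative-factor ij = sumTo (λ n → power (τ ij) (suc n)) (suc D)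

  ⨁-logDerivative-factor : ∀ {L} → Unique L → pairs N ⊆ L → ⨁ logDerivative-factor L ∼ logDerivative (suc D)
  ⨁-logDerivative-factor {L} uL pairs⊆L = begin
    ⨁ logDerivative-factor L
      ≈⟨ ⨁-⊆ logDerivative-factor (pairs-unique N) uL pairs⊆L (λ {(i , j)} _ ij∉ →
           sumTo-𝟎 (suc D) (λ n → ∼-trans (*-congʳ (τ-𝟎 i j ij∉)) (zeroˡ (power (τ (i , j)) n)))) ⟩
    ⨁ logDerivative-factor (pairs N)
      ≈⟨ ⨁-sumTo (λ n ij → power (τ ij) (suc n)) (pairs N) (suc D) ⟩
    sumTo (λ n → ⨁ (λ ij → power (τ ij) (suc n)) (pairs N)) (suc D)
      ≈⟨ sumTo-cong (suc D) ⨁-power-τ ⟩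
    sumTo (λ n → u (suc n) ⊕ fromℕ (suc n) ⊙ w n) (suc D)
      ≈⟨ sumTo-⊕ (λ n → u (suc n)) (λ n → fromℕ (suc n) ⊙ w n) (suc D) ⟩
    logDerivative (suc D) ∎

  geometric-τ-logDerivative : ∀ ij → geometric (τ ij) (suc D) HasLogDerivative logDerivative-factor ij
  geometric-τ-logDerivative ij = HasLogDerivative-resp ∼-refl (∼-sym (geometric-⊗ (τ ij) (suc D)))
    (geometric-logDerivative (τ-central ij) (τ-homogeneous ij))

  -- A left inverse equals a right inverse, here the truncated geometric series. The expansion
  -- thereby becomes independent of the inverses supplied with `IsKernel`.
  inverse-unique : ∀ ij {g} → g * denominator ij ≈ 1# → g ∼ geometric (τ ij) (suc D)
  inverse-unique ij {g} g-inverse = begin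
    g                              ≈⟨ *-identityʳ g ⟨
    g ⊗ 𝟏                          ≈⟨ *-congˡ (geometric-inverseʳ (τ-central ij) (τ-homogeneous ij)) ⟨
    g ⊗ ((𝟏 ⊕ ⊖ τ ij) ⊗ h)         ≈⟨ *-assoc g (𝟏 ⊕ ⊖ τ ij) h ⟨
    (g ⊗ (𝟏 ⊕ ⊖ τ ij)) ⊗ h         ≈⟨ *-congʳ (*-congˡ (≈⇒∼ (denominator≈ ij))) ⟨
    (g ⊗ denominator ij) ⊗ h       ≡⟨ cong (_⊗ h) (*≡⊗ g (denominator ij)) ⟨
    (g * denominator ij) ⊗ h       ≈⟨ *-congʳ (≈⇒∼ g-inverse) ⟩
    1# ⊗ h                         ≡⟨ cong (_⊗ h) 1≡𝟏 ⟩
    𝟏 ⊗ h                          ≈⟨ *-identityˡ h ⟩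
    h                              ∎
    where
    h = geometric (τ ij) (suc D)

  inverses-logDerivative : ∀ {inv : ℕ × ℕ → Series} → (∀ ij → inv ij * denominator ij ≈ 1#) →
    ∀ {L} → Unique L → pairs N ⊆ L → ⨂ inv L HasLogDerivative logDerivative (suc D)
  inverses-logDerivative {inv} inverse {L} uL pairs⊆L = HasLogDerivative-resp ∼-refl (⨁-logDerivative-factor uL pairs⊆L)
    (HasLogDerivative-⨂ L (λ ij → Central-sumTo (suc D) (λ n → Central-power (suc n) (τ-central ij)))
      (λ ij → HasLogDerivative-resp (∼-sym (inverse-unique ij (inverse ij))) ∼-refl (geometric-τ-logDerivative ij)))

-- Enumeration of superpartitions

-- The recursion decides whether n occurs, which is the choice between 1 and wₙ in the factor 1 +
-- wₙ.
strictLists : ℕ → List (List ℕ)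
strictLists zero    = [] ∷ []
strictLists (suc n) = strictLists n ++ map (n ∷_) (strictLists n)

Strict : ℕ → List ℕ → Set
Strict n a = AllPairs _>_ a × All (_< n) a

strictLists-sound : ∀ n → All (Strict n) (strictLists n)
strictLists-sound zero    = ([] , []) ∷ []
strictLists-sound (suc n) = All.++⁺
  (All.map (λ (s , b) → s , All.map ℕ.m<n⇒m<1+n b) (strictLists-sound n))
  (All.map⁺ (All.map (λ (s , b) → b ∷ s , ℕ.n<1+n n ∷ All.map ℕ.m<n⇒m<1+n b) (strictLists-sound n)))

strictLists-complete : ∀ n {a} → Strict n a → a ∈ strictLists n
strictLists-complete zero    ([] , _)         = here refl
strictLists-complete zero    (_ ∷ _ , () ∷ _)
strictLists-complete (suc n) ([] , _)         = ∈-++⁺ˡ (strictLists-complete n ([] , []))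
strictLists-complete (suc n) {m ∷ a} (m>a ∷ s , m<1+n ∷ _) with m ℕ.≟ n
... | yes refl = ∈-++⁺ʳ (strictLists n) (∈-map⁺ (n ∷_) (strictLists-complete n (s , m>a)))
... | no  m≢n  = ∈-++⁺ˡ (strictLists-complete n (m>a ∷ s , m<n ∷ All.map (λ i<m → ℕ.<-trans i<m m<n) m>a))
  where m<n = ℕ.≤∧≢⇒< (ℕ.s≤s⁻¹ m<1+n) m≢n

strictLists-unique : ∀ n → Unique (strictLists n)
strictLists-unique zero    = [] ∷ []
strictLists-unique (suc n) = ++⁺ (strictLists-unique n) (map⁺ ∷-injectiveʳ (strictLists-unique n)) disjoint
  where
  disjoint : ∀ {a} → a ∈ strictLists n × a ∈ map (n ∷_) (strictLists n) → ⊥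
  disjoint (a∈ , na∈) with _ , _ , refl ← ∈-map⁻ (n ∷_) na∈ with _ , n<n ∷ _ ← All.lookup (strictLists-sound n) a∈ =
    ℕ.<-irrefl refl n<n

-- The highest multiplicity comes last, as in `sumTo`; summation over this list then produces a
-- truncated exponential.
copies : ℕ → ℕ → List (List ℕ) → List (List ℕ)
copies k zero    ls = ls
copies k (suc j) ls = copies k j ls ++ map (replicate (suc j) k ++_) ls

-- Parts at most k, each of multiplicity at most J.
partitions : ℕ → ℕ → List (List ℕ)
partitions J zero    = [] ∷ []
partitions J (suc k) = copies (suc k) J (partitions J k)

Weak : ℕ → List ℕ → Set
Weak k s = AllPairs _≥_ s × All NonZero s × All (_≤ k) s

∈-copies⁺ : ∀ k {J j ls s} → j ≤ J → s ∈ ls → replicate j k ++ s ∈ copies k J ls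
∈-copies⁺ k {zero}  {zero} _ s∈ = s∈
∈-copies⁺ k {suc J} {j} {ls} j≤ s∈ with j ℕ.≟ suc J
... | yes refl = ∈-++⁺ʳ (copies k J ls) (∈-map⁺ (replicate (suc J) k ++_) s∈)
... | no  j≢   = ∈-++⁺ˡ (∈-copies⁺ k (ℕ.s≤s⁻¹ (ℕ.≤∧≢⇒< j≤ j≢)) s∈)

∈-copies⁻ : ∀ k J {ls v} → v ∈ copies k J ls → ∃[ j ] ∃[ s ] j ≤ J × s ∈ ls × v ≡ replicate j k ++ s
∈-copies⁻ k zero    {v = v} v∈ = 0 , v , z≤n , v∈ , refl
∈-copies⁻ k (suc J) {ls} v∈ with ∈-++⁻ (copies k J ls) v∈
... | inj₁ v∈₁ with j , s , j≤J , s∈ , eq ← ∈-copies⁻ k J v∈₁ = j , s , ℕ.m≤n⇒m≤1+n j≤J , s∈ , eq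
... | inj₂ v∈₂ with s , s∈ , eq ← ∈-map⁻ (replicate (suc J) k ++_) v∈₂ = suc J , s , ℕ.≤-refl , s∈ , eq

replicate-Weak : ∀ k j {s} → Weak k s → Weak (suc k) (replicate j (suc k) ++ s)
replicate-Weak k zero    (d , nz , b) = d , nz , All.map ℕ.m≤n⇒m≤1+n b
replicate-Weak k (suc j) w with d , nz , b ← replicate-Weak k j w = b ∷ d , _ ∷ nz , ℕ.≤-refl ∷ b

partitions-sound : ∀ J k → All (Weak k) (partitions J k)
partitions-sound J zero    = ([] , [] , []) ∷ []
partitions-sound J (suc k) = All.tabulate (λ v∈ → sound (∈-copies⁻ (suc k) J v∈))
  where
  sound : ∀ {v} → ∃[ j ] ∃[ s ] j ≤ J × s ∈ partitions J k × v ≡ replicate j (suc k) ++ s → Weak (suc k) v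
  sound (j , s , _ , s∈ , refl) = replicate-Weak k j (All.lookup (partitions-sound J k) s∈)

-- The tails have no part equal to `suc k`, so the leading run ends where the tail begins and its
-- length can be recovered.
replicate-++-injective : ∀ {k i j s t} → All (_≤ k) s → All (_≤ k) t →
  replicate i (suc k) ++ s ≡ replicate j (suc k) ++ t → i ≡ j
replicate-++-injective {i = zero}  {zero}  bs       bt eq   = refl
replicate-++-injective {i = zero}  {suc j} (b ∷ _)  bt refl = ⊥-elim (ℕ.<-irrefl refl b)
replicate-++-injective {i = suc i} {zero}  bs (b ∷ _)  refl = ⊥-elim (ℕ.<-irrefl refl b)
replicate-++-injective {i = suc i} {suc j} bs       bt eq   = cong suc (replicate-++-injective bs bt (∷-injectiveʳ eq))

copies-unique : ∀ k J {ls} → All (All (_≤ k)) ls → Unique ls → Unique (copies (suc k) J ls)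
copies-unique k zero    bs u = u
copies-unique k (suc J) {ls} bs u = ++⁺ (copies-unique k J bs u) (map⁺ (++-cancelˡ (replicate (suc J) (suc k)) _ _) u) disjoint
  where
  disjoint : ∀ {v} → v ∈ copies (suc k) J ls × v ∈ map (replicate (suc J) (suc k) ++_) ls → ⊥
  disjoint (v∈₁ , v∈₂)
    with j , s , j≤J , s∈ , eq ← ∈-copies⁻ (suc k) J v∈₁
    with t , t∈ , eq′ ← ∈-map⁻ (replicate (suc J) (suc k) ++_) v∈₂
    with refl ← replicate-++-injective {i = j} {j = suc J} (All.lookup bs s∈) (All.lookup bs t∈) (trans (sym eq) eq′) =
    ℕ.<-irrefl refl j≤J

partitions-unique : ∀ J k → Unique (partitions J k)
partitions-unique J zero    = [] ∷ []
partitions-unique J (suc k) = copies-unique k J (All.map (proj₂ ∘ proj₂) (partitions-sound J k)) (partitions-unique J k)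

peel : ∀ k s → Weak (suc k) s → ∃[ j ] ∃[ t ] j ℕ.+ length t ≡ length s × Weak k t × s ≡ replicate j (suc k) ++ t
peel k []      _ = 0 , [] , refl , ([] , [] , []) , refl
peel k (n ∷ s) (n≥s ∷ d , nz ∷ nzs , b ∷ bs) with n ℕ.≟ suc k
... | yes refl with j , t , len , wt , eq ← peel k s (d , nzs , bs) = suc j , t , cong suc len , wt , cong (suc k ∷_) eq
... | no  n≢   = 0 , n ∷ s , refl , (n≥s ∷ d , nz ∷ nzs , n≤k ∷ All.map (λ i≤n → ℕ.≤-trans i≤n n≤k) n≥s) , refl
  where n≤k = ℕ.s≤s⁻¹ (ℕ.≤∧≢⇒< b n≢)

-- The length of a list bounds all its multiplicities, and the bound passes to the tail left after
-- peeling off one run.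
partitions-complete : ∀ J k {s} → Weak k s → length s ≤ J → s ∈ partitions J k
partitions-complete J zero    {[]}        _                             _   = here refl
partitions-complete J zero    {zero ∷ s}  (_ , nz ∷ _ , _)              _   = ⊥-elim (ℕ.NonZero.nonZero nz)
partitions-complete J zero    {suc n ∷ s} (_ , _ , () ∷ _)              _
partitions-complete J (suc k) {s}         ws                            len
  with j , t , refl-len , wt , refl ← peel k s ws =
  ∈-copies⁺ (suc k) (ℕ.m+n≤o⇒m≤o j j+t≤J) (partitions-complete J k wt (ℕ.m+n≤o⇒n≤o j j+t≤J))
  where
  j+t≤J : j ℕ.+ length t ≤ J
  j+t≤J = subst (_≤ J) (sym refl-len) len

-- The numbers z and their multiplicativity

zFactorᴸ : List ℕ → ℕ → ℕ
zFactorᴸ s k = k ^ multiplicity k s ℕ.* multiplicity k s !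

zᴸ : List ℕ → ℕ
zᴸ s = product (map (zFactorᴸ s ∘ suc) (upTo (sum s)))

-- The range of the product in `zᴸ` is tied to `sum s` and changes with s; a free bound allows two
-- lists to be compared factor by factor.
zUpTo : ℕ → List ℕ → ℕ
zUpTo zero    s = 1
zUpTo (suc n) s = zUpTo n s ℕ.* zFactorᴸ s (suc n)

product≡zUpTo : ∀ n s → product (map (zFactorᴸ s ∘ suc) (upTo n)) ≡ zUpTo n s
product≡zUpTo zero    s = refl
product≡zUpTo (suc n) s = begin
  product (map f (upTo (suc n)))                    ≡⟨ cong (product ∘ map f) (upTo-∷ʳ n) ⟨
  product (map f (upTo n ++ n ∷ []))                ≡⟨ cong product (map-++ f (upTo n) (n ∷ [])) ⟩
  product (map f (upTo n) ++ f n ∷ [])              ≡⟨ product-++ (map f (upTo n)) (f n ∷ []) ⟩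
  product (map f (upTo n)) ℕ.* (f n ℕ.* 1)              ≡⟨ cong₂ ℕ._*_ (product≡zUpTo n s) (ℕ.*-identityʳ (f n)) ⟩
  zUpTo n s ℕ.* f n                                   ∎
  where
  open ≡-Reasoning
  f = zFactorᴸ s ∘ suc

multiplicity-here : ∀ k s → multiplicity k (k ∷ s) ≡ suc (multiplicity k s)
multiplicity-here k s = cong length (filter-accept (k ℕ.≟_) {k} {s} refl)

multiplicity-there : ∀ {k n} → k ≢ n → ∀ s → multiplicity k (n ∷ s) ≡ multiplicity k s
multiplicity-there {k} {n} k≢n s = cong length (filter-reject (k ℕ.≟_) {n} {s} k≢n)

multiplicity-zero : ∀ {k n s} → All (_≤ n) s → n < k → multiplicity k s ≡ 0
multiplicity-zero []       n<k = refl
multiplicity-zero {s = i ∷ s} (b ∷ bs) n<k =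
  trans (multiplicity-there (λ { refl → ℕ.<⇒≱ n<k b }) s) (multiplicity-zero bs n<k)

multiplicity-replicate : ∀ k j s → multiplicity k (replicate j k ++ s) ≡ j ℕ.+ multiplicity k s
multiplicity-replicate k zero    s = refl
multiplicity-replicate k (suc j) s =
  trans (multiplicity-here k (replicate j k ++ s)) (cong suc (multiplicity-replicate k j s))

multiplicity-replicate-≢ : ∀ {k n} → k ≢ n → ∀ j s → multiplicity k (replicate j n ++ s) ≡ multiplicity k s
multiplicity-replicate-≢ k≢n zero    s = refl
multiplicity-replicate-≢ {n = n} k≢n (suc j) s =
  trans (multiplicity-there k≢n (replicate j n ++ s)) (multiplicity-replicate-≢ k≢n j s)

-- Beyond the largest part every multiplicity is 0, and the factor is k⁰ 0! = 1.
zUpTo-stable : ∀ {n s} → All (_≤ n) s → ∀ m → zUpTo (m ℕ.+ n) s ≡ zUpTo n s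
zUpTo-stable         bs zero    = refl
zUpTo-stable {n} {s} bs (suc m)
  rewrite multiplicity-zero bs (s≤s (ℕ.m≤n+m n m)) = trans (ℕ.*-identityʳ _) (zUpTo-stable bs m)

All-≤-sum : ∀ s → All (_≤ sum s) s
All-≤-sum []      = []
All-≤-sum (n ∷ s) = ℕ.m≤m+n n (sum s) ∷ All.map (λ i≤ → ℕ.≤-trans i≤ (ℕ.m≤n+m (sum s) n)) (All-≤-sum s)

zᴸ≡zUpTo : ∀ {n s} → All (_≤ n) s → zᴸ s ≡ zUpTo n s
zᴸ≡zUpTo {n} {s} bs = begin
  zᴸ s                  ≡⟨ product≡zUpTo (sum s) s ⟩
  -- Both `n` and `sum s` bound the parts of s; each is compared with their sum.
  zUpTo (sum s) s       ≡⟨ zUpTo-stable (All-≤-sum s) n ⟨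
  zUpTo (n ℕ.+ sum s) s   ≡⟨ cong (λ k → zUpTo k s) (ℕ.+-comm n (sum s)) ⟩
  zUpTo (sum s ℕ.+ n) s   ≡⟨ zUpTo-stable bs (sum s) ⟩
  zUpTo n s             ∎
  where open ≡-Reasoning

zUpTo-replicate : ∀ {n k} → n ≤ k → ∀ j s → zUpTo n (replicate j (suc k) ++ s) ≡ zUpTo n s
zUpTo-replicate {zero}  n≤k j s = refl
zUpTo-replicate {suc n} {k} n≤k j s = cong₂ ℕ._*_ (zUpTo-replicate (ℕ.≤-trans (ℕ.n≤1+n n) n≤k) j s)
  (cong (λ e → suc n ^ e ℕ.* e !) (multiplicity-replicate-≢ (λ { refl → ℕ.<-irrefl refl n≤k }) j s))

-- The run of `suc k` affects only the factor of index `suc k`, so 1/z splits into one factor for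
-- each part size. This is why the sum over partitions becomes a product of exponentials.
zᴸ-replicate : ∀ {k s} → Weak k s → ∀ j → zᴸ (replicate j (suc k) ++ s) ≡ (suc k ^ j ℕ.* j !) ℕ.* zᴸ s
zᴸ-replicate {k} {s} ws@(_ , _ , bs) j = begin
  zᴸ v                                  ≡⟨ zᴸ≡zUpTo (proj₂ (proj₂ (replicate-Weak k j ws))) ⟩
  zUpTo k v ℕ.* zFactorᴸ v (suc k)        ≡⟨ cong₂ ℕ._*_ (zUpTo-replicate {k} {k} ℕ.≤-refl j s)
                                             (cong (λ e → suc k ^ e ℕ.* e !) multiplicity-v) ⟩
  zUpTo k s ℕ.* (suc k ^ j ℕ.* j !)         ≡⟨ cong (ℕ._* (suc k ^ j ℕ.* j !)) (zᴸ≡zUpTo bs) ⟨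
  zᴸ s ℕ.* (suc k ^ j ℕ.* j !)              ≡⟨ ℕ.*-comm (zᴸ s) _ ⟩
  (suc k ^ j ℕ.* j !) ℕ.* zᴸ s              ∎
  where
  open ≡-Reasoning
  v = replicate j (suc k) ++ s
  multiplicity-v : multiplicity (suc k) v ≡ j
  multiplicity-v = trans (multiplicity-replicate (suc k) j s)
    (trans (cong (j ℕ.+_) (multiplicity-zero bs (ℕ.n<1+n k))) (ℕ.+-identityʳ j))

-- Superpartitions as pairs of lists

shape : Superpartition → List ℕ × List ℕ
shape Λ = Λᵃ Λ , Λˢ Λ

NonZero-irrelevant : ∀ {n} (p q : NonZero n) → p ≡ q
NonZero-irrelevant {suc n} p q = refl

-- `HasSum` speaks of duplicate-free lists of records, so two records must not differ in their
-- proofs alone.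
shape-injective : ∀ {Λ Μ} → shape Λ ≡ shape Μ → Λ ≡ Μ
shape-injective {Λ} {Μ} refl
  rewrite Linked.irrelevant ℕ.≤-irrelevant (Λᵃ-strict Λ) (Λᵃ-strict Μ)
        | Linked.irrelevant ℕ.≤-irrelevant (Λˢ-weak Λ) (Λˢ-weak Μ)
        | All.irrelevant NonZero-irrelevant (Λˢ-nonZero Λ) (Λˢ-nonZero Μ) = refl

shapes : ℕ → ℕ → List (List ℕ × List ℕ)
shapes J n = cartesianProduct (strictLists n) (partitions J n)

superpartition : ∀ {n as} → Strict n (proj₁ as) × Weak n (proj₂ as) → Superpartition
superpartition {as = a , s} ((d , _) , (d′ , nz , _)) = record
  { Λᵃ = a ; Λˢ = s ; Λᵃ-strict = AllPairs⇒Linked d ; Λˢ-weak = AllPairs⇒Linked d′ ; Λˢ-nonZero = nz }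

shapes-sound : ∀ J n → All (λ (a , s) → Strict n a × Weak n s) (shapes J n)
shapes-sound J n = All-cartesianProductWith _,_ (strictLists-sound n) (partitions-sound J n)

superpartitions : ℕ → ℕ → List Superpartition
superpartitions J n = All.reduce superpartition (shapes-sound J n)

map-shape-reduce : ∀ {n ass} (v : All (λ (a , s) → Strict n a × Weak n s) ass) →
  map shape (All.reduce superpartition v) ≡ ass
map-shape-reduce []      = refl
map-shape-reduce (_ ∷ v) = cong (_ ∷_) (map-shape-reduce v)

map-shape : ∀ J n → map shape (superpartitions J n) ≡ shapes J n
map-shape J n = map-shape-reduce (shapes-sound J n)

superpartitions-unique : ∀ J n → Unique (superpartitions J n)
superpartitions-unique J n = map⁻ (subst Unique (sym (map-shape J n))
  (cartesianProduct⁺ (strictLists-unique n) (partitions-unique J n)))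

-- The degree of p[ Λ ] in (x, θ).
size : Superpartition → ℕ
size Λ = sum (map suc (Λᵃ Λ)) ℕ.+ sum (Λˢ Λ)

All-<-sum : ∀ a → All (_< suc (sum (map suc a))) a
All-<-sum a = All.map (λ i≤ → ℕ.≤-trans i≤ (ℕ.n≤1+n _)) (All.map⁻ (All-≤-sum (map suc a)))

length≤sum : ∀ {s} → All NonZero s → length s ≤ sum s
length≤sum {[]}        []        = z≤n
length≤sum {suc n ∷ s} (_ ∷ nzs) = s≤s (ℕ.≤-trans (length≤sum nzs) (ℕ.m≤n+m (sum s) n))

-- A strict part i accounts for i + 1 in `size`, hence lies below `suc D`. The weak parts share the
-- bound `suc D`, so that both logarithmic derivatives stop at the same index; their number is at
-- most D because each is at least 1.
shape∈shapes : ∀ D Λ → size Λ ≤ D → shape Λ ∈ shapes D (suc D)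
shape∈shapes D Λ size≤D = ∈-cartesianProduct⁺
  (strictLists-complete (suc D) (Linked⇒AllPairs (λ j<i k<j → ℕ.<-trans k<j j<i) (Λᵃ-strict Λ) ,
    All.map (λ i< → ℕ.≤-trans i< (s≤s a≤D)) (All-<-sum (Λᵃ Λ))))
  (partitions-complete D (suc D) (Linked⇒AllPairs (λ j≤i k≤j → ℕ.≤-trans k≤j j≤i) (Λˢ-weak Λ) , Λˢ-nonZero Λ ,
    All.map (λ i≤ → ℕ.m≤n⇒m≤1+n (ℕ.≤-trans i≤ s≤D)) (All-≤-sum (Λˢ Λ)))
    (ℕ.≤-trans (length≤sum (Λˢ-nonZero Λ)) s≤D))
  where
  a≤D : sum (map suc (Λᵃ Λ)) ≤ D
  a≤D = ℕ.m+n≤o⇒m≤o _ size≤D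
  s≤D : sum (Λˢ Λ) ≤ D
  s≤D = ℕ.m+n≤o⇒n≤o (sum (map suc (Λᵃ Λ))) size≤D

superpartitions-complete : ∀ D Λ → size Λ ≤ D → Λ ∈ superpartitions D (suc D)
superpartitions-complete D Λ size≤D
  with Μ , Μ∈ , eq ← ∈-map⁻ shape (subst (shape Λ ∈_) (sym (map-shape D (suc D))) (shape∈shapes D Λ size≤D)) =
  subst (_∈ superpartitions D (suc D)) (sym (shape-injective eq)) Μ∈

-- Reciprocals, and homogeneity of products of power sums

reciprocal-* : ∀ m n → reciprocal (m ℕ.* n) ≡ reciprocal m ℚ.* reciprocal n
reciprocal-* zero    n       = sym (ℚ.*-zeroˡ (reciprocal n))
reciprocal-* (suc m) zero    = trans (cong reciprocal (ℕ.*-zeroʳ m)) (sym (ℚ.*-zeroʳ (reciprocal (suc m))))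
reciprocal-* (suc m) (suc n) = fromℕ-cancel (n ℕ.+ m ℕ.* suc n) (begin
  fromℕ (suc m ℕ.* suc n) ℚ.* reciprocal (suc m ℕ.* suc n)
    ≡⟨ fromℕ-*-reciprocal (n ℕ.+ m ℕ.* suc n) ⟩
  1ℚ
    ≡⟨⟩
  1ℚ ℚ.* 1ℚ
    ≡⟨ cong₂ ℚ._*_ (fromℕ-*-reciprocal m) (fromℕ-*-reciprocal n) ⟨
  (fromℕ (suc m) ℚ.* reciprocal (suc m)) ℚ.* (fromℕ (suc n) ℚ.* reciprocal (suc n))
    ≡⟨ interchange (fromℕ (suc m)) (reciprocal (suc m)) (fromℕ (suc n)) (reciprocal (suc n)) ⟩
  (fromℕ (suc m) ℚ.* fromℕ (suc n)) ℚ.* (reciprocal (suc m) ℚ.* reciprocal (suc n))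
    ≡⟨ cong (ℚ._* (reciprocal (suc m) ℚ.* reciprocal (suc n))) (fromℕ-* (suc m) (suc n)) ⟨
  fromℕ (suc m ℕ.* suc n) ℚ.* (reciprocal (suc m) ℚ.* reciprocal (suc n)) ∎)
  where
  open ≡-Reasoning
  interchange : ∀ p q r s → (p ℚ.* q) ℚ.* (r ℚ.* s) ≡ (p ℚ.* r) ℚ.* (q ℚ.* s)
  interchange = solve-∀ ℚ-ring

fromℕ-cancel-reciprocal : ∀ m n → fromℕ (suc m) ℚ.* reciprocal (suc m ℕ.* n) ≡ reciprocal n
fromℕ-cancel-reciprocal m n = begin
  fromℕ (suc m) ℚ.* reciprocal (suc m ℕ.* n)               ≡⟨ cong (fromℕ (suc m) ℚ.*_) (reciprocal-* (suc m) n) ⟩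
  fromℕ (suc m) ℚ.* (reciprocal (suc m) ℚ.* reciprocal n)  ≡⟨ ℚ.*-assoc (fromℕ (suc m)) (reciprocal (suc m)) (reciprocal n) ⟨
  (fromℕ (suc m) ℚ.* reciprocal (suc m)) ℚ.* reciprocal n  ≡⟨ cong (ℚ._* reciprocal n) (fromℕ-*-reciprocal m) ⟩
  1ℚ ℚ.* reciprocal n                                      ≡⟨ ℚ.*-identityˡ (reciprocal n) ⟩
  reciprocal n                                             ∎
  where open ≡-Reasoning

1/n≡reciprocal : ∀ n (n≢0 : NonZero n) → (ℤ.+ 1 ℚ./ n) {{n≢0}} ≡ reciprocal n
1/n≡reciprocal (suc n) _ = refl

∏≡⨂ : ∀ (f : A → Series) as → ∏ (map f as) ≡ ⨂ f as
∏≡⨂ f []       = 1≡𝟏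
∏≡⨂ f (a ∷ as) = trans (*≡⊗ (f a) (∏ (map f as))) (cong (f a ⊗_) (∏≡⨂ f as))

∑≡⨁ : ∀ (f : A → Series) as → ∑ (map f as) ≡ ⨁ f as
∑≡⨁ f []       = 0≡𝟎
∑≡⨁ f (a ∷ as) = trans (+≡⊕ (f a) (∑ (map f as))) (cong (f a ⊕_) (∑≡⨁ f as))

Homogeneous-⨂ : ∀ G {f : A → Series} {d} as → (∀ a → Homogeneous G (f a) (d a)) → Homogeneous G (⨂ f as) (sum (map d as))
Homogeneous-⨂ G []       hf = Homogeneous-𝟏 G
Homogeneous-⨂ G (a ∷ as) hf = Homogeneous-⊗ G (hf a) (Homogeneous-⨂ G as hf)

Homogeneous-⊙ : ∀ G q {f d} → Homogeneous G f d → Homogeneous G (q ⊙ f) d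
Homogeneous-⊙ G q {f} hf m m≢d = trans (coeff-⊙ q f m) (trans (cong (q ℚ.*_) (hf m m≢d)) (ℚ.*-zeroʳ q))

p̃-homogeneous : ∀ G a n → Homogeneous G (p̃ a n) (weight G (fermionic a n))
p̃-homogeneous G a n = Homogeneous-sumOverVariables G (fermionic a n) (fermionic≢𝟘 a n)

powerSum-homogeneous : ∀ G a n → Homogeneous G (powerSum a n) (weight G (bosonic a n))
powerSum-homogeneous G xθ zero    = subst (Homogeneous G 𝟏) (sym (weight-𝟘 G)) (Homogeneous-𝟏 G)
powerSum-homogeneous G yφ zero    = subst (Homogeneous G 𝟏) (sym (weight-𝟘 G)) (Homogeneous-𝟏 G)
powerSum-homogeneous G a  (suc n) = Homogeneous-sumOverVariables G (bosonic a (suc n)) (bosonic≢𝟘 a (suc n))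

powerSum-even : ∀ a n → Homogeneous oddGrading (powerSum a n) 0
powerSum-even xθ n = powerSum-homogeneous oddGrading xθ n
powerSum-even yφ n = powerSum-homogeneous oddGrading yφ n

p̃-odd : ∀ a n → Homogeneous oddGrading (p̃ a n) 1
p̃-odd xθ n = p̃-homogeneous oddGrading xθ n
p̃-odd yφ n = p̃-homogeneous oddGrading yφ n

w-homogeneous : ∀ n → Homogeneous xθ-grading (w n) (suc n)
w-homogeneous n = subst (Homogeneous xθ-grading (w n)) (trans (ℕ.+-identityʳ (n ℕ.+ 1)) (ℕ.+-comm n 1))
  (Homogeneous-⊗ xθ-grading (p̃-homogeneous xθ-grading xθ n) (p̃-homogeneous xθ-grading yφ n))

u-homogeneous : ∀ n → Homogeneous xθ-grading (u n) n
u-homogeneous n = subst (Homogeneous xθ-grading (u n)) (trans (ℕ.+-identityʳ (n ℕ.+ 0)) (ℕ.+-identityʳ n))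
  (Homogeneous-⊗ xθ-grading (powerSum-homogeneous xθ-grading xθ n) (powerSum-homogeneous xθ-grading yφ n))

sum-map-const : ∀ c (as : List A) → sum (map (λ _ → c) as) ≡ length as ℕ.* c
sum-map-const c []       = refl
sum-map-const c (a ∷ as) = cong (c ℕ.+_) (sum-map-const c as)

sum-map-id : ∀ s → sum (map (λ n → n) s) ≡ sum s
sum-map-id []      = refl
sum-map-id (n ∷ s) = cong (n ℕ.+_) (sum-map-id s)

Homogeneous-⨂-const : ∀ G {f : A → Series} {c} as → (∀ a → Homogeneous G (f a) c) → Homogeneous G (⨂ f as) (length as ℕ.* c)
Homogeneous-⨂-const G {f} {c} as hf = subst (Homogeneous G (⨂ f as)) (sum-map-const c as) (Homogeneous-⨂ G as hf)

⨂-p̃-homogeneous : ∀ G a → (∀ n → weight G (fermionic a n) ≡ 1) → ∀ ns → Homogeneous G (⨂ (p̃ a) ns) (length ns)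
⨂-p̃-homogeneous G a w≡1 ns = subst (Homogeneous G (⨂ (p̃ a) ns)) (ℕ.*-identityʳ (length ns))
  (Homogeneous-⨂-const G ns (λ n → subst (Homogeneous G (p̃ a n)) (w≡1 n) (p̃-homogeneous G a n)))

⨂-powerSum-homogeneous : ∀ G a → (∀ n → weight G (bosonic a n) ≡ 0) → ∀ ns → Homogeneous G (⨂ (powerSum a) ns) 0
⨂-powerSum-homogeneous G a w≡0 ns = subst (Homogeneous G (⨂ (powerSum a) ns)) (ℕ.*-zeroʳ (length ns))
  (Homogeneous-⨂-const G ns (λ n → subst (Homogeneous G (powerSum a n)) (w≡0 n) (powerSum-homogeneous G a n)))

triangle : ℕ → ℕ
triangle n = n ℕ.* (n ∸ 1) / 2

triangle-suc : ∀ n → triangle (suc n) ≡ n ℕ.+ triangle n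
triangle-suc zero    = refl
triangle-suc (suc n) = begin
  suc (suc n) ℕ.* suc n / 2                    ≡⟨ cong (_/ 2) (lemma n) ⟩
  (suc n ℕ.* 2 ℕ.+ suc n ℕ.* n) / 2            ≡⟨ +-distrib-/-∣ˡ (suc n ℕ.* n) (n∣m*n (suc n) {2}) ⟩
  suc n ℕ.* 2 / 2 ℕ.+ suc n ℕ.* n / 2          ≡⟨ cong (ℕ._+ suc n ℕ.* n / 2) (m*n/n≡m (suc n) 2) ⟩
  suc n ℕ.+ suc n ℕ.* n / 2                    ∎
  where
  open ≡-Reasoning
  lemma : ∀ n → suc (suc n) ℕ.* suc n ≡ suc n ℕ.* 2 ℕ.+ suc n ℕ.* n
  lemma = ℕ-Solver.solve-∀

powerSum-reduce : ∀ a {s} (nz : All NonZero s) → All.reduce (λ {n} n≢0 → p a n {{n≢0}}) nz ≡ map (powerSum a) s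
powerSum-reduce a {[]}        []       = refl
powerSum-reduce a {suc n ∷ s} (_ ∷ nz) = cong (p a (suc n) ∷_) (powerSum-reduce a nz)

zTerm : List ℕ → Series
zTerm s = reciprocal (zᴸ s) ⊙ ⨂ u s

term : Superpartition → Series
term Λ = z⁻¹ Λ • (reverseθ (p[ Λ ] xθ) * p[ Λ ] yφ)

shapeTerm : List ℕ × List ℕ → Series
shapeTerm (a , s) = ⨂ w a ⊗ zTerm s

strictSum : ℕ → Series
strictSum n = ⨁ (⨂ w) (strictLists n)

partitionSum : ℕ → ℕ → Series
partitionSum J k = ⨁ zTerm (partitions J k)

exponentialTerm : ℕ → ℕ → Series
exponentialTerm k j = reciprocal (k ^ j ℕ.* j !) ⊙ power (u k) j

-- exp (u k / k), cut off after the J-th term.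
exponential : ℕ → ℕ → Series
exponential J k = sumTo (exponentialTerm k) (suc J)

-- The sum over superpartitions and its logarithmic derivative

module Superpartitions (N D : ℕ) where
  open Kernel N D public
  open SetoidReasoning setoid

  w-central : ∀ n → Central (w n)
  w-central n = even-central 1 (Homogeneous-⊗ oddGrading (p̃-odd xθ n) (p̃-odd yφ n))

  u-central : ∀ n → Central (u n)
  u-central n = even-central 0 (Homogeneous-⊗ oddGrading (powerSum-even xθ n) (powerSum-even yφ n))

  powerSums-central : ∀ a ns → Central (⨂ (powerSum a) ns)
  powerSums-central xθ ns = even-central 0 (⨂-powerSum-homogeneous oddGrading xθ (λ _ → refl) ns)
  powerSums-central yφ ns = even-central 0 (⨂-powerSum-homogeneous oddGrading yφ (λ _ → refl) ns)

  ⨂-replicate-++ : ∀ (f : A → Series) j a bs → ⨂ f (replicate j a ++ bs) ∼ power (f a) j ⊗ ⨂ f bs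
  ⨂-replicate-++ f zero    a bs = ∼-sym (*-identityˡ (⨂ f bs))
  ⨂-replicate-++ f (suc j) a bs =
    ∼-trans (*-congˡ (⨂-replicate-++ f j a bs)) (∼-sym (*-assoc (f a) (power (f a) j) (⨂ f bs)))

  reverseθ-cong : ∀ {f g} → f ∼ g → reverseθ f ∼ reverseθ g
  reverseθ-cong f∼g = agreeing (λ m l d → cong (sign (triangle (θ-degree m)) ℚ.*_) (agree f∼g m l d))

  reverseθ-homogeneous : ∀ {f d} → Homogeneous θ-grading f d → reverseθ f ∼ sign (triangle d) ⊙ f
  reverseθ-homogeneous {f} {d} hf = agreeing (λ m _ _ → go m)
    where
    go : ∀ m → coeff (reverseθ f) m ≡ coeff (sign (triangle d) ⊙ f) m
    go m with degree θ-grading m ℕ.≟ d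
    ... | yes refl = trans (cong (λ e → sign (triangle e) ℚ.* coeff f m) (θ-degree≡degree m)) (sym (coeff-⊙ (sign (triangle d)) f m))
    ... | no  m≢d  = trans (vanish (sign (triangle (θ-degree m)))) (trans (sym (vanish (sign (triangle d)))) (sym (coeff-⊙ (sign (triangle d)) f m)))
      where
      vanish : ∀ q → q ℚ.* coeff f m ≡ 0ℚ
      vanish q = trans (cong (q ℚ.*_) (hf m m≢d)) (ℚ.*-zeroʳ q)

  p[]-factors : ∀ Λ a → p[ Λ ] a ∼ ⨂ (p̃ a) (Λᵃ Λ) ⊗ ⨂ (powerSum a) (Λˢ Λ)
  p[]-factors Λ a = begin
    ∏ (map (p̃ a) (Λᵃ Λ) ++ All.reduce (λ {n} n≢0 → p a n {{n≢0}}) (Λˢ-nonZero Λ))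
      ≡⟨ cong (λ fs → ∏ (map (p̃ a) (Λᵃ Λ) ++ fs)) (powerSum-reduce a (Λˢ-nonZero Λ)) ⟩
    ∏ (map (p̃ a) (Λᵃ Λ) ++ map (powerSum a) (Λˢ Λ))
      ≈⟨ split (Λᵃ Λ) ⟩
    ⨂ (p̃ a) (Λᵃ Λ) ⊗ ⨂ (powerSum a) (Λˢ Λ) ∎
    where
    split : ∀ ns → ∏ (map (p̃ a) ns ++ map (powerSum a) (Λˢ Λ)) ∼ ⨂ (p̃ a) ns ⊗ ⨂ (powerSum a) (Λˢ Λ)
    split []       = ∼-trans (≡⇒∼ (∏≡⨂ (powerSum a) (Λˢ Λ))) (∼-sym (*-identityˡ _))
    split (n ∷ ns) = begin
      p̃ a n * ∏ (map (p̃ a) ns ++ map (powerSum a) (Λˢ Λ))       ≡⟨ *≡⊗ (p̃ a n) _ ⟩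
      p̃ a n ⊗ ∏ (map (p̃ a) ns ++ map (powerSum a) (Λˢ Λ))       ≈⟨ *-congˡ (split ns) ⟩
      p̃ a n ⊗ (⨂ (p̃ a) ns ⊗ ⨂ (powerSum a) (Λˢ Λ))             ≈⟨ *-assoc (p̃ a n) (⨂ (p̃ a) ns) (⨂ (powerSum a) (Λˢ Λ)) ⟨
      (p̃ a n ⊗ ⨂ (p̃ a) ns) ⊗ ⨂ (powerSum a) (Λˢ Λ)             ∎

  ⨂-u : ∀ s → ⨂ (powerSum xθ) s ⊗ ⨂ (powerSum yφ) s ∼ ⨂ u s
  ⨂-u []      = *-identityˡ 𝟏
  ⨂-u (n ∷ s) = ∼-trans (⊗-interchange (powerSum xθ n) (powerSum yφ n) (⨂ (powerSum yφ) s) (powerSums-central xθ s))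
    (*-congˡ (⨂-u s))

  -- Moving p̃ₙ(y, φ) past the m factors p̃(x, θ) costs (-1)^m, and m + m(m-1)/2 = (m+1)m/2.
  ⨂-w : ∀ a → sign (triangle (length a)) ⊙ (⨂ (p̃ xθ) a ⊗ ⨂ (p̃ yφ) a) ∼ ⨂ w a
  ⨂-w []      = ∼-trans (⊙-identity (𝟏 ⊗ 𝟏)) (*-identityˡ 𝟏)
  ⨂-w (n ∷ a) = begin
    sign (triangle (suc (length a))) ⊙ ((p̃ xθ n ⊗ Pˣ) ⊗ (p̃ yφ n ⊗ Pʸ))
      ≈⟨ ⊙-cong _ (*-assoc (p̃ xθ n) Pˣ (p̃ yφ n ⊗ Pʸ)) ⟩
    sign (triangle (suc (length a))) ⊙ (p̃ xθ n ⊗ (Pˣ ⊗ (p̃ yφ n ⊗ Pʸ)))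
      ≈⟨ ⊙-cong _ (*-congˡ (*-assoc Pˣ (p̃ yφ n) Pʸ)) ⟨
    sign (triangle (suc (length a))) ⊙ (p̃ xθ n ⊗ ((Pˣ ⊗ p̃ yφ n) ⊗ Pʸ))
      ≈⟨ ⊙-cong _ (*-congˡ (*-congʳ swap)) ⟩
    sign (triangle (suc (length a))) ⊙ (p̃ xθ n ⊗ ((sign (length a) ⊙ (p̃ yφ n ⊗ Pˣ)) ⊗ Pʸ))
      ≈⟨ ⊙-cong _ (*-congˡ (⊙-⊗ˡ (sign (length a)) (p̃ yφ n ⊗ Pˣ) Pʸ)) ⟩
    sign (triangle (suc (length a))) ⊙ (p̃ xθ n ⊗ (sign (length a) ⊙ ((p̃ yφ n ⊗ Pˣ) ⊗ Pʸ)))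
      ≈⟨ ⊙-cong _ (⊙-⊗ʳ (sign (length a)) (p̃ xθ n) ((p̃ yφ n ⊗ Pˣ) ⊗ Pʸ)) ⟩
    sign (triangle (suc (length a))) ⊙ sign (length a) ⊙ (p̃ xθ n ⊗ ((p̃ yφ n ⊗ Pˣ) ⊗ Pʸ))
      ≈⟨ ⊙-assoc (sign (triangle (suc (length a)))) (sign (length a)) _ ⟩
    (sign (triangle (suc (length a))) ℚ.* sign (length a)) ⊙ (p̃ xθ n ⊗ ((p̃ yφ n ⊗ Pˣ) ⊗ Pʸ))
      ≡⟨ cong (_⊙ (p̃ xθ n ⊗ ((p̃ yφ n ⊗ Pˣ) ⊗ Pʸ))) signs ⟩
    sign (triangle (length a)) ⊙ (p̃ xθ n ⊗ ((p̃ yφ n ⊗ Pˣ) ⊗ Pʸ))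
      ≈⟨ ⊙-cong _ (*-congˡ (*-assoc (p̃ yφ n) Pˣ Pʸ)) ⟩
    sign (triangle (length a)) ⊙ (p̃ xθ n ⊗ (p̃ yφ n ⊗ (Pˣ ⊗ Pʸ)))
      ≈⟨ ⊙-cong _ (*-assoc (p̃ xθ n) (p̃ yφ n) (Pˣ ⊗ Pʸ)) ⟨
    sign (triangle (length a)) ⊙ (w n ⊗ (Pˣ ⊗ Pʸ))
      ≈⟨ ⊙-⊗ʳ (sign (triangle (length a))) (w n) (Pˣ ⊗ Pʸ) ⟨
    w n ⊗ (sign (triangle (length a)) ⊙ (Pˣ ⊗ Pʸ))
      ≈⟨ *-congˡ (⨂-w a) ⟩
    w n ⊗ ⨂ w a ∎
    where
    Pˣ = ⨂ (p̃ xθ) a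
    Pʸ = ⨂ (p̃ yφ) a
    swap : Pˣ ⊗ p̃ yφ n ∼ sign (length a) ⊙ (p̃ yφ n ⊗ Pˣ)
    swap = ∼-trans (≈⇒∼ (⊗-supercomm-≈ {Pˣ} {p̃ yφ n} (⨂-p̃-homogeneous oddGrading xθ (λ _ → refl) a) (p̃-odd yφ n)))
      (≡⇒∼ (cong (λ k → sign k ⊙ (p̃ yφ n ⊗ Pˣ)) (ℕ.*-identityʳ (length a))))
    signs : sign (triangle (suc (length a))) ℚ.* sign (length a) ≡ sign (triangle (length a))
    signs = ≡-Reasoning.begin
      sign (triangle (suc (length a))) ℚ.* sign (length a)
        ≡-Reasoning.≡⟨ cong (λ k → sign k ℚ.* sign (length a)) (triangle-suc (length a)) ⟩
      sign (length a ℕ.+ triangle (length a)) ℚ.* sign (length a)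
        ≡-Reasoning.≡⟨ cong (ℚ._* sign (length a)) (sign-+ (length a) (triangle (length a))) ⟩
      (sign (length a) ℚ.* sign (triangle (length a))) ℚ.* sign (length a)
        ≡-Reasoning.≡⟨ regroup (sign (length a)) (sign (triangle (length a))) ⟩
      (sign (length a) ℚ.* sign (length a)) ℚ.* sign (triangle (length a))
        ≡-Reasoning.≡⟨ cong (ℚ._* sign (triangle (length a))) (sign-² (length a)) ⟩
      1ℚ ℚ.* sign (triangle (length a))
        ≡-Reasoning.≡⟨ ℚ.*-identityˡ (sign (triangle (length a))) ⟩
      sign (triangle (length a)) ≡-Reasoning.∎
      where
      regroup : ∀ p q → (p ℚ.* q) ℚ.* p ≡ (p ℚ.* p) ℚ.* q
      regroup = solve-∀ ℚ-ring

  -- The bosonic factors are central and contain no θ, so the reversal sign concerns the odd factors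
  -- alone, where `⨂-w` absorbs it.
  term∼shapeTerm : ∀ Λ → term Λ ∼ shapeTerm (shape Λ)
  term∼shapeTerm Λ = begin
    z⁻¹ Λ • (reverseθ (p[ Λ ] xθ) * p[ Λ ] yφ)
      ≡⟨ trans (•≡⊙ (z⁻¹ Λ) _) (cong₂ _⊙_ (1/n≡reciprocal (z Λ) (z≢0 Λ)) (*≡⊗ _ _)) ⟩
    c ⊙ (reverseθ (p[ Λ ] xθ) ⊗ p[ Λ ] yφ)
      ≈⟨ ⊙-cong c (⊗-cong (∼-trans (reverseθ-cong (p[]-factors Λ xθ)) reversed) (p[]-factors Λ yφ)) ⟩
    c ⊙ ((ε ⊙ (Aˣ ⊗ Bˣ)) ⊗ (Aʸ ⊗ Bʸ))
      ≈⟨ ⊙-cong c (⊙-⊗ˡ ε (Aˣ ⊗ Bˣ) (Aʸ ⊗ Bʸ)) ⟩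
    c ⊙ ε ⊙ ((Aˣ ⊗ Bˣ) ⊗ (Aʸ ⊗ Bʸ))
      ≈⟨ ⊙-cong c (⊙-cong ε (⊗-interchange Aˣ Aʸ Bʸ (powerSums-central xθ (Λˢ Λ)))) ⟩
    c ⊙ ε ⊙ ((Aˣ ⊗ Aʸ) ⊗ (Bˣ ⊗ Bʸ))
      ≈⟨ ⊙-cong c (⊙-⊗ˡ ε (Aˣ ⊗ Aʸ) (Bˣ ⊗ Bʸ)) ⟨
    c ⊙ ((ε ⊙ (Aˣ ⊗ Aʸ)) ⊗ (Bˣ ⊗ Bʸ))
      ≈⟨ ⊙-cong c (⊗-cong (⨂-w (Λᵃ Λ)) (⨂-u (Λˢ Λ))) ⟩
    c ⊙ (⨂ w (Λᵃ Λ) ⊗ ⨂ u (Λˢ Λ))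
      ≈⟨ ⊙-⊗ʳ c (⨂ w (Λᵃ Λ)) (⨂ u (Λˢ Λ)) ⟨
    ⨂ w (Λᵃ Λ) ⊗ (c ⊙ ⨂ u (Λˢ Λ)) ∎
    where
    c  = reciprocal (zᴸ (Λˢ Λ))
    ε  = sign (triangle (length (Λᵃ Λ)))
    Aˣ = ⨂ (p̃ xθ) (Λᵃ Λ)
    Aʸ = ⨂ (p̃ yφ) (Λᵃ Λ)
    Bˣ = ⨂ (powerSum xθ) (Λˢ Λ)
    Bʸ = ⨂ (powerSum yφ) (Λˢ Λ)
    reversed : reverseθ (Aˣ ⊗ Bˣ) ∼ ε ⊙ (Aˣ ⊗ Bˣ)
    reversed = ∼-trans (reverseθ-homogeneous (Homogeneous-⊗ θ-grading
        (⨂-p̃-homogeneous θ-grading xθ (λ _ → refl) (Λᵃ Λ)) (⨂-powerSum-homogeneous θ-grading xθ (λ _ → refl) (Λˢ Λ))))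
      (≡⇒∼ (cong (λ k → sign (triangle k) ⊙ (Aˣ ⊗ Bˣ)) (ℕ.+-identityʳ (length (Λᵃ Λ)))))

  term-vanish : ∀ Λ → D < size Λ → term Λ ∼ 𝟎
  term-vanish Λ D<Λ = ∼-trans (term∼shapeTerm Λ) (homogeneous-vanish
    (Homogeneous-⊗ xθ-grading (Homogeneous-⨂ xθ-grading (Λᵃ Λ) w-homogeneous)
      (Homogeneous-⊙ xθ-grading (reciprocal (zᴸ (Λˢ Λ)))
        (subst (Homogeneous xθ-grading (⨂ u (Λˢ Λ))) (sum-map-id (Λˢ Λ)) (Homogeneous-⨂ xθ-grading (Λˢ Λ) u-homogeneous)))) D<Λ)

  strictSum-suc : ∀ n → strictSum (suc n) ∼ (𝟏 ⊕ w n) ⊗ strictSum n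
  strictSum-suc n = begin
    ⨁ (⨂ w) (strictLists n ++ map (n ∷_) (strictLists n))
      ≈⟨ ⨁-++ (⨂ w) (strictLists n) (map (n ∷_) (strictLists n)) ⟩
    strictSum n ⊕ ⨁ (⨂ w) (map (n ∷_) (strictLists n))
      ≈⟨ +-congˡ (⨁-map (⨂ w) (n ∷_) (strictLists n)) ⟩
    strictSum n ⊕ ⨁ (λ a → w n ⊗ ⨂ w a) (strictLists n)
      ≈⟨ ⊕-cong (∼-sym (*-identityˡ (strictSum n))) (⨁-⊗ˡ (w n) (⨂ w) (strictLists n)) ⟩
    𝟏 ⊗ strictSum n ⊕ w n ⊗ strictSum n
      ≈⟨ distribʳ (strictSum n) 𝟏 (w n) ⟨
    (𝟏 ⊕ w n) ⊗ strictSum n ∎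

  1+w-logDerivative : ∀ n → 𝟏 ⊕ w n HasLogDerivative fromℕ (suc n) ⊙ w n
  1+w-logDerivative n = begin
    E (𝟏 ⊕ w n)                      ≈⟨ E-⊕ 𝟏 (w n) ⟩
    E 𝟏 ⊕ E (w n)                    ≈⟨ ⊕-cong E-𝟏 (E-homogeneous (w-homogeneous n)) ⟩
    𝟎 ⊕ c ⊙ w n                      ≈⟨ +-comm 𝟎 (c ⊙ w n) ⟩
    c ⊙ w n ⊕ 𝟎                      ≈⟨ ⊕-cong (∼-sym (*-identityʳ (c ⊙ w n))) (∼-sym square) ⟩
    (c ⊙ w n) ⊗ 𝟏 ⊕ (c ⊙ w n) ⊗ w n  ≈⟨ distribˡ (c ⊙ w n) 𝟏 (w n) ⟨
    (c ⊙ w n) ⊗ (𝟏 ⊕ w n)            ∎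
    where
    c = fromℕ (suc n)
    square : (c ⊙ w n) ⊗ w n ∼ 𝟎
    square = begin
      (c ⊙ w n) ⊗ w n         ≈⟨ *-congʳ (⊙-as-⊗ c (w n)) ⟩
      ((c ⊙ 𝟏) ⊗ w n) ⊗ w n   ≈⟨ *-assoc (c ⊙ 𝟏) (w n) (w n) ⟩
      (c ⊙ 𝟏) ⊗ (w n ⊗ w n)   ≈⟨ *-congˡ (odd-product-square (p̃-odd xθ n) (p̃-odd yφ n)) ⟩
      (c ⊙ 𝟏) ⊗ 𝟎             ≈⟨ zeroʳ (c ⊙ 𝟏) ⟩
      𝟎                       ∎

  strictSum-logDerivative : ∀ n → strictSum n HasLogDerivative sumTo (λ k → fromℕ (suc k) ⊙ w k) n
  strictSum-logDerivative zero    = HasLogDerivative-resp (∼-sym (+-identityʳ 𝟏)) ∼-refl HasLogDerivative-𝟏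
  strictSum-logDerivative (suc n) = HasLogDerivative-resp (∼-sym (strictSum-suc n)) (+-comm _ _)
    (HasLogDerivative-⊗ (Central-sumTo n (λ k → Central-⊙ (fromℕ (suc k)) (w-central k)))
      (1+w-logDerivative n) (strictSum-logDerivative n))

  ⨁-copies : ∀ (F : List ℕ → Series) k J ls →
    ⨁ F (copies k J ls) ∼ sumTo (λ j → ⨁ (λ s → F (replicate j k ++ s)) ls) (suc J)
  ⨁-copies F k zero    ls = ∼-sym (+-identityˡ (⨁ F ls))
  ⨁-copies F k (suc J) ls = ∼-trans (⨁-++ F (copies k J ls) (map (replicate (suc J) k ++_) ls))
    (⊕-cong (⨁-copies F k J ls) (⨁-map F (replicate (suc J) k ++_) ls))

  sumTo-⊗ʳ : ∀ f g n → sumTo (λ i → f i ⊗ g) n ∼ sumTo f n ⊗ g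
  sumTo-⊗ʳ f g zero    = ∼-sym (zeroˡ g)
  sumTo-⊗ʳ f g (suc n) = ∼-trans (+-congʳ (sumTo-⊗ʳ f g n)) (∼-sym (distribʳ g (sumTo f n) (f n)))

  zTerm-replicate : ∀ {k s} → Weak k s → ∀ j → zTerm (replicate j (suc k) ++ s) ∼ exponentialTerm (suc k) j ⊗ zTerm s
  zTerm-replicate {k} {s} ws j = begin
    reciprocal (zᴸ (replicate j (suc k) ++ s)) ⊙ ⨂ u (replicate j (suc k) ++ s)
      ≡⟨ cong (_⊙ ⨂ u (replicate j (suc k) ++ s)) (trans (cong reciprocal (zᴸ-replicate ws j)) (reciprocal-* (suc k ^ j ℕ.* j !) (zᴸ s))) ⟩
    (c ℚ.* d) ⊙ ⨂ u (replicate j (suc k) ++ s)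
      ≈⟨ ⊙-cong (c ℚ.* d) (⨂-replicate-++ u j (suc k) s) ⟩
    (c ℚ.* d) ⊙ (power (u (suc k)) j ⊗ ⨂ u s)
      ≈⟨ ⊙-assoc c d (power (u (suc k)) j ⊗ ⨂ u s) ⟨
    c ⊙ d ⊙ (power (u (suc k)) j ⊗ ⨂ u s)
      ≈⟨ ⊙-cong c (⊙-⊗ʳ d (power (u (suc k)) j) (⨂ u s)) ⟨
    c ⊙ (power (u (suc k)) j ⊗ zTerm s)
      ≈⟨ ⊙-⊗ˡ c (power (u (suc k)) j) (zTerm s) ⟨
    exponentialTerm (suc k) j ⊗ zTerm s ∎
    where
    c = reciprocal (suc k ^ j ℕ.* j !)
    d = reciprocal (zᴸ s)

  partitionSum-suc : ∀ J k → partitionSum J (suc k) ∼ exponential J (suc k) ⊗ partitionSum J k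
  partitionSum-suc J k = begin
    ⨁ zTerm (copies (suc k) J (partitions J k))
      ≈⟨ ⨁-copies zTerm (suc k) J (partitions J k) ⟩
    sumTo (λ j → ⨁ (λ s → zTerm (replicate j (suc k) ++ s)) (partitions J k)) (suc J)
      ≈⟨ sumTo-cong (suc J) (λ j → ∼-trans
           (⨁-cong (partitions J k) (λ s∈ → zTerm-replicate (All.lookup (partitions-sound J k) s∈) j))
           (⨁-⊗ˡ (exponentialTerm (suc k) j) zTerm (partitions J k))) ⟩
    sumTo (λ j → exponentialTerm (suc k) j ⊗ partitionSum J k) (suc J)
      ≈⟨ sumTo-⊗ʳ (exponentialTerm (suc k)) (partitionSum J k) (suc J) ⟩
    exponential J (suc k) ⊗ partitionSum J k ∎

  -- `E` multiplies the power by its degree (j + 1)(k + 1), exactly what (k + 1)^(j + 1) (j + 1)!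
  -- has in excess of (k + 1)^j j!.
  E-exponentialTerm : ∀ k j → E (exponentialTerm (suc k) (suc j)) ∼ u (suc k) ⊗ exponentialTerm (suc k) j
  E-exponentialTerm k j = begin
    E (c ⊙ power (u (suc k)) (suc j))
      ≈⟨ E-⊙ c (power (u (suc k)) (suc j)) ⟩
    c ⊙ E (power (u (suc k)) (suc j))
      ≈⟨ ⊙-cong c (E-homogeneous (Homogeneous-power xθ-grading (suc j) (u-homogeneous (suc k)))) ⟩
    c ⊙ fromℕ (suc j ℕ.* suc k) ⊙ power (u (suc k)) (suc j)
      ≈⟨ ⊙-assoc c (fromℕ (suc j ℕ.* suc k)) (power (u (suc k)) (suc j)) ⟩
    (c ℚ.* fromℕ (suc j ℕ.* suc k)) ⊙ power (u (suc k)) (suc j)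
      ≡⟨ cong (_⊙ power (u (suc k)) (suc j)) coefficient ⟩
    reciprocal (suc k ^ j ℕ.* j !) ⊙ (u (suc k) ⊗ power (u (suc k)) j)
      ≈⟨ ⊙-⊗ʳ (reciprocal (suc k ^ j ℕ.* j !)) (u (suc k)) (power (u (suc k)) j) ⟨
    u (suc k) ⊗ exponentialTerm (suc k) j ∎
    where
    c = reciprocal (suc k ^ suc j ℕ.* suc j !)
    regroup : ∀ K J P F → (K ℕ.* P) ℕ.* (J ℕ.* F) ≡ (J ℕ.* K) ℕ.* (P ℕ.* F)
    regroup = ℕ-Solver.solve-∀
    coefficient : c ℚ.* fromℕ (suc j ℕ.* suc k) ≡ reciprocal (suc k ^ j ℕ.* j !)
    coefficient = trans (ℚ.*-comm c (fromℕ (suc j ℕ.* suc k)))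
      (trans (cong (λ e → fromℕ (suc j ℕ.* suc k) ℚ.* reciprocal e) (regroup (suc k) (suc j) (suc k ^ j) (j !)))
        (fromℕ-cancel-reciprocal (k ℕ.+ j ℕ.* suc k) (suc k ^ j ℕ.* j !)))

  exponentialTerm-zero : ∀ k → exponentialTerm k 0 ∼ 𝟏
  exponentialTerm-zero k = ⊙-identity 𝟏

  E-exponential : ∀ k n → E (sumTo (exponentialTerm (suc k)) (suc n)) ∼ u (suc k) ⊗ sumTo (exponentialTerm (suc k)) n
  E-exponential k zero = begin
    E (𝟎 ⊕ exponentialTerm (suc k) 0)   ≈⟨ E-cong (∼-trans (+-identityˡ _) (exponentialTerm-zero (suc k))) ⟩
    E 𝟏                                 ≈⟨ E-𝟏 ⟩
    𝟎                                   ≈⟨ zeroʳ (u (suc k)) ⟨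
    u (suc k) ⊗ 𝟎                       ∎
  E-exponential k (suc n) = begin
    E (sumTo e (suc n) ⊕ e (suc n))               ≈⟨ E-⊕ (sumTo e (suc n)) (e (suc n)) ⟩
    E (sumTo e (suc n)) ⊕ E (e (suc n))           ≈⟨ ⊕-cong (E-exponential k n) (E-exponentialTerm k n) ⟩
    u (suc k) ⊗ sumTo e n ⊕ u (suc k) ⊗ e n       ≈⟨ distribˡ (u (suc k)) (sumTo e n) (e n) ⟨
    u (suc k) ⊗ (sumTo e n ⊕ e n)                 ∎
    where e = exponentialTerm (suc k)

  -- Differentiation shortens the sum by its last term. With the cut-off at D the missing
  -- contribution lies above degree D.
  exponential-logDerivative : ∀ k → exponential D (suc k) HasLogDerivative u (suc k)
  exponential-logDerivative k = begin
    E (exponential D (suc k))                     ≈⟨ E-exponential k D ⟩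
    u (suc k) ⊗ sumTo e D                         ≈⟨ +-identityʳ _ ⟨
    u (suc k) ⊗ sumTo e D ⊕ 𝟎                     ≈⟨ +-congˡ vanish ⟨
    u (suc k) ⊗ sumTo e D ⊕ u (suc k) ⊗ e D       ≈⟨ distribˡ (u (suc k)) (sumTo e D) (e D) ⟨
    u (suc k) ⊗ (sumTo e D ⊕ e D)                 ∎
    where
    e = exponentialTerm (suc k)
    -- The degree of u times the D-th term is (D + 1)(k + 1).
    D<deg : D < suc k ℕ.+ D ℕ.* suc k
    D<deg = s≤s (ℕ.≤-trans (ℕ.m≤m*n D (suc k)) (ℕ.m≤n+m (D ℕ.* suc k) k))
    vanish : u (suc k) ⊗ e D ∼ 𝟎
    vanish = homogeneous-vanish (Homogeneous-⊗ xθ-grading (u-homogeneous (suc k))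
      (Homogeneous-⊙ xθ-grading (reciprocal (suc k ^ D ℕ.* D !)) (Homogeneous-power xθ-grading D (u-homogeneous (suc k))))) D<deg

  partitionSum-zero : ∀ J → partitionSum J 0 ∼ 𝟏
  partitionSum-zero J = ∼-trans (+-identityʳ (zTerm [])) (⊙-identity 𝟏)

  partitionSum-logDerivative : ∀ k → partitionSum D k HasLogDerivative sumTo (λ n → u (suc n)) k
  partitionSum-logDerivative zero    = HasLogDerivative-resp (∼-sym (partitionSum-zero D)) ∼-refl HasLogDerivative-𝟏
  partitionSum-logDerivative (suc k) = HasLogDerivative-resp (∼-sym (partitionSum-suc D k)) (+-comm _ _)
    (HasLogDerivative-⊗ (Central-sumTo k (λ n → u-central (suc n))) (exponential-logDerivative k) (partitionSum-logDerivative k))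

  ⨁-term : ∀ J n → ⨁ term (superpartitions J n) ∼ strictSum n ⊗ partitionSum J n
  ⨁-term J n = begin
    ⨁ term (superpartitions J n)                    ≈⟨ ⨁-cong (superpartitions J n) (λ {Λ} _ → term∼shapeTerm Λ) ⟩
    ⨁ (shapeTerm ∘ shape) (superpartitions J n)     ≈⟨ ⨁-map shapeTerm shape (superpartitions J n) ⟨
    ⨁ shapeTerm (map shape (superpartitions J n))   ≡⟨ cong (⨁ shapeTerm) (map-shape J n) ⟩
    ⨁ shapeTerm (shapes J n)                        ≈⟨ ⨁-cartesianProduct (⨂ w) zTerm (strictLists n) (partitions J n) ⟩
    strictSum n ⊗ partitionSum J n                  ∎

  superpartitionSum-logDerivative : strictSum (suc D) ⊗ partitionSum D (suc D) HasLogDerivative logDerivative (suc D)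
  superpartitionSum-logDerivative = HasLogDerivative-resp ∼-refl (+-comm _ _)
    (HasLogDerivative-⊗ (Central-sumTo (suc D) (λ n → u-central (suc n)))
      (strictSum-logDerivative (suc D)) (partitionSum-logDerivative (suc D)))

-- Initial values in degree 0 and comparison of the two sides

module DegreeZero (N : ℕ) where
  open Superpartitions N 0

  w-𝟎 : ∀ n → w n ∼ 𝟎
  w-𝟎 n = homogeneous-vanish (w-homogeneous n) (s≤s z≤n)

  u-𝟎 : ∀ n → u (suc n) ∼ 𝟎
  u-𝟎 n = homogeneous-vanish (u-homogeneous (suc n)) (s≤s z≤n)

  ⊙-𝟎 : ∀ q {f} → f ∼ 𝟎 → q ⊙ f ∼ 𝟎
  ⊙-𝟎 q {f} f∼𝟎 = ∼-trans (⊙-as-⊗ q f) (∼-trans (*-congˡ f∼𝟎) (zeroʳ (q ⊙ 𝟏)))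

  logDerivative-𝟎 : ∀ n → logDerivative n ∼ 𝟎
  logDerivative-𝟎 n = ∼-trans (⊕-cong (sumTo-𝟎 n u-𝟎) (sumTo-𝟎 n (λ k → ⊙-𝟎 (fromℕ (suc k)) (w-𝟎 k)))) (+-identityˡ 𝟎)

  -- With D = 0 the congruence compares exactly the components of degree 0. The bound n stays free,
  -- as it has to be `suc D` for the D of the expansion.
  strictSum-𝟏 : ∀ n → strictSum n ∼ 𝟏
  strictSum-𝟏 zero    = +-identityʳ 𝟏
  strictSum-𝟏 (suc n) = ∼-trans (strictSum-suc n) (∼-trans
    (⊗-cong (∼-trans (+-congˡ (w-𝟎 n)) (+-identityʳ 𝟏)) (strictSum-𝟏 n)) (*-identityˡ 𝟏))

  exponential-𝟏 : ∀ J k → exponential J (suc k) ∼ 𝟏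
  exponential-𝟏 zero    k = ∼-trans (+-identityˡ _) (exponentialTerm-zero (suc k))
  exponential-𝟏 (suc J) k = ∼-trans (⊕-cong (exponential-𝟏 J k)
    (⊙-𝟎 _ (∼-trans (*-congʳ (u-𝟎 k)) (zeroˡ (power (u (suc k)) J))))) (+-identityʳ 𝟏)

  partitionSum-𝟏 : ∀ J k → partitionSum J k ∼ 𝟏
  partitionSum-𝟏 J zero    = partitionSum-zero J
  partitionSum-𝟏 J (suc k) = ∼-trans (partitionSum-suc J k)
    (∼-trans (⊗-cong (exponential-𝟏 J k) (partitionSum-𝟏 J k)) (*-identityˡ 𝟏))

  superpartitionSum-𝟏 : ∀ J n → strictSum n ⊗ partitionSum J n ∼ 𝟏
  superpartitionSum-𝟏 J n = ∼-trans (⊗-cong (strictSum-𝟏 n) (partitionSum-𝟏 J n)) (*-identityˡ 𝟏)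

  inverses-𝟏 : ∀ {inv : ℕ × ℕ → Series} → (∀ ij → inv ij * denominator ij ≈ 1#) → ∀ L → ⨂ inv L ∼ 𝟏
  inverses-𝟏 inverse []       = ∼-refl
  inverses-𝟏 inverse (ij ∷ L) = ∼-trans
    -- At D = 0 the geometric series consists of its constant term and unfolds to `𝟎 ⊕ 𝟏`.
    (⊗-cong (∼-trans (inverse-unique ij (inverse ij)) (+-identityˡ 𝟏)) (inverses-𝟏 inverse L)) (*-identityˡ 𝟏)

module Expansion (N D : ℕ) where
  open Superpartitions N D public
  open SetoidReasoning setoid
  private
    module D₀ = Superpartitions N 0
    module Z = DegreeZero N

  logDerivative-determines : ∀ {f g} → f HasLogDerivative logDerivative (suc D) → g HasLogDerivative logDerivative (suc D) →
    f D₀.∼ 𝟏 → g D₀.∼ 𝟏 → f ∼ g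
  logDerivative-determines hf hg f₀ g₀ = logDerivative-unique hf hg
    (λ m l d → trans (D₀.agree (Z.logDerivative-𝟎 (suc D)) m l (ℕ.≤-reflexive d)) (coeff-𝟎 m))
    (λ m l d → D₀.agree (D₀.∼-trans f₀ (D₀.∼-sym g₀)) m l (ℕ.≤-reflexive d))

  -- Convergence of the infinite product: any two lists containing `pairs N` give products with the
  -- same logarithmic derivative and the same initial value.
  ⨂-inverses-unique : ∀ {inv : ℕ × ℕ → Series} → (∀ ij → inv ij * denominator ij ≈ 1#) →
    ∀ {L L′} → Unique L → pairs N ⊆ L → Unique L′ → pairs N ⊆ L′ → ⨂ inv L ∼ ⨂ inv L′
  ⨂-inverses-unique inverse {L} {L′} uL ⊆L uL′ ⊆L′ = logDerivative-determines
    (inverses-logDerivative inverse uL ⊆L) (inverses-logDerivative inverse uL′ ⊆L′)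
    (Z.inverses-𝟏 inverse L) (Z.inverses-𝟏 inverse L′)

  ⨁-term∼⨂-inverses : ∀ {inv : ℕ × ℕ → Series} → (∀ ij → inv ij * denominator ij ≈ 1#) →
    ∀ {L} → Unique L → pairs N ⊆ L → ∀ {M} → Unique M → superpartitions D (suc D) ⊆ M → ⨁ term M ∼ ⨂ inv L
  ⨁-term∼⨂-inverses {inv} inverse {L} uL ⊆L {M} uM ⊆M = begin
    ⨁ term M                                        ≈⟨ ⨁-⊆ term (superpartitions-unique D (suc D)) uM ⊆M vanish ⟩
    ⨁ term (superpartitions D (suc D))              ≈⟨ ⨁-term D (suc D) ⟩
    strictSum (suc D) ⊗ partitionSum D (suc D)      ≈⟨ logDerivative-determines superpartitionSum-logDerivative
                                                         (inverses-logDerivative inverse uL ⊆L)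
                                                         (Z.superpartitionSum-𝟏 D (suc D)) (Z.inverses-𝟏 inverse L) ⟩
    ⨂ inv L                                         ∎
    where
    vanish : ∀ {Λ} → Λ ∈ M → Λ ∉ superpartitions D (suc D) → term Λ ∼ 𝟎
    vanish {Λ} _ Λ∉ = term-vanish Λ (ℕ.≰⇒> (λ size≤D → Λ∉ (superpartitions-complete D Λ size≤D)))

-- Existence of the kernel, and the expansion

inverseDenominator : ℕ × ℕ → Series
-- Powers of t beyond the degree of m do not reach the coefficient of m, so the infinite geometric
-- series is read off from truncations that grow with m.
inverseDenominator ij .coeff    m = coeff (geometric (τ ij) (suc (xθ-degree m))) m
inverseDenominator ij .coherent m = trans
  (cong (λ d → coeff (geometric (τ ij) (suc d)) (m ∷ʳ 𝟘)) (degree-∷ʳ xθ-grading m))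
  (coherent (geometric (τ ij) (suc (xθ-degree m))) m)

module _ (N D : ℕ) where
  open Kernel N D

  inverseDenominator∼geometric : ∀ ij → inverseDenominator ij ∼ geometric (τ ij) (suc D)
  inverseDenominator∼geometric ij = agreeing λ m l m≤D →
    -- Modulo the degree of m itself, the longer sum with `suc D` terms already agrees with the one
    -- that defines this coefficient.
    let open Kernel N (xθ-degree m) using () renaming (agree to agreeₘ; geometric-stable to stableₘ; ∼-sym to symₘ)
        k = D ∸ xθ-degree m
        k+1+d≡1+D : k ℕ.+ suc (xθ-degree m) ≡ suc D
        k+1+d≡1+D = trans (ℕ.+-suc k (xθ-degree m)) (cong suc (ℕ.m∸n+n≡m m≤D))
    in trans (sym (agreeₘ (stableₘ (τ-homogeneous ij) k) m l ℕ.≤-refl)) (cong (λ n → coeff (geometric (τ ij) n) m) k+1+d≡1+D)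

inverseDenominator-inverse : ∀ ij → Invertible _≈_ 1# _*_ (denominator ij)
inverseDenominator-inverse ij = inverseDenominator ij , leftInverse , rightInverse
  where
  leftInverse : inverseDenominator ij * denominator ij ≈ 1#
  leftInverse m = agree equation m refl ℕ.≤-refl
    where
    open Kernel (length m) (xθ-degree m)
    equation : inverseDenominator ij * denominator ij ∼ 1#
    equation = ∼-trans (≡⇒∼ (*≡⊗ _ _)) (∼-trans
      (⊗-cong (inverseDenominator∼geometric (length m) (xθ-degree m) ij) (≈⇒∼ (denominator≈ ij)))
      (∼-trans (geometric-inverseˡ (τ-central ij) (τ-homogeneous ij)) (≡⇒∼ (sym 1≡𝟏))))
  rightInverse : denominator ij * inverseDenominator ij ≈ 1#
  rightInverse m = agree equation m refl ℕ.≤-refl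
    where
    open Kernel (length m) (xθ-degree m)
    equation : denominator ij * inverseDenominator ij ∼ 1#
    equation = ∼-trans (≡⇒∼ (*≡⊗ _ _)) (∼-trans
      (⊗-cong (≈⇒∼ (denominator≈ ij)) (inverseDenominator∼geometric (length m) (xθ-degree m) ij))
      (∼-trans (geometric-inverseʳ (τ-central ij) (τ-homogeneous ij)) (≡⇒∼ (sym 1≡𝟏))))

inverseDenominator-inverseˡ : ∀ ij → inverseDenominator ij * denominator ij ≈ 1#
inverseDenominator-inverseˡ ij = proj₁ (proj₂ (inverseDenominator-inverse ij))

pairs-⊆ : ∀ n → pairs n ⊆ pairs (suc n)
pairs-⊆ n {i , j} ij∈ with i<n , j<n ← ∈-pairs⁻ {n} ij∈ = ∈-pairs⁺ {suc n} (ℕ.m<n⇒m<1+n i<n) (ℕ.m<n⇒m<1+n j<n)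

-- At m only pairs of indices below `length m` matter. Padding m enlarges this set of pairs, so
-- coherence is the independence of the product from the chosen list.
kernel : Series
kernel .coeff    m = coeff (⨂ inverseDenominator (pairs (length m))) m
kernel .coherent m = begin
  coeff (⨂ inverseDenominator (pairs (length (m ∷ʳ 𝟘)))) (m ∷ʳ 𝟘)
    ≡⟨ coherent (⨂ inverseDenominator (pairs (length (m ∷ʳ 𝟘)))) m ⟩
  coeff (⨂ inverseDenominator (pairs (length (m ∷ʳ 𝟘)))) m
    ≡⟨ cong (λ n → coeff (⨂ inverseDenominator (pairs n)) m) (length-∷ʳ m) ⟩
  coeff (⨂ inverseDenominator (pairs (suc (length m)))) m
    ≡⟨ agree (⨂-inverses-unique inverseDenominator-inverseˡ (pairs-unique (suc (length m))) (pairs-⊆ (length m))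
         (pairs-unique (length m)) (λ ij∈ → ij∈)) m refl ℕ.≤-refl ⟩
  coeff (⨂ inverseDenominator (pairs (length m))) m ∎
  where
  open ≡-Reasoning
  open Expansion (length m) (xθ-degree m)

-- The expansion is asserted for every K satisfying `IsKernel`; this shows that the assertion is not
-- vacuous.
kernel-isKernel : IsKernel kernel
kernel-isKernel = inverseDenominator-inverse , λ m → let open Expansion (length m) (xθ-degree m) in
  pairs (length m) , λ L uL pairs⊆L → trans (cong (λ f → coeff f m) (∏≡⨂ inverseDenominator L))
    (agree (⨂-inverses-unique inverseDenominator-inverseˡ uL pairs⊆L (pairs-unique (length m)) (λ ij∈ → ij∈)) m refl ℕ.≤-refl)

kernel-expansion : ∀ K → IsKernel K → HasSum term K
kernel-expansion K (inv , product) m = superpartitions (xθ-degree m) (suc (xθ-degree m)) , expand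
  where
  open Expansion (length m) (xθ-degree m)
  open ≡-Reasoning
  L₀ L : List (ℕ × ℕ)
  L₀ = proj₁ (product m)
  -- The list must contain `L₀`, for its product to have the coefficient of K at m, and
  -- `pairs (length m)`, for its logarithmic derivative to be known; both statements ask for a list
  -- without duplicates.
  L  = deduplicate (≡-dec ℕ._≟_ ℕ._≟_) (L₀ ++ pairs (length m))
  uL : Unique L
  uL = deduplicate-! (≡-dec ℕ._≟_ ℕ._≟_) (L₀ ++ pairs (length m))
  L₀⊆L : L₀ ⊆ L
  L₀⊆L ij∈ = ∈-deduplicate⁺ (≡-dec ℕ._≟_ ℕ._≟_) (∈-++⁺ˡ ij∈)
  pairs⊆L : pairs (length m) ⊆ L
  pairs⊆L ij∈ = ∈-deduplicate⁺ (≡-dec ℕ._≟_ ℕ._≟_) (∈-++⁺ʳ L₀ ij∈)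
  expand : ∀ M → Unique M → superpartitions (xθ-degree m) (suc (xθ-degree m)) ⊆ M → coeff (∑ (map term M)) m ≡ coeff K m
  expand M uM ⊆M = begin
    coeff (∑ (map term M)) m
      ≡⟨ cong (λ f → coeff f m) (∑≡⨁ term M) ⟩
    coeff (⨁ term M) m
      ≡⟨ agree (⨁-term∼⨂-inverses (λ ij → proj₁ (proj₂ (inv ij))) uL pairs⊆L uM ⊆M) m refl ℕ.≤-refl ⟩
    coeff (⨂ (proj₁ ∘ inv) L) m
      ≡⟨ cong (λ f → coeff f m) (∏≡⨂ (proj₁ ∘ inv) L) ⟨
    coeff (∏ (map (proj₁ ∘ inv) L)) m
      ≡⟨ proj₂ (product m) L uL L₀⊆L ⟩
    coeff K m ∎

theorem29 :
  ∃ IsKernel ×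
  (∀ K → IsKernel K →
    HasSum (λ Λ → z⁻¹ Λ • (reverseθ (p[ Λ ] xθ) * p[ Λ ] yφ)) K)
theorem29 = (kernel , kernel-isKernel) , kernel-expansion
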